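{- There is an algorithm that, given a graph $G$ on $n$ vertices, a split deletion set $S \subseteq V(G)$ of $G$ and a positive integer $\ell$, determines whether $G$ has a connected vertex cover of size at most $\ell$ in $\mathcal{O}^*(3^{|S|})$ time. Moreover, under the Set Cover Conjecture, for no $\epsilon>0$ does there exist an algorithm for this problem running in $\mathcal{O}^*((2-\epsilon)^{|S|})$ time. Further, if $S$ is a clique deletion set of $G$, then there is an algorithm that solves the problem in $\mathcal{O}^*(2^{|S|})$ time.
   Context: All graphs are finite, simple and undirected. A vertex cover of $G$ is a set of vertices containing at least one endpoint of every edge of $G$; a connected vertex cover is a vertex cover $X$ such that the induced subgraph $G[X]$ is connected. A split graph is a graph whose vertex set can be partitioned into a clique and an independent set. A split deletion set of $G$ is a set $S\subseteq V(G)$ such that $G-S$ is a split graph; a clique deletion set is a set $S\subseteq V(G)$ such that $G-S$ is a complete graph. The set $S$ is part of the input. $\mathcal{O}^*(f(k))$ denotes running time $f(k)\, n^{\mathcal{O}(1)}$ where $n$ is the input size. Set Cover: given a family $\mathcal{F}$ of subsets of a universe $U$ and a positive integer $\ell$, decide whether there is $\mathcal{F}'\subseteq\mathcal{F}$ with $|\mathcal{F}'|\le \ell$ and $\bigcup_{X\in\mathcal{F}'}X=U$. The Set Cover Conjecture states that, for every $\epsilon>0$, Set Cover has no $\mathcal{O}^*((2-\epsilon)^{|U|})$ time algorithm. A known consequence (which may be taken as given) is that, under this conjecture, deciding whether a graph has a connected vertex cover of size at most $\ell$ has no $\mathcal{O}^*((2-\epsilon)^{\ell})$ time algorithm for any $\epsilon>0$.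 -}

module Defs where

open import Algebra.Definitions.RawSemiring as RawSemiring using ()
open import Data.Bool.Base using (Bool; true; false; T)
open import Data.Fin.Base using (Fin; zero; suc)
open import Data.Fin.Subset using (Subset; _∈_; ∁; ∣_∣; ⋃; ⊤)
open import Data.Integer.Base using (+_)
open import Data.List.Base as List using (List; []; _∷_; length)
open import Data.List.Relation.Binary.Subset.Propositional using (_⊆_)
open import Data.Nat.Base as ℕ using (ℕ; zero; suc)
open import Data.Nat.Binary.Base using (ℕᵇ; zero; 2[1+_]; 1+[2_]; fromℕ)
open import Data.Product.Base using (Σ-syntax; ∃-syntax; _×_; proj₁)
open import Data.Rational.Base as ℚ using (ℚ; 0ℚ; +-*-rawSemiring)
open import Data.Sum.Base using (_⊎_)
open import Data.Vec.Base as Vec using (Vec; []; _∷_; lookup)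
open import Function.Base using (_on_)
open import Relation.Binary.Construct.Closure.ReflexiveTransitive using (Star)
open import Relation.Binary.PropositionalEquality.Core using (_≡_; _≢_)
open import Relation.Nullary.Negation.Core using (¬_)
open import Relation.Nullary.Reflects using (Reflects)

------------------------------------------------------------------------
-- Model of computation

-- Algorithms are programs of a first-order functional language whose only
-- data are binary trees (a functional variant of Jones' WHILE language).
-- Every evaluation step has unit cost.  Values can be shared, so T steps
-- are carried out by a RAM in O(T) operations on pointers of O(log T)
-- bits (plus the input size), and T steps of a logarithmic-cost RAM can be
-- simulated with an overhead polynomial in log T, keeping the memory in a
-- balanced tree.  Since log T is polynomial in the input size whenever
-- T = c^k n^O(1) with k ≤ n, the classes O*(c^k) agree for both models.

data Tree : Set where
  nil  : Tree
  cons : Tree → Tree → Tree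

size : Tree → ℕ
size nil        = 1
size (cons s t) = suc (size s ℕ.+ size t)

-- Exp p n: expressions over p global unary functions and n tree variables
-- (de Bruijn indices).  In  case e a b,  the expression a is taken if e is
-- nil; otherwise b is, with variable 0 bound to the left and variable 1 to
-- the right subtree.

data Exp (p n : ℕ) : Set where
  var  : Fin n → Exp p n
  nil  : Exp p n
  cons : Exp p n → Exp p n → Exp p n
  case : Exp p n → Exp p n → Exp p (2 ℕ.+ n) → Exp p n
  bind : Exp p n → Exp p (1 ℕ.+ n) → Exp p n
  call : Fin p → Exp p n → Exp p n

-- The functions may be mutually recursive.
Functions : ℕ → Set
Functions p = Vec (Exp p 1) p

-- δ ∙ ρ ⊢ e ⇓ v [ t ]: in the environment ρ, the expression e evaluates to
-- v in t steps (t counts the rules in the derivation).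

infix 4 _∙_⊢_⇓_[_]

data _∙_⊢_⇓_[_] {p : ℕ} (δ : Functions p) {n : ℕ} (ρ : Vec Tree n) :
                Exp p n → Tree → ℕ → Set where

  var  : ∀ i → δ ∙ ρ ⊢ var i ⇓ lookup ρ i [ 1 ]

  nil  : δ ∙ ρ ⊢ nil ⇓ nil [ 1 ]

  cons : ∀ {a b u v s t} →
         δ ∙ ρ ⊢ a ⇓ u [ s ] →
         δ ∙ ρ ⊢ b ⇓ v [ t ] →
         δ ∙ ρ ⊢ cons a b ⇓ cons u v [ suc (s ℕ.+ t) ]

  case-nil  : ∀ {e a b v s t} →
              δ ∙ ρ ⊢ e ⇓ nil [ s ] →
              δ ∙ ρ ⊢ a ⇓ v [ t ] →
              δ ∙ ρ ⊢ case e a b ⇓ v [ suc (s ℕ.+ t) ]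

  case-cons : ∀ {e a b l r v s t} →
              δ ∙ ρ ⊢ e ⇓ cons l r [ s ] →
              δ ∙ (l ∷ r ∷ ρ) ⊢ b ⇓ v [ t ] →
              δ ∙ ρ ⊢ case e a b ⇓ v [ suc (s ℕ.+ t) ]

  bind : ∀ {a b u v s t} →
         δ ∙ ρ ⊢ a ⇓ u [ s ] →
         δ ∙ (u ∷ ρ) ⊢ b ⇓ v [ t ] →
         δ ∙ ρ ⊢ bind a b ⇓ v [ suc (s ℕ.+ t) ]

  call : ∀ {f e u v s t} →
         δ ∙ ρ ⊢ e ⇓ u [ s ] →
         δ ∙ (u ∷ []) ⊢ lookup δ f ⇓ v [ t ] →
         δ ∙ ρ ⊢ call f e ⇓ v [ suc (s ℕ.+ t) ]

record Program : Set where
  field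
    {arity}   : ℕ
    functions : Functions arity
    main      : Exp arity 1

_on-input_returns_in-steps_ : Program → Tree → Tree → ℕ → Set
P on-input x returns y in-steps t = functions ∙ (x ∷ []) ⊢ main ⇓ y [ t ]
  where open Program P

------------------------------------------------------------------------
-- Encodings

⌜_⌝ᴮ : Bool → Tree
⌜ false ⌝ᴮ = nil
⌜ true  ⌝ᴮ = cons nil nil

⌜_⌝ᴸ : List Tree → Tree
⌜ []     ⌝ᴸ = nil
⌜ t ∷ ts ⌝ᴸ = cons t ⌜ ts ⌝ᴸ

-- Numbers are written in binary: the tree of k has size Θ(log k).
⌜_⌝ᵇ : ℕᵇ → Tree
⌜ zero     ⌝ᵇ = nil
⌜ 2[1+ x ] ⌝ᵇ = cons nil ⌜ x ⌝ᵇ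
⌜ 1+[2 x ] ⌝ᵇ = cons (cons nil nil) ⌜ x ⌝ᵇ

⌜_⌝ᴺ : ℕ → Tree
⌜ k ⌝ᴺ = ⌜ fromℕ k ⌝ᵇ

-- A subset is given by its characteristic vector.
⌜_⌝ˢ : ∀ {n} → Subset n → Tree
⌜ X ⌝ˢ = ⌜ List.map ⌜_⌝ᴮ (Vec.toList X) ⌝ᴸ

------------------------------------------------------------------------
-- Parameterized decision problems and O*-running times

-- A promise on the input is part of the type Instance.
record Problem : Set₁ where
  field
    Instance  : Set
    encode    : Instance → Tree
    Yes       : Instance → Set
    parameter : Instance → ℕ

ℕ→ℚ : ℕ → ℚ
ℕ→ℚ n = + n ℚ./ 1

infixr 8 _^_

_^_ : ℚ → ℕ → ℚ
_^_ = RawSemiring._^_ +-*-rawSemiring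

-- Π is decided by some program in f(k) · n^O(1) steps, where n is the size
-- of the encoded input; n^O(1) is spelled out as c · n^c.
infix 4 _solvableInO*_

_solvableInO*_ : Problem → (ℕ → ℚ) → Set
Π solvableInO* f =
  Σ[ P ∈ Program ] Σ[ c ∈ ℕ ] (∀ (x : Instance) →
    ∃[ answer ] ∃[ t ]
      P on-input encode x returns ⌜ answer ⌝ᴮ in-steps t ×
      Reflects (Yes x) answer ×
      ℕ→ℚ t ℚ.≤ f (parameter x) ℚ.* ℕ→ℚ (c ℕ.* size (encode x) ℕ.^ c))
  where open Problem Π

------------------------------------------------------------------------
-- Graphs

record Graph (V : Set) : Set where
  field
    adj    : V → V → Bool
    sym    : ∀ u v → adj u v ≡ adj v u
    irrefl : ∀ v → adj v v ≡ false

  Adj : V → V → Set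
  Adj u v = T (adj u v)

open Graph public using (Adj)

module _ {V : Set} (G : Graph V) where

  -- The graph without vertices counts as connected.
  Connected : Set
  Connected = ∀ u v → Star (Adj G) u v

  Complete : Set
  Complete = ∀ u v → u ≢ v → Adj G u v

  -- The partition is κ : V → Bool, with clique κ⁻¹(true) and independent
  -- set κ⁻¹(false).
  Split : Set
  Split = Σ[ κ ∈ (V → Bool) ]
    (∀ u v → κ u ≡ true  → κ v ≡ true  → u ≢ v → Adj G u v) ×
    (∀ u v → κ u ≡ false → κ v ≡ false → ¬ Adj G u v)

-- The vertices of an induced subgraph are pairs (v , v∈X).  As v ∈ X has at
-- most one proof, such pairs are equal iff the underlying vertices are.
induced : ∀ {n} → Graph (Fin n) → (X : Subset n) → Graph (Σ[ v ∈ Fin n ] v ∈ X)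
induced G X = record
  { adj    = G.adj on proj₁
  ; sym    = λ u v → G.sym (proj₁ u) (proj₁ v)
  ; irrefl = λ v → G.irrefl (proj₁ v)
  }
  where module G = Graph G

module _ {n : ℕ} (G : Graph (Fin n)) where

  VertexCover : Subset n → Set
  VertexCover X = ∀ u v → Adj G u v → u ∈ X ⊎ v ∈ X

  ConnectedVertexCover : Subset n → Set
  ConnectedVertexCover X = VertexCover X × Connected (induced G X)

  SplitDeletionSet : Subset n → Set
  SplitDeletionSet S = Split (induced G (∁ S))

  CliqueDeletionSet : Subset n → Set
  CliqueDeletionSet S = Complete (induced G (∁ S))

  adjacencyMatrix : Vec (Subset n) n
  adjacencyMatrix = Vec.tabulate λ u → Vec.tabulate λ v → Graph.adj G u v

⌜_⌝ᴳ : ∀ {n} → Graph (Fin n) → Tree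
⌜ G ⌝ᴳ = ⌜ List.map ⌜_⌝ˢ (Vec.toList (adjacencyMatrix G)) ⌝ᴸ

------------------------------------------------------------------------
-- Connected Vertex Cover parameterized by the size of a deletion set

record CVCInstance (DeletionSet : ∀ {n} → Graph (Fin n) → Subset n → Set) : Set where
  field
    n           : ℕ
    G           : Graph (Fin n)
    S           : Subset n
    deletionSet : DeletionSet G S
    ℓ           : ℕ
    ℓ>0         : 0 ℕ.< ℓ

CVC : (∀ {n} → Graph (Fin n) → Subset n → Set) → Problem
CVC DeletionSet = record
  { Instance  = CVCInstance DeletionSet
  ; encode    = λ x → let open CVCInstance x in
                  cons ⌜ G ⌝ᴳ (cons ⌜ S ⌝ˢ ⌜ ℓ ⌝ᴺ)
  ; Yes       = λ x → let open CVCInstance x in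
                  ∃[ X ] ConnectedVertexCover G X × ∣ X ∣ ℕ.≤ ℓ
  ; parameter = λ x → let open CVCInstance x in ∣ S ∣
  }

------------------------------------------------------------------------
-- Set Cover

-- The universe U is Fin m.
record SetCoverInstance : Set where
  field
    m   : ℕ
    F   : List (Subset m)
    ℓ   : ℕ
    ℓ>0 : 0 ℕ.< ℓ

-- The universe is encoded by listing its elements, so that the input size
-- is at least |U| even for an empty family.
SetCover : Problem
SetCover = record
  { Instance  = SetCoverInstance
  ; encode    = λ x → let open SetCoverInstance x in
                  cons ⌜ List.replicate m nil ⌝ᴸ
                       (cons ⌜ List.map ⌜_⌝ˢ F ⌝ᴸ ⌜ ℓ ⌝ᴺ)
  ; Yes       = λ x → let open SetCoverInstance x in
                  ∃[ F′ ] F′ ⊆ F × length F′ ℕ.≤ ℓ × ⋃ F′ ≡ ⊤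
  ; parameter = λ x → SetCoverInstance.m x
  }

-- Rational ε suffice: on (0, 2] the time bound grows as ε decreases, so a
-- real ε there can be replaced by a smaller positive rational.  For ε ≥ 2
-- the claim holds trivially, as the bound fails when |U| is odd.
SetCoverConjecture : Set
SetCoverConjecture =
  ∀ (ε : ℚ) → 0ℚ ℚ.< ε → ¬ (SetCover solvableInO* λ k → (ℕ→ℚ 2 ℚ.- ε) ^ k)

{-# OPTIONS --safe #-}

-- Split case.  Let X be a connected vertex cover, and let G − S have clique κ
-- and independent set I.  X misses at most one vertex of κ, so we may guess
-- S′ = X ∩ S and the set D ⊆ κ missed by X.  This forces the set B of S′, of
-- κ ∖ D and of the vertices of I adjacent to S ∖ S′ or D; B is already a vertex
-- cover, and only vertices of I can be left to choose.  Since these are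
-- independent, X grows from a root r ∈ κ ∖ D (or r ∈ S′) by adding vertices z
-- one by one, each adjacent to what is reached already, and all that matters of
-- the state is which subset of S′ is reached.  Hence the subsets Q of S′ that can
-- be connected to r by j + 1 new vertices are found in a table for j: for the
-- last vertex z, connecting M, look up Q ∖ M together with some w ∈ S′ ∩ M.
-- Summing 2^|S′| over all S′ ⊆ S gives 3^|S|.
--
-- Clique case.  Here I is empty, so X = B for one of the 2^|S| sets S′ and one of
-- the polynomially many sets D.
--
-- Lower bound.  The incidence graph of the sets and of the elements together
-- with a root contained in all sets becomes split when the elements are
-- deleted, and with pendant vertices at the elements and at the root its
-- connected vertex covers of size |U| + 1 + ℓ are the set covers of size ℓ.
--
-- The programs are built from combinators that carry their time bound.  Except
-- for the tables, which are only accessed by descending to a leaf, all values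
-- have polynomial size by their type, so polynomial time comes for free; the
-- exponential part is tracked by a weight and arises only where a subset of a
-- given set is guessed.

module Submission where

open import Data.Bool.Base using (Bool; T; _∧_; _∨_; false; if_then_else_; not; true)
open import Data.Fin.Base as Fin using (Fin; _↑ʳ_; _↑ˡ_; suc; toℕ; zero)
open import Data.Fin.Patterns
open import Data.Fin.Properties as Finₚ using (_≟_)
open import Data.Fin.Subset as Subset using (Subset; _∈_; _∉_; _∩_; _∪_; _⊆_; ⁅_⁆; ∁; ∣_∣; ⋃)
open import Data.Fin.Subset.Properties as Subsetₚ
  using (p⊆p∪q; p⊆q⇒∣p∣≤∣q∣; x∈p∩q⁺; x∈p∩q⁻; x∈p∪q⁺; x∈p∪q⁻; x∈⁅x⁆; x∈⁅y⁆⇒x≡y)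
open import Data.Integer.Base as ℤ using ()
import Data.Integer.Properties as ℤₚ
open import Data.List.Base as List using (List; []; _∷_)
import Data.List.Membership.Propositional as List∈
import Data.List.Properties as Listₚ
open import Data.List.Relation.Unary.Any as Any using (here; there)
import Data.List.Relation.Unary.Any.Properties as Anyₚ
open import Data.Nat.Base as ℕ using (_*_; _+_; _≤_; suc; s≤s; zero; z≤n; ℕ)
open import Data.Nat.Binary.Base as ℕᵇ using (1+[2_]; 2[1+_]; fromℕ; zero; ℕᵇ)
import Data.Nat.Binary.Properties as ℕᵇₚ
open import Data.Nat.Properties as ℕₚ
  using (*-mono-≤; *-monoʳ-≤; *-monoˡ-≤; +-assoc; +-identityʳ; +-mono-≤; +-monoʳ-≤; +-monoˡ-≤;
         +-suc; m≤m+n; m≤n+m; n≤1+n; ≤-refl; ≤-reflexive; ≤-trans)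
open import Data.Nat.Tactic.RingSolver using (solve-∀)
open import Data.Product.Base using (_,_; _×_; proj₁; proj₂; Σ-syntax; ∃-syntax)
open import Data.Rational.Base as ℚ using (0ℚ; 1ℚ; _-_; _<_; ℚ)
import Data.Rational.Properties as ℚₚ
open import Data.Rational.Unnormalised.Base as ℚᵘ using (*≡*; *≤*; mkℚᵘ)
import Data.Rational.Unnormalised.Properties as ℚᵘₚ
open import Data.Sum.Base using ([_,_]′; _⊎_; inj₁; inj₂)
open import Data.Unit.Base using (tt) renaming (⊤ to Unit)
open import Data.Vec.Base as Vec using (Vec; []; _++_; _∷_; allFin; lookup)
open import Data.Vec.Properties as Vecₚ
  using ([]=⇒lookup; lookup-++ʳ; lookup-++ˡ; lookup-map; lookup-replicate; lookup⇒[]=;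
         lookup∘tabulate)
import Data.Vec.Properties.WithK as VecWithK
open import Defs
open import Function.Base using (_∘_)
open import Relation.Binary.Construct.Closure.ReflexiveTransitive as Star using (Star; _◅_; _◅◅_; ε)
open import Relation.Binary.PropositionalEquality
open import Relation.Nullary using (Dec; _because_; contradiction; does; no; proof; yes; ¬_)
open import Relation.Nullary.Reflects

-- Evaluation with an upper bound on the time, and linking of programs

-- Why the reached part of `S′` suffices as a state: a new vertex `z` is independent, so its
-- neighbours lie in `S` and in the clique, and every clique vertex of the solution equals the root
-- or is adjacent to it. Hence `z` either touches an element of `S′` that is reached already or sees
-- the root through `B`; which independent vertices were added before makes no difference. Soundness
-- in turn allows any vertex as `z`, because `B` covers all edges already. Three obstacles shape the
-- rest. The partition of `G - S` is promised but not part of the input, so it is computed first,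
-- one vertex at a time. The number `ℓ` is binary and can be exponentially larger than the graph, so
-- the rounds are limited by the budget and by `n`. A solution that meets neither `S` nor the clique
-- has no root; it has at most one vertex and is searched for separately. In the lower bound, the
-- base `2 - ε` may drop below 1, where the exponential factor no longer pays for the reduction;
-- these bases are treated apart.

mapCalls : ∀ {p q n} → (Fin p → Fin q) → Exp p n → Exp q n
mapCalls φ (var i)      = var i
mapCalls φ nil          = nil
mapCalls φ (cons a b)   = cons (mapCalls φ a) (mapCalls φ b)
mapCalls φ (case e a b) = case (mapCalls φ e) (mapCalls φ a) (mapCalls φ b)
mapCalls φ (bind a b)   = bind (mapCalls φ a) (mapCalls φ b)
mapCalls φ (call f e)   = call (φ f) (mapCalls φ e)

-- Renaming turns each rule into the same rule, so linking programs leaves their running times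
-- exactly as they were.
mapCalls-⇓ : ∀ {p q n} {δ : Functions p} {δ′ : Functions q} (φ : Fin p → Fin q) →
             (∀ f → lookup δ′ (φ f) ≡ mapCalls φ (lookup δ f)) →
             ∀ {ρ : Vec Tree n} {e v t} →
             δ ∙ ρ ⊢ e ⇓ v [ t ] → δ′ ∙ ρ ⊢ mapCalls φ e ⇓ v [ t ]
mapCalls-⇓ φ eq (var i)         = var i
mapCalls-⇓ φ eq nil             = nil
mapCalls-⇓ φ eq (cons d e)      = cons (mapCalls-⇓ φ eq d) (mapCalls-⇓ φ eq e)
mapCalls-⇓ φ eq (case-nil d e)  = case-nil (mapCalls-⇓ φ eq d) (mapCalls-⇓ φ eq e)
mapCalls-⇓ φ eq (case-cons d e) = case-cons (mapCalls-⇓ φ eq d) (mapCalls-⇓ φ eq e)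
mapCalls-⇓ φ eq (bind d e)      = bind (mapCalls-⇓ φ eq d) (mapCalls-⇓ φ eq e)
mapCalls-⇓ φ eq (call {f = f} d e) =
  call (mapCalls-⇓ φ eq d)
       (subst (λ b → _ ∙ _ ⊢ b ⇓ _ [ _ ]) (sym (eq f)) (mapCalls-⇓ φ eq e))

infix 4 _∙_⊢_⇓_⟨_⟩

_∙_⊢_⇓_⟨_⟩ : ∀ {p n} → Functions p → Vec Tree n → Exp p n → Tree → ℕ → Set
δ ∙ ρ ⊢ e ⇓ v ⟨ b ⟩ = ∃[ t ] t ≤ b × δ ∙ ρ ⊢ e ⇓ v [ t ]

module _ {p n} {δ : Functions p} {ρ : Vec Tree n} where

  ⇓-mono : ∀ {e v b c} → b ≤ c → δ ∙ ρ ⊢ e ⇓ v ⟨ b ⟩ → δ ∙ ρ ⊢ e ⇓ v ⟨ c ⟩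
  ⇓-mono b≤c (t , t≤b , d) = t , ≤-trans t≤b b≤c , d

  ⇓-result : ∀ {e v v′ b} → v ≡ v′ → δ ∙ ρ ⊢ e ⇓ v ⟨ b ⟩ → δ ∙ ρ ⊢ e ⇓ v′ ⟨ b ⟩
  ⇓-result refl d = d

  ⇓var : ∀ i → δ ∙ ρ ⊢ var i ⇓ lookup ρ i ⟨ 1 ⟩
  ⇓var i = 1 , ≤-refl , var i

  ⇓nil : δ ∙ ρ ⊢ nil ⇓ nil ⟨ 1 ⟩
  ⇓nil = 1 , ≤-refl , nil

  ⇓cons : ∀ {a b u v s t} → δ ∙ ρ ⊢ a ⇓ u ⟨ s ⟩ → δ ∙ ρ ⊢ b ⇓ v ⟨ t ⟩ →
          δ ∙ ρ ⊢ cons a b ⇓ cons u v ⟨ suc (s + t) ⟩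
  ⇓cons (_ , p , d) (_ , q , e) = _ , s≤s (+-mono-≤ p q) , cons d e

  ⇓case-nil : ∀ {e a b v s t} → δ ∙ ρ ⊢ e ⇓ nil ⟨ s ⟩ → δ ∙ ρ ⊢ a ⇓ v ⟨ t ⟩ →
              δ ∙ ρ ⊢ case e a b ⇓ v ⟨ suc (s + t) ⟩
  ⇓case-nil (_ , p , d) (_ , q , e) = _ , s≤s (+-mono-≤ p q) , case-nil d e

  ⇓case-cons : ∀ {e a b l r v s t} → δ ∙ ρ ⊢ e ⇓ cons l r ⟨ s ⟩ →
               δ ∙ (l ∷ r ∷ ρ) ⊢ b ⇓ v ⟨ t ⟩ →
               δ ∙ ρ ⊢ case e a b ⇓ v ⟨ suc (s + t) ⟩
  ⇓case-cons (_ , p , d) (_ , q , e) = _ , s≤s (+-mono-≤ p q) , case-cons d e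

  ⇓call : ∀ {f e u v s t} → δ ∙ ρ ⊢ e ⇓ u ⟨ s ⟩ →
          δ ∙ (u ∷ []) ⊢ lookup δ f ⇓ v ⟨ t ⟩ →
          δ ∙ ρ ⊢ call f e ⇓ v ⟨ suc (s + t) ⟩
  ⇓call (_ , p , d) (_ , q , e) = _ , s≤s (+-mono-≤ p q) , call d e

-- The first entry of the table is the function meant; the others are its helpers.
record Fn : Set where
  constructor fn
  field
    {others} : ℕ
    table    : Functions (suc others)

infix 3 _▹_⇓_⟨_⟩

_▹_⇓_⟨_⟩ : Fn → Tree → Tree → ℕ → Set
fn δ ▹ x ⇓ y ⟨ b ⟩ = δ ∙ (x ∷ []) ⊢ lookup δ zero ⇓ y ⟨ b ⟩

-- The body of a new function refers to itself and to the two components F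
-- and G through the three indices it is applied to.
Body : Set
Body = ∀ {p} → Fin p → Fin p → Fin p → Exp p 1

module Link (F G : Fn) where
  open Fn

  left : Fin (suc (others F)) → Fin (suc (suc (others F) + suc (others G)))
  left f = suc (f ↑ˡ _)

  right : Fin (suc (others G)) → Fin (suc (suc (others F) + suc (others G)))
  right f = suc (suc (others F) ↑ʳ f)

  module _ (e : Body) where

    linked : Functions (suc (suc (others F) + suc (others G)))
    linked = e zero (left zero) (right zero) ∷
             (Vec.map (mapCalls left) (table F) ++ Vec.map (mapCalls right) (table G))

    ⇓left : ∀ {x y b} → F ▹ x ⇓ y ⟨ b ⟩ →
            linked ∙ (x ∷ []) ⊢ lookup linked (left zero) ⇓ y ⟨ b ⟩
    ⇓left {x} (t , t≤b , d) = t , t≤b ,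
      subst (λ f → linked ∙ (x ∷ []) ⊢ f ⇓ _ [ t ]) (sym (commutes zero))
            (mapCalls-⇓ left commutes d)
      where
      commutes : ∀ f → lookup linked (left f) ≡ mapCalls left (lookup (table F) f)
      commutes f = trans (lookup-++ˡ (Vec.map (mapCalls left) (table F)) _ f)
                         (lookup-map f (mapCalls left) (table F))

    ⇓right : ∀ {x y b} → G ▹ x ⇓ y ⟨ b ⟩ →
             linked ∙ (x ∷ []) ⊢ lookup linked (right zero) ⇓ y ⟨ b ⟩
    ⇓right {x} (t , t≤b , d) = t , t≤b ,
      subst (λ f → linked ∙ (x ∷ []) ⊢ f ⇓ _ [ t ]) (sym (commutes zero))
            (mapCalls-⇓ right commutes d)
      where
      commutes : ∀ f → lookup linked (right f) ≡ mapCalls right (lookup (table G) f)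
      commutes f = trans (lookup-++ʳ (Vec.map (mapCalls left) (table F)) _ f)
                         (lookup-map f (mapCalls right) (table G))

link : Body → Fn → Fn → Fn
link e F G = fn (Link.linked F G e)

-- Basic programs and recursion schemes with their costs

idᶠ : Fn
idᶠ = fn (var 0F ∷ [])

idᶠ-⇓ : ∀ {x} → idᶠ ▹ x ⇓ x ⟨ 1 ⟩
idᶠ-⇓ = ⇓var 0F

quote-tree : ∀ {p n} → Tree → Exp p n
quote-tree nil        = nil
quote-tree (cons s t) = cons (quote-tree s) (quote-tree t)

quote-tree-⇓ : ∀ {p n} {δ : Functions p} {ρ : Vec Tree n} v →
               δ ∙ ρ ⊢ quote-tree v ⇓ v ⟨ size v ⟩
quote-tree-⇓ nil        = ⇓nil
quote-tree-⇓ (cons s t) = ⇓cons (quote-tree-⇓ s) (quote-tree-⇓ t)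

constᶠ : Tree → Fn
constᶠ v = fn (quote-tree v ∷ [])

constᶠ-⇓ : ∀ v {x} → constᶠ v ▹ x ⇓ v ⟨ size v ⟩
constᶠ-⇓ v = quote-tree-⇓ v

infixr 9 _∘ᶠ_

∘-body : Body
∘-body _ f g = call f (call g (var 0F))

_∘ᶠ_ : Fn → Fn → Fn
F ∘ᶠ G = link ∘-body F G

∘ᶠ-⇓ : ∀ {F G x y z a b} → G ▹ x ⇓ y ⟨ a ⟩ → F ▹ y ⇓ z ⟨ b ⟩ → F ∘ᶠ G ▹ x ⇓ z ⟨ 3 + (a + b) ⟩
∘ᶠ-⇓ {F} {G} d e = ⇓call (⇓call (⇓var 0F) (⇓right ∘-body d)) (⇓left ∘-body e)
  where open Link F G

infixr 4 _,ᶠ_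

,-body : Body
,-body _ f g = cons (call f (var 0F)) (call g (var 0F))

_,ᶠ_ : Fn → Fn → Fn
F ,ᶠ G = link ,-body F G

,ᶠ-⇓ : ∀ {F G x u v a b} → F ▹ x ⇓ u ⟨ a ⟩ → G ▹ x ⇓ v ⟨ b ⟩ →
       F ,ᶠ G ▹ x ⇓ cons u v ⟨ 5 + (a + b) ⟩
,ᶠ-⇓ {F} {G} {a = a} {b} d e =
  ⇓-mono (≤-reflexive (arith a b))
    (⇓cons (⇓call (⇓var 0F) (⇓left ,-body d)) (⇓call (⇓var 0F) (⇓right ,-body e)))
  where
  open Link F G
  arith : ∀ a b → suc (suc (1 + a) + suc (1 + b)) ≡ 5 + (a + b)
  arith = solve-∀

fstᶠ sndᶠ : Fn
fstᶠ = fn (case (var 0F) nil (var 0F) ∷ [])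
sndᶠ = fn (case (var 0F) nil (var 1F) ∷ [])

fstᶠ-⇓ : ∀ {x y} → fstᶠ ▹ cons x y ⇓ x ⟨ 3 ⟩
fstᶠ-⇓ = ⇓case-cons (⇓var 0F) (⇓var 0F)

sndᶠ-⇓ : ∀ {x y} → sndᶠ ▹ cons x y ⇓ y ⟨ 3 ⟩
sndᶠ-⇓ = ⇓case-cons (⇓var 0F) (⇓var 1F)

-- Both branches are already evaluated.
ifᶠ : Fn
ifᶠ = fn (case (var 0F) nil
           (case (var 1F) nil
             (case (var 2F) (var 1F) (var 2F))) ∷ [])

ifᶠ-⇓ : ∀ c {x y} → ifᶠ ▹ cons ⌜ c ⌝ᴮ (cons x y) ⇓ (if c then x else y) ⟨ 7 ⟩
ifᶠ-⇓ false = ⇓case-cons (⇓var 0F) (⇓case-cons (⇓var 1F)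
                (⇓case-nil (⇓var 2F) (⇓var 1F)))
ifᶠ-⇓ true  = ⇓case-cons (⇓var 0F) (⇓case-cons (⇓var 1F)
                (⇓case-cons (⇓var 2F) (⇓var 2F)))

-- x = (γ , (acc , list))
foldr-body : Body
foldr-body self step _ =
  case (var 0F) nil
    (case (var 1F) nil
      (case (var 1F) (var 0F)
        (call step
          (cons (cons (var 4F) (var 0F))
                (call self (cons (var 4F)
                                 (cons (var 2F) (var 1F))))))))

foldrᶠ : Fn → Fn
foldrᶠ F = link foldr-body F idᶠ

foldrᶠ-nil : ∀ {F γ acc} → foldrᶠ F ▹ cons γ (cons acc nil) ⇓ acc ⟨ 7 ⟩
foldrᶠ-nil = ⇓case-cons (⇓var 0F) (⇓case-cons (⇓var 1F)
               (⇓case-nil (⇓var 1F) (⇓var 0F)))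

foldrᶠ-cons : ∀ {F γ acc h t r r′ a b} →
              foldrᶠ F ▹ cons γ (cons acc t) ⇓ r ⟨ a ⟩ →
              F ▹ cons (cons γ h) r ⇓ r′ ⟨ b ⟩ →
              foldrᶠ F ▹ cons γ (cons acc (cons h t)) ⇓ r′ ⟨ 17 + (a + b) ⟩
foldrᶠ-cons {F} {a = a} {b} d e =
  ⇓-mono (≤-reflexive (arith a b))
  (⇓case-cons (⇓var 0F) (⇓case-cons (⇓var 1F) (⇓case-cons (⇓var 1F)
    (⇓call (⇓cons (⇓cons (⇓var _) (⇓var _))
                  (⇓call (⇓cons (⇓var _) (⇓cons (⇓var _) (⇓var _))) d))
           (⇓left foldr-body e)))))
  where
  open Link F idᶠ
  arith : ∀ a b → suc (1 + suc (1 + suc (1 + suc (suc (suc (1 + 1) + suc (suc (1 + suc (1 + 1)) + a)) + b)))) ≡ 17 + (a + b)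
  arith = solve-∀

foldl-body : Body
foldl-body self step _ =
  case (var 0F) nil
    (case (var 1F) nil
      (case (var 1F) (var 0F)
        (call self (cons (var 4F)
          (cons (call step (cons (cons (var 4F) (var 0F))
                                 (var 2F)))
                (var 1F))))))

foldlᶠ : Fn → Fn
foldlᶠ F = link foldl-body F idᶠ

foldlᶠ-nil : ∀ {F γ acc} → foldlᶠ F ▹ cons γ (cons acc nil) ⇓ acc ⟨ 7 ⟩
foldlᶠ-nil = ⇓case-cons (⇓var 0F) (⇓case-cons (⇓var 1F)
               (⇓case-nil (⇓var 1F) (⇓var 0F)))

foldlᶠ-cons : ∀ {F γ acc acc′ h t r a b} →
              F ▹ cons (cons γ h) acc ⇓ acc′ ⟨ a ⟩ →
              foldlᶠ F ▹ cons γ (cons acc′ t) ⇓ r ⟨ b ⟩ →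
              foldlᶠ F ▹ cons γ (cons acc (cons h t)) ⇓ r ⟨ 17 + (a + b) ⟩
foldlᶠ-cons {F} {a = a} {b} d e =
  ⇓-mono (≤-reflexive (arith a b))
  (⇓case-cons (⇓var 0F) (⇓case-cons (⇓var 1F) (⇓case-cons (⇓var 1F)
    (⇓call (⇓cons (⇓var _) (⇓cons (⇓call (⇓cons (⇓cons (⇓var _) (⇓var _)) (⇓var _))
                                         (⇓left foldl-body d)) (⇓var _))) e))))
  where
  open Link F idᶠ
  arith : ∀ a b → suc (1 + suc (1 + suc (1 + suc (suc (1 + suc (suc (suc (suc (1 + 1) + 1) + a) + 1)) + b)))) ≡ 17 + (a + b)
  arith = solve-∀

-- x = (γ , (acc , mask)): the leaves see the choices made so far, the last
-- one first.
branch-body : Body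
branch-body self leaf op =
  case (var 0F) nil
    (case (var 1F) nil
      (case (var 1F) (call leaf (cons (var 2F) (var 0F)))
        (case (var 0F)
          (without γ₀ acc₀ rest₀)
          (call op (cons (without γ₁ acc₁ rest₁) (including γ₁ acc₁ rest₁))))))
  where
  without : ∀ {n} → Fin n → Fin n → Fin n → Exp _ n
  without γ acc rest = call self (cons (var γ) (cons (cons nil (var acc)) (var rest)))
  including : ∀ {n} → Fin n → Fin n → Fin n → Exp _ n
  including γ acc rest =
    call self (cons (var γ) (cons (cons (cons nil nil) (var acc)) (var rest)))
  γ₀ acc₀ rest₀ : Fin 7
  γ₀    = 4F
  acc₀  = 2F
  rest₀ = 1F
  γ₁ acc₁ rest₁ : Fin 9
  γ₁    = 6F
  acc₁  = 4F
  rest₁ = 3F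

branchᶠ : Fn → Fn → Fn
branchᶠ leaf op = link branch-body leaf op

module _ {F G : Fn} where
  open Link F G

  branchᶠ-nil : ∀ {γ acc r b} → F ▹ cons γ acc ⇓ r ⟨ b ⟩ →
                branchᶠ F G ▹ cons γ (cons acc nil) ⇓ r ⟨ 10 + b ⟩
  branchᶠ-nil d = ⇓case-cons (⇓var 0F) (⇓case-cons (⇓var 1F)
    (⇓case-nil (⇓var 1F) (⇓call (⇓cons (⇓var _) (⇓var _)) (⇓left branch-body d))))

  branchᶠ-false : ∀ {γ acc t r b} →
                  branchᶠ F G ▹ cons γ (cons (cons nil acc) t) ⇓ r ⟨ b ⟩ →
                  branchᶠ F G ▹ cons γ (cons acc (cons nil t)) ⇓ r ⟨ 16 + b ⟩
  branchᶠ-false d = ⇓case-cons (⇓var 0F) (⇓case-cons (⇓var 1F)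
    (⇓case-cons (⇓var 1F) (⇓case-nil (⇓var 0F)
      (⇓call (⇓cons (⇓var _) (⇓cons (⇓cons ⇓nil (⇓var _)) (⇓var _))) d))))

  branchᶠ-true : ∀ {γ acc t r s v a b c} →
                 branchᶠ F G ▹ cons γ (cons (cons nil acc) t) ⇓ r ⟨ a ⟩ →
                 branchᶠ F G ▹ cons γ (cons (cons (cons nil nil) acc) t) ⇓ s ⟨ b ⟩ →
                 G ▹ cons r s ⇓ v ⟨ c ⟩ →
                 branchᶠ F G ▹ cons γ (cons acc (cons (cons nil nil) t)) ⇓ v ⟨ 28 + (a + b + c) ⟩
  branchᶠ-true {a = a} {b} {c} d e f =
    ⇓-mono (≤-reflexive (arith a b c))
    (⇓case-cons (⇓var 0F) (⇓case-cons (⇓var 1F)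
      (⇓case-cons (⇓var 1F) (⇓case-cons (⇓var 0F)
        (⇓call (⇓cons
          (⇓call (⇓cons (⇓var _) (⇓cons (⇓cons ⇓nil (⇓var _)) (⇓var _))) d)
          (⇓call (⇓cons (⇓var _) (⇓cons (⇓cons (⇓cons ⇓nil ⇓nil) (⇓var _)) (⇓var _))) e))
          (⇓right branch-body f))))))
    where
    arith : ∀ a b c → suc (1 + suc (1 + suc (1 + suc (1 + suc (suc (suc (suc (1 + suc (suc (1 + 1) + 1)) + a) + suc (suc (1 + suc (suc (suc (1 + 1) + 1) + 1)) + b)) + c))))) ≡ 28 + (a + b + c)
    arith = solve-∀

-- Programs on vectors, numbers and tables

⌜_⌝ⱽ : ∀ {A : Set} {k} → (A → Tree) → Vec A k → Tree
⌜ e ⌝ⱽ xs = ⌜ List.map e (Vec.toList xs) ⌝ᴸ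

-- Indices are written in unary: they are bounded by a length occurring in the input, so this stays
-- polynomial, and lookup and comparison become plain recursions.
⌜_⌝ᵁ : ℕ → Tree
⌜ zero ⌝ᵁ  = nil
⌜ suc k ⌝ᵁ = cons nil ⌜ k ⌝ᵁ

-- Here `g` plays the role of the loop invariant: it names the intermediate value for every suffix.
-- A single bound `b` has to serve all rounds.
foldrᶠ-Vec : ∀ {F} {A : Set} (e : A → Tree) (g : ∀ {k} → Vec A k → Tree) {γ b} →
             (∀ {k} x (xs : Vec A k) → F ▹ cons (cons γ (e x)) (g xs) ⇓ g (x ∷ xs) ⟨ b ⟩) →
             ∀ {k} (xs : Vec A k) →
             foldrᶠ F ▹ cons γ (cons (g []) (⌜ e ⌝ⱽ xs)) ⇓ g xs ⟨ 7 + k * (17 + b) ⟩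
foldrᶠ-Vec {F} e g d []       = foldrᶠ-nil {F}
foldrᶠ-Vec {F} e g {b = b} d {suc k} (x ∷ xs) =
  ⇓-mono (≤-reflexive (arith b (k * (17 + b)))) (foldrᶠ-cons {F} (foldrᶠ-Vec {F} e g d xs) (d x xs))
  where
  arith : ∀ b m → 17 + ((7 + m) + b) ≡ 7 + ((17 + b) + m)
  arith = solve-∀

recurᶠ : (∀ {p} → Fin p → Exp p 1) → Fn
recurᶠ e = fn (e zero ∷ [])

lookup-body : ∀ {p} → Fin p → Exp p 1
lookup-body self =
  case (var 0F) nil
    (case (var 1F)
      (case (var 0F) nil (var 0F))
      (case (var 2F) nil
        (call self (cons (var 1F) (var 3F)))))

lookupᶠ-⇓ : ∀ {A : Set} (e : A → Tree) {k} (xs : Vec A k) i →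
            recurᶠ lookup-body ▹ cons (⌜ e ⌝ⱽ xs) ⌜ toℕ i ⌝ᵁ ⇓ e (lookup xs i) ⟨ 7 + k * 10 ⟩
lookupᶠ-⇓ e (x ∷ xs) zero =
  ⇓-mono (m≤m+n 7 _)
    (⇓case-cons (⇓var 0F) (⇓case-nil (⇓var _) (⇓case-cons (⇓var _) (⇓var _))))
lookupᶠ-⇓ e {suc k} (x ∷ xs) (suc i) =
  ⇓-mono (≤-reflexive (arith (k * 10)))
    (⇓case-cons (⇓var 0F) (⇓case-cons (⇓var _) (⇓case-cons (⇓var _)
      (⇓call (⇓cons (⇓var _) (⇓var _)) (lookupᶠ-⇓ e xs i)))))
  where
  arith : ∀ m → 10 + (7 + m) ≡ 7 + (10 + m)
  arith = solve-∀

equal-body : ∀ {p} → Fin p → Exp p 1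
equal-body self =
  case (var 0F) nil
    (case (var 0F)
      (case (var 1F) (cons nil nil) nil)
      (case (var 3F) nil
        (call self (cons (var 3F) (var 1F)))))

equalᶠ-⇓ : ∀ {k} (i j : Fin k) →
           recurᶠ equal-body ▹ cons ⌜ toℕ i ⌝ᵁ ⌜ toℕ j ⌝ᵁ ⇓ ⌜ does (i ≟ j) ⌝ᴮ ⟨ 9 + k * 10 ⟩
equalᶠ-⇓ zero zero =
  ⇓-mono (m≤m+n 9 _)
    (⇓case-cons (⇓var 0F) (⇓case-nil (⇓var _) (⇓case-nil (⇓var _) (⇓cons ⇓nil ⇓nil))))
equalᶠ-⇓ zero (suc j) =
  ⇓-mono (m≤m+n 7 _) (⇓case-cons (⇓var 0F) (⇓case-nil (⇓var _) (⇓case-cons (⇓var _) ⇓nil)))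
equalᶠ-⇓ (suc i) zero =
  ⇓-mono (m≤m+n 7 _) (⇓case-cons (⇓var 0F) (⇓case-cons (⇓var _) (⇓case-nil (⇓var _) ⇓nil)))
equalᶠ-⇓ {suc k} (suc i) (suc j) =
  ⇓-mono (≤-reflexive (arith (k * 10)))
    (⇓case-cons (⇓var 0F) (⇓case-cons (⇓var _) (⇓case-cons (⇓var _)
      (⇓call (⇓cons (⇓var _) (⇓var _)) (equalᶠ-⇓ i j)))))
  where
  arith : ∀ m → 10 + (9 + m) ≡ 9 + (10 + m)
  arith = solve-∀

-- x = (c , list)
range-body : ∀ {p} → Fin p → Exp p 1
range-body self =
  case (var 0F) nil
    (case (var 1F) nil
      (cons (var 2F)
            (call self (cons (cons nil (var 2F)) (var 1F)))))

-- Only the length of the list matters: it drives the recursion while the counter `c` is written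
-- out. This is how the indices are enumerated from a list found in the input.
rangeᶠ-⇓ : ∀ {A : Set} (e : A → Tree) c {k} (xs : Vec A k) →
           recurᶠ range-body ▹ cons ⌜ c ⌝ᵁ (⌜ e ⌝ⱽ xs) ⇓
           ⌜ (λ i → ⌜ c + toℕ i ⌝ᵁ) ⌝ⱽ (allFin k) ⟨ 5 + k * 12 ⟩
rangeᶠ-⇓ e c []       = ⇓case-cons (⇓var 0F) (⇓case-nil (⇓var _) ⇓nil)
rangeᶠ-⇓ e c {suc k} (x ∷ xs) =
  ⇓-mono (≤-reflexive (arith (k * 12)))
    (⇓-result (cong₂ cons (cong ⌜_⌝ᵁ (sym (+-identityʳ c))) tail-eq)
           (⇓case-cons (⇓var 0F) (⇓case-cons (⇓var _)
             (⇓cons (⇓var _) (⇓call (⇓cons (⇓cons ⇓nil (⇓var _)) (⇓var _)) (rangeᶠ-⇓ e (suc c) xs))))))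
  where
  arith : ∀ m → suc (1 + suc (1 + suc (1 + suc (suc (suc (1 + 1) + 1) + (5 + m))))) ≡ 5 + (12 + m)
  arith = solve-∀
  shift : ∀ {m} (f : Fin m → Fin (suc k)) (g : Fin m → Fin k) → (∀ i → f i ≡ suc (g i)) →
          List.map (λ i → ⌜ suc c + toℕ i ⌝ᵁ) (Vec.toList (Vec.tabulate g)) ≡
          List.map (λ i → ⌜ c + toℕ i ⌝ᵁ) (Vec.toList (Vec.tabulate f))
  shift {zero}  f g eq = refl
  shift {suc m} f g eq =
    cong₂ _∷_ (cong ⌜_⌝ᵁ (trans (sym (+-suc c _)) (cong (λ x → c + toℕ x) (sym (eq zero)))))
              (shift (f ∘ suc) (g ∘ suc) (eq ∘ suc))
  tail-eq : ⌜ (λ i → ⌜ suc c + toℕ i ⌝ᵁ) ⌝ⱽ (allFin k) ≡ ⌜ (λ i → ⌜ c + toℕ i ⌝ᵁ) ⌝ⱽ (Vec.tabulate suc)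
  tail-eq = cong ⌜_⌝ᴸ (shift suc (λ i → i) (λ _ → refl))

reverseᶠ : Fn
reverseᶠ = foldlᶠ ((sndᶠ ∘ᶠ fstᶠ) ,ᶠ sndᶠ)

reverseᶠ-⇓ : ∀ {γ} (as bs : List Tree) →
             reverseᶠ ▹ cons γ (cons ⌜ bs ⌝ᴸ ⌜ as ⌝ᴸ) ⇓ ⌜ as List.ʳ++ bs ⌝ᴸ ⟨ 7 + List.length as * 34 ⟩
reverseᶠ-⇓ []       bs = foldlᶠ-nil {(sndᶠ ∘ᶠ fstᶠ) ,ᶠ sndᶠ}
reverseᶠ-⇓ (a ∷ as) bs =
  ⇓-mono (≤-reflexive (arith (List.length as * 34)))
    (foldlᶠ-cons {(sndᶠ ∘ᶠ fstᶠ) ,ᶠ sndᶠ}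
      (,ᶠ-⇓ {sndᶠ ∘ᶠ fstᶠ} {sndᶠ} (∘ᶠ-⇓ {sndᶠ} {fstᶠ} fstᶠ-⇓ sndᶠ-⇓) sndᶠ-⇓)
      (reverseᶠ-⇓ as (a ∷ bs)))
  where
  arith : ∀ m → 17 + ((5 + ((3 + (3 + 3)) + 3)) + (7 + m)) ≡ 7 + (34 + m)
  arith = solve-∀

isCons : Tree → Bool
isCons nil        = false
isCons (cons _ _) = true

leftOf rightOf : Tree → Tree
leftOf nil         = nil
leftOf (cons l _)  = l
rightOf nil        = nil
rightOf (cons _ r) = r

-- A table maps the subsets of a mask to truth values: a binary tree that
-- branches at the elements of the mask.
find : ∀ {k} → Tree → Vec Bool k → Vec Bool k → Bool
find T []          []      = isCons T
find T (false ∷ m) (_ ∷ q) = find T m q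
find T (true ∷ m)  (b ∷ q) = find (if b then rightOf T else leftOf T) m q

-- x = (T , (m , q))
find-body : ∀ {p} → Fin p → Exp p 1
find-body self =
  case (var 0F) nil
    (case (var 1F) nil
      (case (var 0F)
        (case (var 2F) nil (cons nil nil))
        (case (var 3F) nil
          (case (var 2F)
            (call self (cons (var 6F)
                             (cons (var 3F) (var 1F))))
            (case (var 8F)
              (call self (cons nil (cons (var 5F) (var 3F))))
              (case (var 4F)
                (call self (cons (var 0F)
                   (cons (var 7F) (var 5F))))
                (call self (cons (var 3F)
                   (cons (var 9F) (var 7F))))))))))

findᶠ : Fn
findᶠ = recurᶠ find-body

findᶠ-⇓ : ∀ {k} T (m q : Vec Bool k) →
          findᶠ ▹ cons T (cons (⌜ ⌜_⌝ᴮ ⌝ⱽ m) (⌜ ⌜_⌝ᴮ ⌝ⱽ q)) ⇓ ⌜ find T m q ⌝ᴮ ⟨ 11 + k * 20 ⟩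
findᶠ-⇓ nil        [] [] = ⇓-mono (m≤m+n 9 2)
  (⇓case-cons (⇓var 0F) (⇓case-cons (⇓var _) (⇓case-nil (⇓var _) (⇓case-nil (⇓var _) ⇓nil))))
findᶠ-⇓ (cons _ _) [] [] =
  ⇓case-cons (⇓var 0F) (⇓case-cons (⇓var _) (⇓case-nil (⇓var _) (⇓case-cons (⇓var _) (⇓cons ⇓nil ⇓nil))))
findᶠ-⇓ {suc k} T (false ∷ m) (b ∷ q) =
  ⇓-mono (ℕₚ.m≤n⇒m≤o+n 4 (≤-reflexive (arith (k * 20))))
  (⇓case-cons (⇓var 0F) (⇓case-cons (⇓var _) (⇓case-cons (⇓var _) (⇓case-cons (⇓var _) (⇓case-nil (⇓var _)
    (⇓call (⇓cons (⇓var _) (⇓cons (⇓var _) (⇓var _))) (findᶠ-⇓ T m q)))))))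
  where
  arith : ∀ m → 16 + (11 + m) ≡ 7 + (20 + m)
  arith = solve-∀
-- A tree that ends too early reads as `nil` further down, as in `leftOf` and `rightOf`; the program
-- agrees with `find` on every tree.
findᶠ-⇓ {suc k} nil (true ∷ m) (b ∷ q) =
  ⇓-mono (ℕₚ.m≤n⇒m≤o+n 2 (≤-reflexive (arith (k * 20))))
  (⇓-result (cong (λ T → ⌜ find T m q ⌝ᴮ) (nil-children b))
  (⇓case-cons (⇓var 0F) (⇓case-cons (⇓var _) (⇓case-cons (⇓var _) (⇓case-cons (⇓var _) (⇓case-cons (⇓var _)
    (⇓case-nil (⇓var _) (⇓call (⇓cons ⇓nil (⇓cons (⇓var _) (⇓var _))) (findᶠ-⇓ nil m q)))))))))
  where
  arith : ∀ m → 18 + (11 + m) ≡ 9 + (20 + m)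
  arith = solve-∀
  nil-children : ∀ b → nil ≡ (if b then rightOf nil else leftOf nil)
  nil-children false = refl
  nil-children true  = refl
findᶠ-⇓ {suc k} (cons l r) (true ∷ m) (false ∷ q) =
  ⇓-mono (≤-reflexive (arith (k * 20)))
  (⇓case-cons (⇓var 0F) (⇓case-cons (⇓var _) (⇓case-cons (⇓var _) (⇓case-cons (⇓var _) (⇓case-cons (⇓var _)
    (⇓case-cons (⇓var _) (⇓case-nil (⇓var _)
      (⇓call (⇓cons (⇓var _) (⇓cons (⇓var _) (⇓var _))) (findᶠ-⇓ l m q)))))))))
  where
  arith : ∀ m → 20 + (11 + m) ≡ 11 + (20 + m)
  arith = solve-∀
findᶠ-⇓ {suc k} (cons l r) (true ∷ m) (true ∷ q) =
  ⇓-mono (≤-reflexive (arith (k * 20)))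
  (⇓case-cons (⇓var 0F) (⇓case-cons (⇓var _) (⇓case-cons (⇓var _) (⇓case-cons (⇓var _) (⇓case-cons (⇓var _)
    (⇓case-cons (⇓var _) (⇓case-cons (⇓var _)
      (⇓call (⇓cons (⇓var _) (⇓cons (⇓var _) (⇓var _))) (findᶠ-⇓ r m q)))))))))
  where
  arith : ∀ m → 20 + (11 + m) ≡ 11 + (20 + m)
  arith = solve-∀

-- A typed language whose terms are programs with time bounds

-- Syntax instead of functions: one closed expression in the input size bounds the time on all
-- instances, which makes the bound uniformly polynomial.
data Bound : Set where
  #_        : ℕ → Bound
  𝕏         : Bound
  _:+_ _:*_ : Bound → Bound → Bound

infix  8 #_
infixl 6 _:+_
infixl 7 _:*_

eval : Bound → ℕ → ℕ
eval (# c)    n = c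
eval 𝕏        n = n
eval (p :+ q) n = eval p n + eval q n
eval (p :* q) n = eval p n * eval q n

-- The time bounds of terms have the form eval P (N i) * suc (w i γ), where
-- the weight w accounts for the exponential part.
absorb : ∀ c p w → c + p * suc w ≤ (c + p) * suc w
absorb c p w = begin
  c + p * suc w         ≤⟨ +-monoˡ-≤ (p * suc w) (ℕₚ.m≤m*n c (suc w)) ⟩
  c * suc w + p * suc w ≡⟨ ℕₚ.*-distribʳ-+ (suc w) c p ⟨
  (c + p) * suc w       ∎
  where open ℕₚ.≤-Reasoning

-- The same recursion is a search when `op` is a disjunction and builds a table when `op` is `cons`.
-- The choices made so far are kept in the continuation `h`.
branch : ∀ {R : Set} {n} → (R → R → R) → (Vec Bool n → R) →
         ∀ {k} → Vec Bool k → (Vec Bool k → Vec Bool n) → R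
branch op leaf []          h = leaf (h [])
branch op leaf (false ∷ m) h = branch op leaf m (h ∘ (false ∷_))
branch op leaf (true ∷ m)  h =
  op (branch op leaf m (h ∘ (false ∷_))) (branch op leaf m (h ∘ (true ∷_)))

anyFin allFin? : ∀ {n} → (Fin n → Bool) → Bool
anyFin  f = Vec.foldr′ (λ x b → f x ∨ b) false (allFin _)
allFin? f = Vec.foldr′ (λ x b → f x ∧ b) true (allFin _)

module Language (I : Set) (N : I → ℕ) (root : I → Tree) where

  record Length : Set where
    field
      len   : I → ℕ
      bound : Bound
      len≤  : ∀ i → len i ≤ eval bound (N i)

  open Length public using (len)

  infixr 4 _⊗_
  infixr 3 _⊕_

  -- Types are families over the instances.  The contexts of terms are
  -- nested pairs.
  data Ty : Set₁ where
    𝟙 𝔹 𝕋   : Ty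
    fin      : Length → Ty
    vec      : Ty → Length → Ty
    _⊗_ _⊕_  : Ty → Ty → Ty
    coded    : (C : I → Set) → (∀ {i} → C i → Tree) → Ty

  ⟦_⟧ : Ty → I → Set
  ⟦ 𝟙 ⟧         i = Unit
  ⟦ 𝔹 ⟧         i = Bool
  ⟦ 𝕋 ⟧         i = Tree
  ⟦ fin L ⟧     i = Fin (len L i)
  ⟦ vec A L ⟧   i = Vec (⟦ A ⟧ i) (len L i)
  ⟦ A ⊗ B ⟧     i = ⟦ A ⟧ i × ⟦ B ⟧ i
  ⟦ A ⊕ B ⟧     i = ⟦ A ⟧ i ⊎ ⟦ B ⟧ i
  ⟦ coded C _ ⟧ i = C i

  -- The unit type is encoded as `root i`, which contains the input. Thus the instance is accessible
  -- in every context that is built on `𝟙`.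
  enc : ∀ A {i} → ⟦ A ⟧ i → Tree
  enc 𝟙 {i}      _        = root i
  enc 𝔹           b        = ⌜ b ⌝ᴮ
  enc 𝕋           t        = t
  enc (fin L)     x        = ⌜ toℕ x ⌝ᵁ
  enc (vec A L)   xs       = ⌜ enc A ⌝ⱽ xs
  enc (A ⊗ B)     (x , y)  = cons (enc A x) (enc B y)
  enc (A ⊕ B)     (inj₁ x) = cons nil (enc A x)
  enc (A ⊕ B)     (inj₂ y) = cons (cons nil nil) (enc B y)
  enc (coded _ e) x        = e x

  Weight : Ty → Set
  Weight Γ = ∀ i → ⟦ Γ ⟧ i → ℕ

  Map : Ty → Ty → Set
  Map Γ A = ∀ i → ⟦ Γ ⟧ i → ⟦ A ⟧ i

  record Term (Γ : Ty) (w : Weight Γ) (A : Ty) (f : Map Γ A) : Set where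
    constructor term
    field
      code  : Fn
      bound : Bound
      run   : ∀ i γ → code ▹ enc Γ γ ⇓ enc A (f i γ) ⟨ eval bound (N i) * suc (w i γ) ⟩

  open Term public

  Poly : (Γ A : Ty) → Map Γ A → Set
  Poly Γ A f = Term Γ (λ _ _ → 0) A f

  module _ {Γ : Ty} {w : Weight Γ} where

    simple : ∀ {A f} (F : Fn) (c : Bound) →
             (∀ i γ → F ▹ enc Γ γ ⇓ enc A (f i γ) ⟨ eval c (N i) ⟩) → Term Γ w A f
    simple F c d = term F c λ i γ → ⇓-mono (ℕₚ.m≤m*n (eval c (N i)) (suc (w i γ))) (d i γ)

    idᵀ : Term Γ w Γ (λ _ γ → γ)
    idᵀ = simple idᶠ (# 1) λ i γ → ⇓var zero

    -- The weight of the outer term is measured at the value handed to it; the last hypothesis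
    -- expresses it in the original context.
    compose : ∀ {Δ A w′ f g} → Term Δ w′ A f → Term Γ w Δ g →
              (∀ i γ → w′ i (g i γ) ≤ w i γ) → Term Γ w A (λ i γ → f i (g i γ))
    compose (term F p d) (term G q e) w≤ = term (F ∘ᶠ G) (# 3 :+ (q :+ p)) λ i γ →
      ⇓-mono (begin
        3 + (eval q (N i) * suc (w i γ) + eval p (N i) * suc _)
          ≤⟨ +-monoʳ-≤ 3 (+-monoʳ-≤ (eval q (N i) * suc (w i γ)) (*-monoʳ-≤ (eval p (N i)) (s≤s (w≤ i γ)))) ⟩
        3 + (eval q (N i) * suc (w i γ) + eval p (N i) * suc (w i γ))
          ≡⟨ cong (3 +_) (ℕₚ.*-distribʳ-+ (suc (w i γ)) (eval q (N i)) _) ⟨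
        3 + (eval q (N i) + eval p (N i)) * suc (w i γ)
          ≤⟨ absorb 3 (eval q (N i) + eval p (N i)) (w i γ) ⟩
        (3 + (eval q (N i) + eval p (N i))) * suc (w i γ) ∎)
      (∘ᶠ-⇓ {F} {G} (e i γ) (d i _))
      where open ℕₚ.≤-Reasoning

    infixr 1 _$ᵀ_

    _$ᵀ_ : ∀ {Δ A f g} → Poly Δ A f → Term Γ w Δ g → Term Γ w A (λ i γ → f i (g i γ))
    t $ᵀ s = compose t s (λ _ _ → z≤n)

    infixl 4 _,ᵀ_

    _,ᵀ_ : ∀ {A B f g} → Term Γ w A f → Term Γ w B g → Term Γ w (A ⊗ B) (λ i γ → f i γ , g i γ)
    term F p d ,ᵀ term G q e = term (F ,ᶠ G) (# 5 :+ (p :+ q)) λ i γ →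
      ⇓-mono (begin
        5 + (eval p (N i) * suc (w i γ) + eval q (N i) * suc (w i γ))
          ≡⟨ cong (5 +_) (ℕₚ.*-distribʳ-+ (suc (w i γ)) (eval p (N i)) _) ⟨
        5 + (eval p (N i) + eval q (N i)) * suc (w i γ)
          ≤⟨ absorb 5 (eval p (N i) + eval q (N i)) (w i γ) ⟩
        (5 + (eval p (N i) + eval q (N i))) * suc (w i γ) ∎)
      (,ᶠ-⇓ {F} {G} (d i γ) (e i γ))
      where open ℕₚ.≤-Reasoning

    letᵀ : ∀ {A B f g} → Term Γ w A f → Term (Γ ⊗ A) (λ i γ → w i (proj₁ γ)) B g →
           Term Γ w B (λ i γ → g i (γ , f i γ))
    letᵀ t s = compose s (idᵀ ,ᵀ t) (λ _ _ → ≤-refl)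

    constᵀ : ∀ {A} (f : Map Γ A) v → (∀ i γ → v ≡ enc A (f i γ)) → Term Γ w A f
    constᵀ f v eq = simple (constᶠ v) (# size v) λ i γ → ⇓-result (eq i γ) (constᶠ-⇓ v)

    congᵀ : ∀ {A f g} → (∀ i γ → f i γ ≡ g i γ) → Term Γ w A f → Term Γ w A g
    congᵀ {A} eq (term F p d) = term F p λ i γ → ⇓-result (cong (enc A) (eq i γ)) (d i γ)

    -- Costs nothing, as the same tree is read at another type.
    recode : ∀ {A B f} (g : Map A B) → (∀ i x → enc A x ≡ enc B (g i x)) →
             Term Γ w A f → Term Γ w B (λ i γ → g i (f i γ))
    recode g eq (term F p d) = term F p λ i γ → ⇓-result (eq i _) (d i γ)

  fstᵀ : ∀ {Γ A w} → Term (Γ ⊗ A) w Γ (λ _ → proj₁)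
  fstᵀ = simple fstᶠ (# 3) λ _ _ → fstᶠ-⇓

  sndᵀ : ∀ {Γ A w} → Term (Γ ⊗ A) w A (λ _ → proj₂)
  sndᵀ = simple sndᶠ (# 3) λ _ _ → sndᶠ-⇓

  v0 : ∀ {Γ A w} → Term (Γ ⊗ A) w A (λ _ γ → proj₂ γ)
  v0 = sndᵀ

  v1 : ∀ {Γ A B w} → Term ((Γ ⊗ A) ⊗ B) w A (λ _ γ → proj₂ (proj₁ γ))
  v1 = v0 $ᵀ fstᵀ

  v2 : ∀ {Γ A B C w} → Term (((Γ ⊗ A) ⊗ B) ⊗ C) w A (λ _ γ → proj₂ (proj₁ (proj₁ γ)))
  v2 = v1 $ᵀ fstᵀ

  v3 : ∀ {Γ A B C D w} →
       Term ((((Γ ⊗ A) ⊗ B) ⊗ C) ⊗ D) w A (λ _ γ → proj₂ (proj₁ (proj₁ (proj₁ γ))))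
  v3 = v2 $ᵀ fstᵀ

  v4 : ∀ {Γ A B C D E w} → Term (((((Γ ⊗ A) ⊗ B) ⊗ C) ⊗ D) ⊗ E) w A
       (λ _ γ → proj₂ (proj₁ (proj₁ (proj₁ (proj₁ γ)))))
  v4 = v3 $ᵀ fstᵀ

  v5 : ∀ {Γ A B C D E F w} → Term ((((((Γ ⊗ A) ⊗ B) ⊗ C) ⊗ D) ⊗ E) ⊗ F) w A
       (λ _ γ → proj₂ (proj₁ (proj₁ (proj₁ (proj₁ (proj₁ γ))))))
  v5 = v4 $ᵀ fstᵀ

  v6 : ∀ {Γ A B C D E F G w} → Term (((((((Γ ⊗ A) ⊗ B) ⊗ C) ⊗ D) ⊗ E) ⊗ F) ⊗ G) w A
       (λ _ γ → proj₂ (proj₁ (proj₁ (proj₁ (proj₁ (proj₁ (proj₁ γ)))))))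
  v6 = v5 $ᵀ fstᵀ

  data Rooted : Ty → Set₁ where
    here  : Rooted 𝟙
    there : ∀ {Γ A} → Rooted Γ → Rooted (Γ ⊗ A)

  rootᵀ : ∀ {Γ w} → ⦃ Rooted Γ ⦄ → Term Γ w 𝟙 (λ _ _ → tt)
  rootᵀ ⦃ here ⦄    = idᵀ
  rootᵀ ⦃ there r ⦄ = compose (rootᵀ {w = λ _ _ → 0} ⦃ r ⦄) fstᵀ (λ _ _ → z≤n)

  module _ {Γ : Ty} {w : Weight Γ} where

    trueᵀ : Term Γ w 𝔹 (λ _ _ → true)
    trueᵀ = constᵀ _ (cons nil nil) (λ _ _ → refl)

    falseᵀ : Term Γ w 𝔹 (λ _ _ → false)
    falseᵀ = constᵀ _ nil (λ _ _ → refl)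

    ifᵀ : ∀ {A c f g} → Term Γ w 𝔹 c → Term Γ w A f → Term Γ w A g →
          Term Γ w A (λ i γ → if c i γ then f i γ else g i γ)
    ifᵀ {A} b t s = choose $ᵀ (b ,ᵀ (t ,ᵀ s))
      where
      choose : Poly (𝔹 ⊗ (A ⊗ A)) A (λ i x → if proj₁ x then proj₁ (proj₂ x) else proj₂ (proj₂ x))
      choose = simple ifᶠ (# 7) λ where
        i (true , _)  → ifᶠ-⇓ true
        i (false , _) → ifᶠ-⇓ false

    notᵀ : ∀ {b} → Term Γ w 𝔹 b → Term Γ w 𝔹 (λ i γ → not (b i γ))
    notᵀ {b} t = congᵀ (λ i γ → eq (b i γ)) (ifᵀ t falseᵀ trueᵀ)
      where
      eq : ∀ x → (if x then false else true) ≡ not x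
      eq true  = refl
      eq false = refl

    infixr 6 _∧ᵀ_
    infixr 5 _∨ᵀ_

    _∧ᵀ_ : ∀ {a b} → Term Γ w 𝔹 a → Term Γ w 𝔹 b → Term Γ w 𝔹 (λ i γ → a i γ ∧ b i γ)
    _∧ᵀ_ {a} {b} t s = congᵀ (λ i γ → eq (a i γ) (b i γ)) (ifᵀ t s falseᵀ)
      where
      eq : ∀ x y → (if x then y else false) ≡ x ∧ y
      eq true  y = refl
      eq false y = refl

    _∨ᵀ_ : ∀ {a b} → Term Γ w 𝔹 a → Term Γ w 𝔹 b → Term Γ w 𝔹 (λ i γ → a i γ ∨ b i γ)
    _∨ᵀ_ {a} {b} t s = congᵀ (λ i γ → eq (a i γ) (b i γ)) (ifᵀ t trueᵀ s)
      where
      eq : ∀ x y → (if x then true else y) ≡ x ∨ y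
      eq true  y = refl
      eq false y = refl

    -- Serves `foldrᵀ` and `mapᵀ` alike: `c` is the overhead of a round beyond the step itself, 0
    -- for the former and 14 for the latter.
    loop-bound : ∀ (L : Length) c z x s i W →
      3 + ((5 + (1 + (5 + (eval z (N i) * suc W + eval x (N i) * suc W)))) +
           (7 + len L i * (17 + (c + eval s (N i) * suc W)))) ≤
      eval (# 21 :+ (z :+ x) :+ Length.bound L :* (# (17 + c) :+ s)) (N i) * suc W
    loop-bound L c z x s i W = begin
      3 + ((5 + (1 + (5 + (Z * suc W + Y * suc W)))) + (7 + len L i * (17 + (c + S * suc W))))
        ≡⟨ arith Z Y (suc W) (len L i * (17 + (c + S * suc W))) ⟩
      21 + ((Z + Y) * suc W + len L i * (17 + (c + S * suc W)))
        ≤⟨ +-monoʳ-≤ 21 (+-monoʳ-≤ ((Z + Y) * suc W)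
             (*-mono-≤ (Length.len≤ L i) (≤-trans (≤-reflexive (sym (+-assoc 17 c _))) (absorb (17 + c) S W)))) ⟩
      21 + ((Z + Y) * suc W + B * ((17 + c + S) * suc W))
        ≡⟨ arith₂ (Z + Y) (suc W) B (17 + c + S) ⟩
      21 + (Z + Y + B * (17 + c + S)) * suc W
        ≤⟨ absorb 21 (Z + Y + B * (17 + c + S)) W ⟩
      (21 + (Z + Y + B * (17 + c + S))) * suc W
        ≡⟨ cong (_* suc W) (+-assoc 21 (Z + Y) _) ⟨
      (21 + (Z + Y) + B * (17 + c + S)) * suc W ∎
      where
      open ℕₚ.≤-Reasoning
      Z Y S B : ℕ
      Z = eval z (N i)
      Y = eval x (N i)
      S = eval s (N i)
      B = eval (Length.bound L) (N i)
      arith : ∀ z x w m → 3 + ((5 + (1 + (5 + (z * w + x * w)))) + (7 + m)) ≡ 21 + ((z + x) * w + m)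
      arith = solve-∀
      arith₂ : ∀ z w b m → 21 + (z * w + b * (m * w)) ≡ 21 + (z + b * m) * w
      arith₂ = solve-∀

    -- The weight of the step sees neither the element nor the accumulator, so all rounds obey the
    -- same bound, and the exponential part is multiplied only by the length.
    foldrᵀ : ∀ {L A B xs z s} → Term Γ w (vec A L) xs → Term Γ w B z →
             Term ((Γ ⊗ A) ⊗ B) (λ i γ → w i (proj₁ (proj₁ γ))) B s →
             Term Γ w B (λ i γ → Vec.foldr′ (λ x acc → s i ((γ , x) , acc)) (z i γ) (xs i γ))
    foldrᵀ {L} {A} {B} {xs} {z} {s} (term F p d) (term G q e) (term H r h) =
      term (foldrᶠ H ∘ᶠ (idᶠ ,ᶠ (G ,ᶠ F)))
           (# 21 :+ (q :+ p) :+ Length.bound L :* (# 17 :+ r)) λ i γ →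
        ⇓-mono (loop-bound L 0 q p r i (w i γ))
          (∘ᶠ-⇓ {foldrᶠ H} {idᶠ ,ᶠ (G ,ᶠ F)}
            (,ᶠ-⇓ {idᶠ} {G ,ᶠ F} (⇓var zero) (,ᶠ-⇓ {G} {F} (e i γ) (d i γ)))
            (foldrᶠ-Vec {H} (enc A)
              (λ ys → enc B (Vec.foldr′ (λ x acc → s i ((γ , x) , acc)) (z i γ) ys))
              (λ x ys → h i ((γ , x) , _)) (xs i γ)))

    mapᵀ : ∀ {L A B xs s} → Term Γ w (vec A L) xs →
           Term (Γ ⊗ A) (λ i γ → w i (proj₁ γ)) B s →
           Term Γ w (vec B L) (λ i γ → Vec.map (λ x → s i (γ , x)) (xs i γ))
    mapᵀ {L} {A} {B} {xs} {s} (term F p d) (term H r h) =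
      term (foldrᶠ ((H ∘ᶠ fstᶠ) ,ᶠ sndᶠ) ∘ᶠ (idᶠ ,ᶠ (constᶠ nil ,ᶠ F)))
           (# 21 :+ (# 1 :+ p) :+ Length.bound L :* (# (17 + 14) :+ r)) λ i γ →
        ⇓-mono (≤-trans (+-monoʳ-≤ 3 (+-monoˡ-≤ _ (+-monoʳ-≤ 11 (+-monoˡ-≤ (eval p (N i) * suc (w i γ)) (s≤s z≤n)))))
                 (loop-bound L 14 (# 1) p r i (w i γ)))
          (∘ᶠ-⇓ {foldrᶠ ((H ∘ᶠ fstᶠ) ,ᶠ sndᶠ)} {idᶠ ,ᶠ (constᶠ nil ,ᶠ F)}
            (,ᶠ-⇓ {idᶠ} {constᶠ nil ,ᶠ F} (⇓var zero) (,ᶠ-⇓ {constᶠ nil} {F} (constᶠ-⇓ nil) (d i γ)))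
            (foldrᶠ-Vec {(H ∘ᶠ fstᶠ) ,ᶠ sndᶠ} (enc A)
              (λ ys → ⌜ enc B ⌝ⱽ (Vec.map (λ x → s i (γ , x)) ys))
              (λ x ys → ⇓-mono (≤-reflexive (arith (eval r (N i) * suc (w i γ))))
                (,ᶠ-⇓ {H ∘ᶠ fstᶠ} {sndᶠ} (∘ᶠ-⇓ {H} {fstᶠ} fstᶠ-⇓ (h i (γ , x))) sndᶠ-⇓))
              (xs i γ)))
      where
      arith : ∀ m → 5 + ((3 + (3 + m)) + 3) ≡ 14 + m
      arith = solve-∀

    lookupᵀ : ∀ {L A xs x} → Term Γ w (vec A L) xs → Term Γ w (fin L) x →
              Term Γ w A (λ i γ → lookup (xs i γ) (x i γ))
    lookupᵀ {L} {A} t s = access $ᵀ (t ,ᵀ s)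
      where
      access : Poly (vec A L ⊗ fin L) A (λ i p → lookup (proj₁ p) (proj₂ p))
      access = simple (recurᶠ lookup-body) (# 7 :+ Length.bound L :* # 10) λ i (xs , x) →
        ⇓-mono (+-monoʳ-≤ 7 (*-monoˡ-≤ 10 (Length.len≤ L i))) (lookupᶠ-⇓ (enc A) xs x)

    equalᵀ : ∀ {L x y} → Term Γ w (fin L) x → Term Γ w (fin L) y →
             Term Γ w 𝔹 (λ i γ → does (x i γ ≟ y i γ))
    equalᵀ {L} t s = equals $ᵀ (t ,ᵀ s)
      where
      equals : Poly (fin L ⊗ fin L) 𝔹 (λ i p → does (proj₁ p ≟ proj₂ p))
      equals = simple (recurᶠ equal-body) (# 9 :+ Length.bound L :* # 10) λ i (x , y) →
        ⇓-mono (+-monoʳ-≤ 9 (*-monoˡ-≤ 10 (Length.len≤ L i))) (equalᶠ-⇓ x y)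

    findᵀ : ∀ {L T m q} → Term Γ w 𝕋 T → Term Γ w (vec 𝔹 L) m → Term Γ w (vec 𝔹 L) q →
            Term Γ w 𝔹 (λ i γ → find (T i γ) (m i γ) (q i γ))
    findᵀ {L} t m q = access $ᵀ (t ,ᵀ (m ,ᵀ q))
      where
      access : Poly (𝕋 ⊗ (vec 𝔹 L ⊗ vec 𝔹 L)) 𝔹
               (λ i p → find (proj₁ p) (proj₁ (proj₂ p)) (proj₂ (proj₂ p)))
      access = simple findᶠ (# 11 :+ Length.bound L :* # 20) λ i (T , m , q) →
        ⇓-mono (+-monoʳ-≤ 11 (*-monoˡ-≤ 20 (Length.len≤ L i))) (findᶠ-⇓ T m q)

  -- Branching over the subsets of a mask

  module _ {Γ : Ty} {L : Length} {R : Ty} {m : Map Γ (vec 𝔹 L)} {f : Map (Γ ⊗ vec 𝔹 L) R}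
           {g : Map (R ⊗ R) R} (a : ℕ)
           (leaf : Term (Γ ⊗ vec 𝔹 L) (λ i γ → suc a ℕ.^ ∣ proj₂ γ ∣) R f)
           (op : Poly (R ⊗ R) R g) (mask : Poly Γ (vec 𝔹 L) m) where

    -- The loop collects the choices in reverse order.
    leafᶠ : Fn
    leafᶠ = code leaf ∘ᶠ (fstᶠ ,ᶠ (reverseᶠ ∘ᶠ (idᶠ ,ᶠ (constᶠ nil ,ᶠ sndᶠ))))

    -- The summand 46 is 36 for assembling the argument plus 10 for the loop, and 34 is the price of
    -- reversing one choice. The factor 2 replaces the successor of a weight by twice the weight,
    -- which is at least 1.
    leafBound nodeBound : Bound
    leafBound = # 46 :+ Length.bound L :* # 34 :+ bound leaf :* # 2
    nodeBound = # 28 :+ bound op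

    module _ (i : I) (γ : ⟦ Γ ⟧ i) where
      private
        K D : ℕ
        K = eval leafBound (N i)
        D = eval nodeBound (N i)

      weight≥1 : ∀ x o r → 1 ≤ suc x ℕ.^ o * suc (suc x) ℕ.^ r
      weight≥1 x o r = *-mono-≤ (ℕₚ.^-monoʳ-≤ (suc x) {0} {o} z≤n) (ℕₚ.^-monoʳ-≤ (suc (suc x)) {0} {r} z≤n)

      leafᶠ-⇓ : ∀ (as : List Bool) (Q : Vec Bool (len L i)) → Vec.toList Q ≡ as List.ʳ++ [] →
                List.length as ≤ eval (Length.bound L) (N i) →
                leafᶠ ▹ cons (enc Γ γ) ⌜ List.map ⌜_⌝ᴮ as ⌝ᴸ ⇓ enc R (f i (γ , Q))
                ⟨ 36 + eval (Length.bound L) (N i) * 34 + eval (bound leaf) (N i) * suc (suc a ℕ.^ ∣ Q ∣) ⟩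
      leafᶠ-⇓ as Q eq as≤ =
        ⇓-mono (≤-trans (≤-reflexive (arith (List.length (List.map ⌜_⌝ᴮ as) * 34) _))
                 (+-monoˡ-≤ _ (+-monoʳ-≤ 36 (*-monoˡ-≤ 34 (≤-trans (≤-reflexive (Listₚ.length-map ⌜_⌝ᴮ as)) as≤)))))
          (∘ᶠ-⇓ {code leaf} {fstᶠ ,ᶠ rev}
            (,ᶠ-⇓ {fstᶠ} {rev} fstᶠ-⇓
              (⇓-result reversed
                (∘ᶠ-⇓ {reverseᶠ} {idᶠ ,ᶠ (constᶠ nil ,ᶠ sndᶠ)}
                (,ᶠ-⇓ {idᶠ} {constᶠ nil ,ᶠ sndᶠ} idᶠ-⇓ (,ᶠ-⇓ {constᶠ nil} {sndᶠ} (constᶠ-⇓ nil) sndᶠ-⇓))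
                (reverseᶠ-⇓ (List.map ⌜_⌝ᴮ as) []))))
            (run leaf i (γ , Q)))
        where
        rev : Fn
        rev = reverseᶠ ∘ᶠ (idᶠ ,ᶠ (constᶠ nil ,ᶠ sndᶠ))
        reversed : ⌜ List.map ⌜_⌝ᴮ as List.ʳ++ [] ⌝ᴸ ≡ ⌜ ⌜_⌝ᴮ ⌝ⱽ Q
        reversed = cong ⌜_⌝ᴸ (trans (sym (Listₚ.map-ʳ++ ⌜_⌝ᴮ as)) (cong (List.map ⌜_⌝ᴮ) (sym eq)))
        arith : ∀ l p → 3 + (5 + (3 + (3 + (15 + (7 + l)))) + p) ≡ 36 + l + p
        arith = solve-∀

      -- With `o` elements chosen so far, the leaves below weigh `(a+1)^o * (a+2)^∣ M ∣` in total.
      -- Deciding one more element of the mask preserves this, since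
      -- `(a+1)^o + (a+1)^(o+1) = (a+1)^o * (a+2)`. Each level adds at most `D` times this weight
      -- for its own overhead.
      branchᶠ-⇓ : ∀ {k} (M : Vec Bool k) (as : List Bool) o (h : Vec Bool k → Vec Bool (len L i)) →
                  (∀ q → Vec.toList (h q) ≡ as List.ʳ++ Vec.toList q) →
                  List.length as + k ≤ eval (Length.bound L) (N i) →
                  (∀ q → ∣ h q ∣ ≡ o + ∣ q ∣) →
                  branchᶠ leafᶠ (code op) ▹ cons (enc Γ γ) (cons ⌜ List.map ⌜_⌝ᴮ as ⌝ᴸ (⌜ ⌜_⌝ᴮ ⌝ⱽ M)) ⇓
                  enc R (branch (λ x y → g i (x , y)) (λ Q → f i (γ , Q)) M h)
                  ⟨ (K + k * D) * (suc a ℕ.^ o * suc (suc a) ℕ.^ ∣ M ∣) ⟩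
      branchᶠ-⇓ [] as o h h≡ as≤ ∣h∣ =
        ⇓-mono leaf≤
          (branchᶠ-nil {leafᶠ} {code op} (leafᶠ-⇓ as (h []) (h≡ []) (≤-trans (m≤m+n _ 0) as≤)))
        where
        open ℕₚ.≤-Reasoning
        B P Y : ℕ
        B = eval (Length.bound L) (N i)
        P = eval (bound leaf) (N i)
        Y = suc a ℕ.^ o
        Y≥1 : 1 ≤ Y
        Y≥1 = ℕₚ.^-monoʳ-≤ (suc a) {0} {o} z≤n
        arith : ∀ b p y → (46 + b * 34 + p * 2) * y ≡ (46 + b * 34) * y + p * (y + y)
        arith = solve-∀
        arith₂ : ∀ b m → 10 + (36 + b * 34 + m) ≡ (46 + b * 34) * 1 + m
        arith₂ = solve-∀
        leaf≤ : 10 + (36 + B * 34 + P * suc (suc a ℕ.^ ∣ h [] ∣)) ≤ (K + 0) * (Y * 1)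
        leaf≤ = begin
          10 + (36 + B * 34 + P * suc (suc a ℕ.^ ∣ h [] ∣))
            ≡⟨ cong (λ e → 10 + (36 + B * 34 + P * suc (suc a ℕ.^ e))) {∣ h [] ∣} {o} (trans (∣h∣ []) (+-identityʳ o)) ⟩
          10 + (36 + B * 34 + P * suc Y)
            ≡⟨ arith₂ B _ ⟩
          (46 + B * 34) * 1 + P * (1 + Y)
            ≤⟨ +-mono-≤ (*-monoʳ-≤ (46 + B * 34) Y≥1) (*-monoʳ-≤ P (+-monoˡ-≤ Y Y≥1)) ⟩
          (46 + B * 34) * Y + P * (Y + Y)
            ≡⟨ arith B P Y ⟨
          K * Y
            ≡⟨ cong₂ _*_ (+-identityʳ K) (ℕₚ.*-identityʳ Y) ⟨
          (K + 0) * (Y * 1) ∎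
      branchᶠ-⇓ {suc k} (false ∷ M) as o h h≡ as≤ ∣h∣ =
        ⇓-mono node≤
          (branchᶠ-false {leafᶠ} {code op}
            (branchᶠ-⇓ M (false ∷ as) o (h ∘ (false ∷_)) (h≡ ∘ (false ∷_))
              (≤-trans (≤-reflexive (sym (+-suc (List.length as) k))) as≤) (∣h∣ ∘ (false ∷_))))
        where
        open ℕₚ.≤-Reasoning
        Y : ℕ
        Y = suc a ℕ.^ o * suc (suc a) ℕ.^ ∣ M ∣
        arith : ∀ x y d → d * y + x * y ≡ (x + d) * y
        arith = solve-∀
        node≤ : 16 + (K + k * D) * Y ≤ (K + (D + k * D)) * Y
        node≤ = begin
          16 + (K + k * D) * Y
            ≤⟨ +-monoˡ-≤ _ (*-mono-≤ (≤-trans (m≤m+n 16 12) (m≤m+n 28 (eval (bound op) (N i)))) (weight≥1 a o ∣ M ∣)) ⟩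
          D * Y + (K + k * D) * Y ≡⟨ arith (K + k * D) Y D ⟩
          (K + k * D + D) * Y     ≡⟨ cong (_* Y) (trans (+-assoc K (k * D) D) (cong (K +_) (ℕₚ.+-comm (k * D) D))) ⟩
          (K + (D + k * D)) * Y   ∎
      branchᶠ-⇓ {suc k} (true ∷ M) as o h h≡ as≤ ∣h∣ =
        ⇓-mono node≤
          (branchᶠ-true {leafᶠ} {code op}
            (branchᶠ-⇓ M (false ∷ as) o (h ∘ (false ∷_)) (h≡ ∘ (false ∷_)) as≤′ (∣h∣ ∘ (false ∷_)))
            (branchᶠ-⇓ M (true ∷ as) (suc o) (h ∘ (true ∷_)) (h≡ ∘ (true ∷_)) as≤′
              (λ q → trans (∣h∣ (true ∷ q)) (+-suc o ∣ q ∣)))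
            (run op i _))
        where
        open ℕₚ.≤-Reasoning
        as≤′ : suc (List.length as) + k ≤ eval (Length.bound L) (N i)
        as≤′ = ≤-trans (≤-reflexive (sym (+-suc (List.length as) k))) as≤
        O Z E : ℕ
        O = suc a ℕ.^ o
        Z = suc (suc a) ℕ.^ ∣ M ∣
        E = eval (bound op) (N i)
        arith : ∀ x a o z e → 28 + (x * (o * z) + x * ((o + a * o) * z) + e * 1) ≡ (28 + e) * 1 + x * (o * (z + (z + a * z)))
        arith = solve-∀
        arith₂ : ∀ x y d → d * y + x * y ≡ (x + d) * y
        arith₂ = solve-∀
        node≤ : 28 + ((K + k * D) * (O * Z) + (K + k * D) * (suc a ℕ.^ suc o * Z) + E * 1) ≤
                (K + (D + k * D)) * (O * (suc (suc a) ℕ.^ suc ∣ M ∣))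
        node≤ = begin
          28 + ((K + k * D) * (O * Z) + (K + k * D) * (suc a ℕ.^ suc o * Z) + E * 1)
            ≡⟨ arith (K + k * D) a O Z E ⟩
          D * 1 + (K + k * D) * (O * (suc (suc a) ℕ.^ suc ∣ M ∣))
            ≤⟨ +-monoˡ-≤ _ (*-monoʳ-≤ D (weight≥1 a o (suc ∣ M ∣))) ⟩
          D * (O * (suc (suc a) ℕ.^ suc ∣ M ∣)) + (K + k * D) * (O * (suc (suc a) ℕ.^ suc ∣ M ∣))
            ≡⟨ arith₂ (K + k * D) (O * (suc (suc a) ℕ.^ suc ∣ M ∣)) D ⟩
          (K + k * D + D) * (O * (suc (suc a) ℕ.^ suc ∣ M ∣))
            ≡⟨ cong (_* (O * (suc (suc a) ℕ.^ suc ∣ M ∣))) (trans (+-assoc K (k * D) D) (cong (K +_) (ℕₚ.+-comm (k * D) D))) ⟩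
          (K + (D + k * D)) * (O * (suc (suc a) ℕ.^ suc ∣ M ∣)) ∎

    -- The binomial theorem in terms of time: leaves of weight `(a+1)^∣ Q ∣`, summed over all
    -- subsets `Q` of the mask, give `(a+2)^∣ mask ∣`. With `a = 0` polynomial leaves lead to base
    -- 2; with `a = 1` leaves that build tables of size `2^∣ Q ∣` lead to base 3.
    branchᵀ : Term Γ (λ i γ → suc (suc a) ℕ.^ ∣ m i γ ∣) R
                (λ i γ → branch (λ x y → g i (x , y)) (λ Q → f i (γ , Q)) (m i γ) (λ Q → Q))
    branchᵀ = term (branchᶠ leafᶠ (code op) ∘ᶠ (idᶠ ,ᶠ (constᶠ nil ,ᶠ code mask)))
                   (# 15 :+ (bound mask :+ (leafBound :+ Length.bound L :* nodeBound))) λ i γ →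
      ⇓-mono (bound≤ i γ)
        (∘ᶠ-⇓ {branchᶠ leafᶠ (code op)} {idᶠ ,ᶠ (constᶠ nil ,ᶠ code mask)}
          (,ᶠ-⇓ {idᶠ} {constᶠ nil ,ᶠ code mask} idᶠ-⇓ (,ᶠ-⇓ {constᶠ nil} {code mask} (constᶠ-⇓ nil) (run mask i γ)))
          (branchᶠ-⇓ i γ (m i γ) [] 0 (λ q → q) (λ q → refl) (Length.len≤ L i) (λ q → refl)))
      where
      open ℕₚ.≤-Reasoning
      bound≤ : ∀ i γ → 3 + ((5 + (1 + (5 + (1 + eval (bound mask) (N i) * 1)))) +
                 (eval leafBound (N i) + len L i * eval nodeBound (N i)) * (1 * suc (suc a) ℕ.^ ∣ m i γ ∣)) ≤
               eval (# 15 :+ (bound mask :+ (leafBound :+ Length.bound L :* nodeBound))) (N i) * suc (suc (suc a) ℕ.^ ∣ m i γ ∣)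
      bound≤ i γ = begin
        3 + ((5 + (1 + (5 + (1 + M * 1)))) + (K + len L i * D) * (1 * Y))
          ≡⟨ arith M (K + len L i * D) Y ⟩
        15 * 1 + (M * 1 + (K + len L i * D) * Y)
          ≤⟨ +-mono-≤ (*-monoʳ-≤ 15 (s≤s (z≤n {Y}))) (+-mono-≤ (*-monoʳ-≤ M (s≤s (z≤n {Y})))
               (*-mono-≤ (+-monoʳ-≤ K (*-monoˡ-≤ D (Length.len≤ L i))) (n≤1+n Y))) ⟩
        15 * suc Y + (M * suc Y + (K + B * D) * suc Y)
          ≡⟨ arith₂ 15 M (K + B * D) (suc Y) ⟩
        (15 + (M + (K + B * D))) * suc Y ∎
        where
        M K B D Y : ℕ
        M = eval (bound mask) (N i)
        K = eval leafBound (N i)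
        D = eval nodeBound (N i)
        B = eval (Length.bound L) (N i)
        Y = suc (suc a) ℕ.^ ∣ m i γ ∣
        arith : ∀ m x y → 3 + ((5 + (1 + (5 + (1 + m * 1)))) + x * (1 * y)) ≡ 15 * 1 + (m * 1 + x * y)
        arith = solve-∀
        arith₂ : ∀ c m x y → c * y + (m * y + x * y) ≡ (c + (m + x)) * y
        arith₂ = solve-∀

  module Loops (L : Length) (range : Poly 𝟙 (vec (fin L) L) (λ i _ → allFin (len L i)))
               {Γ : Ty} ⦃ rooted : Rooted Γ ⦄ {w : Weight Γ} where

    anyᵀ : ∀ {f} → Term (Γ ⊗ fin L) (λ i γ → w i (proj₁ γ)) 𝔹 f →
           Term Γ w 𝔹 (λ i γ → anyFin (λ x → f i (γ , x)))
    anyᵀ t = foldrᵀ (range $ᵀ rootᵀ) falseᵀ (compose t fstᵀ (λ _ _ → ≤-refl) ∨ᵀ v0)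

    allᵀ : ∀ {f} → Term (Γ ⊗ fin L) (λ i γ → w i (proj₁ γ)) 𝔹 f →
           Term Γ w 𝔹 (λ i γ → allFin? (λ x → f i (γ , x)))
    allᵀ t = foldrᵀ (range $ᵀ rootᵀ) trueᵀ (compose t fstᵀ (λ _ _ → ≤-refl) ∧ᵀ v0)

    tabulateᵀ : ∀ {A f} → Term (Γ ⊗ fin L) (λ i γ → w i (proj₁ γ)) A f →
                Term Γ w (vec A L) (λ i γ → Vec.tabulate (λ x → f i (γ , x)))
    tabulateᵀ t = congᵀ (λ i γ → sym (Vecₚ.tabulate-allFin _)) (mapᵀ (range $ᵀ rootᵀ) t)

    iterateᵀ : ∀ {A z s} → Term Γ w A z → Term ((Γ ⊗ fin L) ⊗ A) (λ i γ → w i (proj₁ (proj₁ γ))) A s →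
               Term Γ w A (λ i γ → Vec.foldr′ (λ x acc → s i ((γ , x) , acc)) (z i γ) (allFin (len L i)))
    iterateᵀ t s = foldrᵀ (range $ᵀ rootᵀ) t s

-- Binary numbers

-- The digits mean `2(1+x)` and `1+2x`. The predecessor of `1+2x` is `2x`, which has to be rewritten
-- in these digits: twice `2(1+x)` is `2(1+(1+2x))`, and for twice `1+2x` the recursion produces the
-- `2x` inside `2(1+2x)`.
double-body : ∀ {p} → Fin p → Exp p 1
double-body self =
  case (var 0F) nil
    (case (var 0F)
      (cons nil (cons (cons nil nil) (var 1F)))
      (cons nil (call self (var 3F))))

pred-body : ∀ {p} → Fin p → Exp p 1
pred-body double =
  case (var 0F) nil
    (case (var 0F)
      (cons (cons nil nil) (var 1F))
      (call double (var 3F)))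

predᶠ : Fn
predᶠ = fn (pred-body (suc zero) ∷ double-body (suc zero) ∷ [])

double-⇓ : ∀ {p} {δ : Functions p} self → lookup δ self ≡ double-body self → ∀ b →
           δ ∙ (⌜ b ⌝ᵇ ∷ []) ⊢ double-body self ⇓ ⌜ ℕᵇ.double b ⌝ᵇ ⟨ 3 + size ⌜ b ⌝ᵇ * 9 ⟩
double-⇓ self eq zero     = ⇓-mono (m≤m+n 3 9) (⇓case-nil (⇓var _) ⇓nil)
double-⇓ self eq 2[1+ b ] = ⇓-mono (m≤m+n 11 _)
  (⇓case-cons (⇓var _) (⇓case-nil (⇓var _) (⇓cons ⇓nil (⇓cons (⇓cons ⇓nil ⇓nil) (⇓var _)))))
double-⇓ {δ = δ} self eq 1+[2 b ] = ⇓-mono (≤-trans (≤-reflexive (arith (size ⌜ b ⌝ᵇ * 9))) (m≤n+m _ 28))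
  (⇓case-cons (⇓var _) (⇓case-cons (⇓var _) (⇓cons ⇓nil (⇓call (⇓var _)
    (subst (λ e → δ ∙ (⌜ b ⌝ᵇ ∷ []) ⊢ e ⇓ ⌜ ℕᵇ.double b ⌝ᵇ ⟨ 3 + size ⌜ b ⌝ᵇ * 9 ⟩) (sym eq) (double-⇓ self eq b))))))
  where
  arith : ∀ m → 8 + (3 + m) ≡ 3 + (8 + m)
  arith = solve-∀

predᶠ-⇓ : ∀ b → predᶠ ▹ ⌜ b ⌝ᵇ ⇓ ⌜ ℕᵇ.pred b ⌝ᵇ ⟨ 9 + size ⌜ b ⌝ᵇ * 9 ⟩
predᶠ-⇓ zero     = ⇓-mono (m≤m+n 3 15) (⇓case-nil (⇓var _) ⇓nil)
predᶠ-⇓ 2[1+ b ] = ⇓-mono (m≤m+n 9 _)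
  (⇓case-cons (⇓var _) (⇓case-nil (⇓var _) (⇓cons (⇓cons ⇓nil ⇓nil) (⇓var _))))
predᶠ-⇓ 1+[2 b ] = ⇓-mono (≤-trans (≤-reflexive (arith (size ⌜ b ⌝ᵇ * 9))) (m≤n+m _ 36))
  (⇓case-cons (⇓var _) (⇓case-cons (⇓var _) (⇓call (⇓var _) (double-⇓ (suc zero) refl b))))
  where
  arith : ∀ m → 6 + (3 + m) ≡ 9 + m
  arith = solve-∀

suc-body : ∀ {p} → Fin p → Exp p 1
suc-body self =
  case (var 0F) (cons (cons nil nil) nil)
    (case (var 0F)
      (cons (cons nil nil) (call self (var 1F)))
      (cons nil (var 3F)))

sucᶠ : Fn
sucᶠ = recurᶠ suc-body

sucᶠ-⇓ : ∀ b → sucᶠ ▹ ⌜ b ⌝ᵇ ⇓ ⌜ ℕᵇ.suc b ⌝ᵇ ⟨ size ⌜ b ⌝ᵇ * 10 ⟩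
sucᶠ-⇓ zero     = ⇓-mono (m≤m+n 7 3) (⇓case-nil (⇓var _) (⇓cons (⇓cons ⇓nil ⇓nil) ⇓nil))
sucᶠ-⇓ 2[1+ b ] = ⇓-mono (m≤n+m (10 + size ⌜ b ⌝ᵇ * 10) 10)
  (⇓case-cons (⇓var _) (⇓case-nil (⇓var _) (⇓cons (⇓cons ⇓nil ⇓nil) (⇓call (⇓var _) (sucᶠ-⇓ b)))))
sucᶠ-⇓ 1+[2 b ] = ⇓-mono (m≤m+n 7 _)
  (⇓case-cons (⇓var _) (⇓case-cons (⇓var _) (⇓cons ⇓nil (⇓var _))))

isZeroᶠ : Fn
isZeroᶠ = fn (case (var 0F) (cons nil nil) nil ∷ [])

isZero : ℕ → Bool
isZero zero    = true
isZero (suc _) = false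

fromℕ-suc : ∀ k → fromℕ (suc k) ≡ ℕᵇ.suc (fromℕ k)
fromℕ-suc k = trans (ℕᵇₚ.fromℕ≡fromℕ' (suc k)) (cong ℕᵇ.suc (sym (ℕᵇₚ.fromℕ≡fromℕ' k)))

isZeroᶠ-⇓ : ∀ k → isZeroᶠ ▹ ⌜ k ⌝ᴺ ⇓ ⌜ isZero k ⌝ᴮ ⟨ 5 ⟩
isZeroᶠ-⇓ zero    = ⇓case-nil (⇓var _) (⇓cons ⇓nil ⇓nil)
isZeroᶠ-⇓ (suc k) rewrite fromℕ-suc k = nonzero (fromℕ k)
  where
  nonzero : ∀ b → isZeroᶠ ▹ ⌜ ℕᵇ.suc b ⌝ᵇ ⇓ nil ⟨ 5 ⟩
  nonzero zero     = ⇓-mono (m≤m+n 3 2) (⇓case-cons (⇓var _) ⇓nil)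
  nonzero 2[1+ _ ] = ⇓-mono (m≤m+n 3 2) (⇓case-cons (⇓var _) ⇓nil)
  nonzero 1+[2 _ ] = ⇓-mono (m≤m+n 3 2) (⇓case-cons (⇓var _) ⇓nil)

-- The two digits have trees of different sizes, so the tree of a predecessor can be larger than the
-- tree of the number. The count of digits does not grow.
digits : ℕᵇ → ℕ
digits zero     = 0
digits 2[1+ b ] = suc (digits b)
digits 1+[2 b ] = suc (digits b)

size≤digits : ∀ b → size ⌜ b ⌝ᵇ ≤ 1 + digits b * 4
size≤digits zero     = s≤s z≤n
size≤digits 2[1+ b ] = ≤-trans (s≤s (s≤s (size≤digits b))) (m≤n+m (3 + digits b * 4) 2)
size≤digits 1+[2 b ] = s≤s (s≤s (s≤s (s≤s (size≤digits b))))

digits≤size : ∀ b → digits b ≤ size ⌜ b ⌝ᵇ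
digits≤size zero     = z≤n
digits≤size 2[1+ b ] = s≤s (ℕₚ.m≤n⇒m≤1+n (digits≤size b))
digits≤size 1+[2 b ] = s≤s (ℕₚ.m≤n⇒m≤o+n 3 (digits≤size b))

digits-double : ∀ b → digits (ℕᵇ.double b) ≤ suc (digits b)
digits-double zero     = z≤n
digits-double 2[1+ b ] = ≤-refl
digits-double 1+[2 b ] = s≤s (digits-double b)

digits-pred : ∀ b → digits (ℕᵇ.pred b) ≤ digits b
digits-pred zero     = z≤n
digits-pred 2[1+ b ] = ≤-refl
digits-pred 1+[2 b ] = digits-double b

digits-suc : ∀ b → digits (ℕᵇ.suc b) ≤ suc (digits b)
digits-suc zero     = ≤-refl
digits-suc 2[1+ b ] = s≤s (digits-suc b)
digits-suc 1+[2 b ] = s≤s (n≤1+n _)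

-- Correctness of tables and of Boolean searches

find-branch : ∀ {n} (f : Vec Bool n → Bool) {k} (m q : Vec Bool k) (h : Vec Bool k → Vec Bool n) →
              find (branch cons (λ Q → ⌜ f Q ⌝ᴮ) m h) m q ≡ f (h (m ∩ q))
find-branch f [] [] h with f (h [])
... | true  = refl
... | false = refl
find-branch f (false ∷ m) (_ ∷ q)     h = find-branch f m q (h ∘ (false ∷_))
find-branch f (true ∷ m)  (false ∷ q) h = find-branch f m q (h ∘ (false ∷_))
find-branch f (true ∷ m)  (true ∷ q)  h = find-branch f m q (h ∘ (true ∷_))

reflects-map : ∀ {P Q : Set} {b} → (P → Q) → (Q → P) → Reflects P b → Reflects Q b
reflects-map f g (ofʸ p)  = ofʸ (f p)
reflects-map f g (ofⁿ ¬p) = ofⁿ (¬p ∘ g)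

-- The subsets of the mask are written as `m ∩ q` with `q` arbitrary. This matches `find-branch`,
-- where the descent skips the positions outside of the mask.
branch-reflects : ∀ {n} {P : Vec Bool n → Set} {f} → (∀ Q → Reflects (P Q) (f Q)) →
                  ∀ {k} (m : Vec Bool k) (h : Vec Bool k → Vec Bool n) →
                  Reflects (∃[ q ] P (h (m ∩ q))) (branch _∨_ f m h)
branch-reflects r []          h = reflects-map ([] ,_) (λ where ([] , p) → p) (r (h []))
branch-reflects r (false ∷ m) h =
  reflects-map (λ (q , p) → false ∷ q , p) (λ where (_ ∷ q , p) → q , p)
    (branch-reflects r m (h ∘ (false ∷_)))
branch-reflects r (true ∷ m)  h =
  reflects-map [ (λ (q , p) → false ∷ q , p) , (λ (q , p) → true ∷ q , p) ]′
    (λ where (false ∷ q , p) → inj₁ (q , p)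
             (true ∷ q , p)  → inj₂ (q , p))
    (branch-reflects r m (h ∘ (false ∷_)) ⊎-reflects branch-reflects r m (h ∘ (true ∷_)))

any-reflects : ∀ {n} {P : Fin n → Set} {f} → (∀ x → Reflects (P x) (f x)) →
               Reflects (∃[ x ] P x) (anyFin f)
any-reflects {P = P} {f} r = go (λ x → x)
  where
  go : ∀ {k} (g : Fin k → Fin _) →
       Reflects (∃[ j ] P (g j)) (Vec.foldr′ (λ x b → f x ∨ b) false (Vec.tabulate g))
  go {zero}  g = ofⁿ λ ()
  go {suc k} g = reflects-map [ (zero ,_) , (λ (j , p) → suc j , p) ]′
    (λ where (zero , p)  → inj₁ p
             (suc j , p) → inj₂ (j , p))
    (r (g zero) ⊎-reflects go (g ∘ suc))

all-reflects : ∀ {n} {P : Fin n → Set} {f} → (∀ x → Reflects (P x) (f x)) →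
               Reflects (∀ x → P x) (allFin? f)
all-reflects {P = P} {f} r = go (λ x → x)
  where
  go : ∀ {k} (g : Fin k → Fin _) →
       Reflects (∀ j → P (g j)) (Vec.foldr′ (λ x b → f x ∧ b) true (Vec.tabulate g))
  go {zero}  g = ofʸ λ ()
  go {suc k} g = reflects-map (λ where (p , _) zero → p
                                       (_ , p) (suc j) → p j)
    (λ p → p zero , p ∘ suc)
    (r (g zero) ×-reflects go (g ∘ suc))

-- Reachability, vertex covers and connectedness

to : ∀ {P : Set} {b} → Reflects P b → T b → P
to (ofʸ p) _ = p

from : ∀ {P : Set} {b} → Reflects P b → P → T b
from (ofʸ _)  _ = _
from (ofⁿ ¬p) p = ¬p p

reflects-dec : ∀ {P : Set} {b} → Reflects P b → Dec P
reflects-dec {b = b} r = b because r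

if-reflects : ∀ {P Q P′ : Set} {b c d} → Reflects P b → Reflects Q c → Reflects P′ d →
              Reflects ((P × Q) ⊎ (¬ P × P′)) (if b then c else d)
if-reflects (ofʸ p)  q r = reflects-map (λ q → inj₁ (p , q)) (λ where (inj₁ (_ , q)) → q
                                                                      (inj₂ (¬p , _)) → contradiction p ¬p) q
if-reflects (ofⁿ ¬p) q r = reflects-map (λ r → inj₂ (¬p , r)) (λ where (inj₁ (p , _)) → contradiction p ¬p
                                                                       (inj₂ (_ , r)) → r) r

∈-reflects : ∀ {n} (X : Subset n) x → Reflects (x ∈ X) (lookup X x)
∈-reflects X x = fromEquivalence (λ t → lookup⇒[]= x X (T-true t)) (λ x∈X → subst T (sym ([]=⇒lookup x∈X)) _)
  where
  T-true : ∀ {b} → T b → b ≡ true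
  T-true {true} _ = refl

∈-tabulate-reflects : ∀ {n} {P : Set} {f : Fin n → Bool} {x} → Reflects P (f x) → Reflects P (lookup (Vec.tabulate f) x)
∈-tabulate-reflects {P = P} {f} {x} = subst (Reflects P) (sym (lookup∘tabulate f x))

module _ {n} {P : Set} {f : Fin n → Bool} {x} (r : Reflects P (f x)) where

  ∈-tabulate⁻ : x ∈ Vec.tabulate f → P
  ∈-tabulate⁻ x∈ = to r (subst T (lookup∘tabulate f x) (from (∈-reflects (Vec.tabulate f) x) x∈))

  ∈-tabulate⁺ : P → x ∈ Vec.tabulate f
  ∈-tabulate⁺ p = to (∈-reflects (Vec.tabulate f) x) (from (∈-tabulate-reflects {f = f} r) p)

≟-reflects : ∀ {n} (x y : Fin n) → Reflects (x ≡ y) (does (x ≟ y))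
≟-reflects x y = proof (x ≟ y)

-- Given by `tabulate`, the form in which `tabulateᵀ` produces them.
empty full : ∀ {n} → Subset n
empty = Vec.tabulate (λ _ → false)
full  = Vec.tabulate (λ _ → true)

singleton : ∀ {n} → Fin n → Subset n
singleton v = Vec.tabulate (λ x → does (v ≟ x))

∈-empty : ∀ {n} {x : Fin n} → ¬ (x ∈ empty)
∈-empty = ∈-tabulate⁻ (T-reflects false)

∈-full : ∀ {n} {x : Fin n} → x ∈ full
∈-full = ∈-tabulate⁺ (T-reflects true) _

∈-singleton : ∀ {n} {v : Fin n} → v ∈ singleton v
∈-singleton {v = v} = ∈-tabulate⁺ (≟-reflects v v) refl

singleton-∈ : ∀ {n} {v x : Fin n} → x ∈ singleton v → v ≡ x
singleton-∈ {v = v} {x} = ∈-tabulate⁻ (≟-reflects v x)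

-- The shape of what a vertex cover can miss of a clique: two missed vertices would leave their edge
-- uncovered. Only `n + 1` such sets have to be tried.
Small : ∀ {n} → Subset n → Set
Small D = ∀ {x y} → x ∈ D → y ∈ D → x ≡ y

small-cases : ∀ {n} {D : Subset n} → Small D → D ≡ empty ⊎ ∃[ v ] D ≡ singleton v
small-cases {D = D} small with reflects-dec (any-reflects (∈-reflects D))
... | yes (v , v∈D) = inj₂ (v , Subsetₚ.⊆-antisym (λ {x} x∈D → subst (_∈ singleton v) (small v∈D x∈D) ∈-singleton)
                                          (λ x∈ → subst (_∈ D) (singleton-∈ x∈) v∈D))
... | no ∄          = inj₁ (Subsetₚ.⊆-antisym (λ x∈D → contradiction (_ , x∈D) ∄) (λ x∈ → contradiction x∈ ∈-empty))

anySmall : ∀ {n} → (Subset n → Bool) → Bool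
anySmall f = f empty ∨ anyFin (λ v → f (singleton v))

anySmall-reflects : ∀ {n} {P : Subset n → Set} {f} → (∀ D → Reflects (P D) (f D)) →
                    Reflects (∃[ D ] Small D × P D) (anySmall f)
anySmall-reflects {P = P} r =
  reflects-map (λ where (inj₁ p)       → empty , (λ x∈ → contradiction x∈ ∈-empty) , p
                        (inj₂ (v , p)) → singleton v , (λ x∈ y∈ → trans (sym (singleton-∈ {v = v} x∈)) (singleton-∈ {v = v} y∈)) , p)
               (λ (D , small , p) → [ (λ eq → inj₁ (subst P eq p)) , (λ (v , eq) → inj₂ (v , subst P eq p)) ]′ (small-cases small))
               (r empty ⊎-reflects any-reflects (λ v → r (singleton v)))

module Reachability {n} (G : Graph (Fin n)) where
  open Graph G using (adj)

  -- Only the vertices entered are required to lie in `X`, not the first one. So `reach B z` is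
  -- meaningful for `z` outside of `B`: it is `z` together with the part of `B` that `z` attaches
  -- to.
  Path : Subset n → Fin n → Fin n → Set
  Path X = Star (λ x y → Adj G x y × y ∈ X)

  grow : Subset n → Subset n → Subset n
  grow X R = Vec.tabulate λ y → lookup R y ∨ (lookup X y ∧ anyFin (λ x → lookup R x ∧ adj x y))

  reach : Subset n → Fin n → Subset n
  reach X u = Vec.foldr′ (λ _ R → grow X R) (singleton u) (allFin n)

  covers : Subset n → Bool
  covers X = allFin? λ x → allFin? λ y → not (adj x y) ∨ (lookup X x ∨ lookup X y)

  connected : Subset n → Bool
  connected X = allFin? λ x → allFin? λ y → not (lookup X x ∧ lookup X y) ∨ lookup (reach X x) y

  Adj-sym : ∀ {x y} → Adj G x y → Adj G y x
  Adj-sym {x} {y} = subst T (Graph.sym G x y)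

  Path-mono : ∀ {X Y} → X ⊆ Y → ∀ {u v} → Path X u v → Path Y u v
  Path-mono X⊆Y = Star.map (λ (e , y∈X) → e , X⊆Y y∈X)

  Path-reverse : ∀ {X u v} → u ∈ X → Path X u v → Path X v u
  Path-reverse u∈X ε               = ε
  Path-reverse u∈X ((e , y∈X) ◅ p) = Path-reverse y∈X p ◅◅ (Adj-sym e , u∈X) ◅ ε

  module _ (X : Subset n) where

    grow-reflects : ∀ R y → Reflects (y ∈ R ⊎ (y ∈ X × ∃[ x ] x ∈ R × Adj G x y))
                    (lookup R y ∨ (lookup X y ∧ anyFin (λ x → lookup R x ∧ adj x y)))
    grow-reflects R y = ∈-reflects R y ⊎-reflects (∈-reflects X y ×-reflects
                          any-reflects (λ x → ∈-reflects R x ×-reflects T-reflects (adj x y)))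

    Closed : Subset n → Set
    Closed R = ∀ x y → x ∈ R → Adj G x y → y ∈ X → y ∈ R

    closed? : ∀ R → Dec (∀ x y → x ∈ R × Adj G x y × y ∈ X → y ∈ R)
    closed? R = reflects-dec (all-reflects λ x → all-reflects λ y →
      (∈-reflects R x ×-reflects T-reflects (adj x y) ×-reflects ∈-reflects X y) →-reflects ∈-reflects R y)

    module _ (u : Fin n) where

      reached : ∀ {A : Set} {k} → Vec A k → Subset n
      reached = Vec.foldr′ (λ _ R → grow X R) (singleton u)

      reached-sound : ∀ {A : Set} {k} (xs : Vec A k) {y} → y ∈ reached xs → Path X u y
      reached-sound []       y∈ = subst (Path X u) (singleton-∈ y∈) ε
      reached-sound (_ ∷ xs) {y} y∈ with ∈-tabulate⁻ (grow-reflects (reached xs) y) y∈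
      ... | inj₁ y∈R                   = reached-sound xs y∈R
      ... | inj₂ (y∈X , x , x∈R , e)   = reached-sound xs x∈R ◅◅ (e , y∈X) ◅ ε

      -- As long as the reached set is not closed, it grows in every round.
      reached-closed : ∀ {A : Set} {k} (xs : Vec A k) → Closed (reached xs) ⊎ suc k ≤ ∣ reached xs ∣
      reached-closed []       = inj₂ (≤-trans (≤-reflexive (sym (Subsetₚ.∣⁅x⁆∣≡1 u)))
        (p⊆q⇒∣p∣≤∣q∣ (λ x∈ → subst (_∈ singleton u) (sym (x∈⁅y⁆⇒x≡y u x∈)) ∈-singleton)))
      reached-closed (_ ∷ xs) with closed? (reached xs)
      ... | yes cl = inj₁ λ x y x∈ e y∈X → ∈-tabulate⁺ (grow-reflects R y) (inj₁ (cl x y (back x∈ , e , y∈X)))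
        where
        R : Subset n
        R = reached xs
        back : ∀ {x} → x ∈ grow X R → x ∈ R
        back {x} x∈ with ∈-tabulate⁻ (grow-reflects R x) x∈
        ... | inj₁ x∈R                  = x∈R
        ... | inj₂ (x∈X , w , w∈R , e)  = cl w x (w∈R , e , x∈X)
      ... | no ¬cl with reached-closed xs
      ...   | inj₁ cl = contradiction (λ x y (x∈ , e , y∈) → cl x y x∈ e y∈) ¬cl
      ...   | inj₂ k≤ = inj₂ (≤-trans (s≤s k≤) (Subsetₚ.p⊂q⇒∣p∣<∣q∣ (R⊆ , new)))
        where
        R : Subset n
        R = reached xs
        R⊆ : R ⊆ grow X R
        R⊆ {x} x∈ = ∈-tabulate⁺ (grow-reflects R x) (inj₁ x∈)
        new : ∃[ y ] y ∈ grow X R × y ∉ R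
        new with reflects-dec (any-reflects λ y → ∈-reflects (grow X R) y ×-reflects ¬-reflects (∈-reflects R y))
        ... | yes p = p
        ... | no ∄  = contradiction (λ x y (x∈ , e , y∈) → inside x y x∈ e y∈) ¬cl
          where
          inside : Closed R
          inside x y x∈ e y∈ with reflects-dec (∈-reflects R y)
          ... | yes y∈R = y∈R
          ... | no y∉R  = contradiction (y , ∈-tabulate⁺ (grow-reflects R y) (inj₂ (y∈ , x , x∈ , e)) , y∉R) ∄

      reach-closed : Closed (reach X u)
      reach-closed with reached-closed (allFin n)
      ... | inj₁ cl = cl
      ... | inj₂ n< = contradiction (≤-trans n< (Subsetₚ.∣p∣≤n (reach X u))) (ℕₚ.<-irrefl refl)

      reach-self : u ∈ reach X u
      reach-self = go (allFin n)
        where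
        go : ∀ {A : Set} {k} (xs : Vec A k) → u ∈ reached xs
        go []       = ∈-singleton
        go (_ ∷ xs) = ∈-tabulate⁺ (grow-reflects (reached xs) u) (inj₁ (go xs))

      reach-reflects : ∀ v → Reflects (Path X u v) (lookup (reach X u) v)
      reach-reflects v = reflects-map (reached-sound (allFin n)) (complete reach-self) (∈-reflects (reach X u) v)
        where
        complete : ∀ {x y} → x ∈ reach X u → Path X x y → y ∈ reach X u
        complete x∈ ε               = x∈
        complete x∈ ((e , y∈X) ◅ p) = complete (reach-closed _ _ x∈ e y∈X) p

    covers-reflects : Reflects (VertexCover G X) (covers X)
    covers-reflects = all-reflects λ x → all-reflects λ y →
      T-reflects (adj x y) →-reflects (∈-reflects X x ⊎-reflects ∈-reflects X y)

    connected⇒Path : Connected (induced G X) → ∀ {x y} → x ∈ X → y ∈ X → Path X x y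
    connected⇒Path conn x∈X y∈X = Star.gmap proj₁ (λ {_} {v} e → e , proj₂ v) (conn (_ , x∈X) (_ , y∈X))

    Path⇒connected : (∀ {x y} → x ∈ X → y ∈ X → Path X x y) → Connected (induced G X)
    Path⇒connected paths (x , x∈X) (y , y∈X) = go x∈X y∈X (paths x∈X y∈X)
      where
      go : ∀ {x y} (x∈X : x ∈ X) (y∈X : y ∈ X) → Path X x y → Star (Adj (induced G X)) (x , x∈X) (y , y∈X)
      go x∈X y∈X ε with VecWithK.[]=-irrelevant x∈X y∈X
      ... | refl = ε
      go x∈X y∈X ((e , z∈X) ◅ p) = e ◅ go z∈X y∈X p

    connected-reflects : Reflects (Connected (induced G X)) (connected X)
    connected-reflects = reflects-map
      (λ paths → Path⇒connected (λ x∈ y∈ → paths _ _ (x∈ , y∈)))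
      (λ conn x y (x∈ , y∈) → connected⇒Path conn x∈ y∈)
      (all-reflects λ x → all-reflects λ y →
        (∈-reflects X x ×-reflects ∈-reflects X y) →-reflects reach-reflects x y)

-- Solutions and the algorithm for clique deletion sets

-- Counting down by predecessors compares `∣ X ∣` with a binary number without computing `∣ X ∣` in
-- binary.
remaining : ∀ {k} → ℕ → Vec Bool k → ℕ
remaining b = Vec.foldr′ (λ x r → if x then ℕ.pred r else r) b

remaining-∸ : ∀ {k} b (X : Subset k) → remaining b X ≡ b ℕ.∸ ∣ X ∣
remaining-∸ b []          = refl
remaining-∸ b (false ∷ X) = remaining-∸ b X
remaining-∸ b (true ∷ X)  = trans (cong ℕ.pred (remaining-∸ b X)) (ℕₚ.pred[m∸n]≡m∸[1+n] b ∣ X ∣)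

-- Starting from `suc b` separates the exact fit `∣ X ∣ = b` from an overdrawn budget; starting from
-- `b`, both would end at 0.
fits : ∀ {k} → ℕ → Vec Bool k → Bool
fits b X = not (isZero (remaining (suc b) X))

fits-reflects : ∀ {k} b (X : Subset k) → Reflects (∣ X ∣ ≤ b) (fits b X)
fits-reflects b X rewrite remaining-∸ (suc b) X = go b ∣ X ∣
  where
  go : ∀ b m → Reflects (m ≤ b) (not (isZero (suc b ℕ.∸ m)))
  go b       zero          = ofʸ z≤n
  go zero    (suc zero)    = ofⁿ λ ()
  go zero    (suc (suc m)) = ofⁿ λ ()
  go (suc b) (suc m)       = reflects-map s≤s ℕ.s≤s⁻¹ (go b m)

module Solutions {n} (G : Graph (Fin n)) (S : Subset n) where
  open Graph G using (adj)
  open Reachability G public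

  -- A solution X meets S in S′ and misses the clique κ ∖ S in the set D,
  -- which has at most one element.  Then it contains the neighbours outside
  -- of κ of the removed vertices.
  module _ (κ S′ D : Subset n) where

    removed : Fin n → Bool
    removed x = if lookup S x then not (lookup S′ x) else (lookup κ x ∧ lookup D x)

    Removed : Fin n → Set
    Removed x = (x ∈ S × x ∉ S′) ⊎ (x ∉ S × x ∈ κ × x ∈ D)

    removed-reflects : ∀ x → Reflects (Removed x) (removed x)
    removed-reflects x = if-reflects (∈-reflects S x) (¬-reflects (∈-reflects S′ x))
                                     (∈-reflects κ x ×-reflects ∈-reflects D x)

    base : Subset n
    base = Vec.tabulate λ y →
      if lookup S y then lookup S′ y else
      if lookup κ y then not (lookup D y) else
      anyFin (λ x → adj x y ∧ removed x)

    Base : Fin n → Set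
    Base y = (y ∈ S × y ∈ S′) ⊎ (y ∉ S × ((y ∈ κ × y ∉ D) ⊎ (y ∉ κ × ∃[ x ] Adj G x y × Removed x)))

    base-reflects : ∀ y → Reflects (Base y) (if lookup S y then lookup S′ y else
      if lookup κ y then not (lookup D y) else anyFin (λ x → adj x y ∧ removed x))
    base-reflects y = if-reflects (∈-reflects S y) (∈-reflects S′ y)
      (if-reflects (∈-reflects κ y) (¬-reflects (∈-reflects D y))
        (any-reflects λ x → T-reflects (adj x y) ×-reflects removed-reflects x))

    base⁻ : ∀ {y} → y ∈ base → Base y
    base⁻ {y} = ∈-tabulate⁻ (base-reflects y)

    base⁺ : ∀ {y} → Base y → y ∈ base
    base⁺ {y} = ∈-tabulate⁺ (base-reflects y)

  -- Relative to a set `U`, so that it can be the invariant when the partition is computed vertex by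
  -- vertex.
  SplitPartition : Subset n → Subset n → Set
  SplitPartition U κ = ∀ x y → (x ∈ U × x ∉ S) × (y ∈ U × y ∉ S) →
    (x ∈ κ × y ∈ κ → x ≡ y ⊎ Adj G x y) × ((x ∈ κ ⊎ y ∈ κ) ⊎ ¬ Adj G x y)

  module Traces {κ X} (split : SplitPartition full κ) (X-covers : VertexCover G X) where

    S′ D : Subset n
    S′ = S ∩ X
    D  = Vec.tabulate λ x → not (lookup S x) ∧ (lookup κ x ∧ not (lookup X x))

    D-reflects : ∀ x → Reflects (x ∉ S × x ∈ κ × x ∉ X) (not (lookup S x) ∧ (lookup κ x ∧ not (lookup X x)))
    D-reflects x = ¬-reflects (∈-reflects S x) ×-reflects ∈-reflects κ x ×-reflects ¬-reflects (∈-reflects X x)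

    D⁻ : ∀ {x} → x ∈ D → x ∉ S × x ∈ κ × x ∉ X
    D⁻ {x} = ∈-tabulate⁻ (D-reflects x)

    D⁺ : ∀ {x} → x ∉ S × x ∈ κ × x ∉ X → x ∈ D
    D⁺ {x} = ∈-tabulate⁺ (D-reflects x)

    uncovered : ∀ {x y} → x ∉ X → y ∉ X → ¬ Adj G x y
    uncovered x∉ y∉ e = [ x∉ , y∉ ]′ (X-covers _ _ e)

    D-small : Small D
    D-small {x} {y} x∈D y∈D with D⁻ x∈D | D⁻ y∈D
    ... | x∉S , x∈κ , x∉X | y∉S , y∈κ , y∉X with proj₁ (split x y ((∈-full , x∉S) , (∈-full , y∉S))) (x∈κ , y∈κ)
    ...   | inj₁ x≡y = x≡y
    ...   | inj₂ e   = contradiction e (uncovered x∉X y∉X)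

    B : Subset n
    B = base κ S′ D

    removed-∉ : ∀ {x} → Removed κ S′ D x → x ∉ X
    removed-∉ (inj₁ (x∈S , x∉S′))    x∈X = x∉S′ (x∈p∩q⁺ (x∈S , x∈X))
    removed-∉ (inj₂ (_ , _ , x∈D))       = proj₂ (proj₂ (D⁻ x∈D))

    ∈? : ∀ (Y : Subset n) x → Dec (x ∈ Y)
    ∈? Y x = reflects-dec (∈-reflects Y x)

    B⊆X : B ⊆ X
    B⊆X {y} y∈B with base⁻ κ S′ D y∈B
    ... | inj₁ (_ , y∈S′) = proj₂ (x∈p∩q⁻ S X y∈S′)
    ... | inj₂ (y∉S , inj₂ (_ , x , e , gone)) = [ (λ x∈X → contradiction x∈X (removed-∉ gone)) , (λ y∈X → y∈X) ]′ (X-covers x y e)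
    ... | inj₂ (y∉S , inj₁ (y∈κ , y∉D)) with ∈? X y
    ...   | yes y∈X = y∈X
    ...   | no y∉X  = contradiction (D⁺ (y∉S , y∈κ , y∉X)) y∉D

    Independent : Fin n → Set
    Independent x = x ∉ S × x ∉ κ

    independent : ∀ {x y} → Independent x → Independent y → ¬ Adj G x y
    independent {x} {y} (x∉S , x∉κ) (y∉S , y∉κ) =
      [ [ (λ x∈ → contradiction x∈ x∉κ) , (λ y∈ → contradiction y∈ y∉κ) ]′ , (λ ¬e → ¬e) ]′
      (proj₂ (split x y ((∈-full , x∉S) , (∈-full , y∉S))))

    kind : ∀ x → Independent x ⊎ (x ∈ S) ⊎ (x ∉ S × x ∈ κ)
    kind x with ∈? S x | ∈? κ x
    ... | yes x∈S | _       = inj₂ (inj₁ x∈S)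
    ... | no x∉S  | yes x∈κ = inj₂ (inj₂ (x∉S , x∈κ))
    ... | no x∉S  | no x∉κ  = inj₁ (x∉S , x∉κ)

    S∩X⊆B : ∀ {x} → x ∈ S → x ∈ X → x ∈ B
    S∩X⊆B x∈S x∈X = base⁺ κ S′ D (inj₁ (x∈S , x∈p∩q⁺ (x∈S , x∈X)))

    κ∩X⊆B : ∀ {x} → x ∉ S → x ∈ κ → x ∈ X → x ∈ B
    κ∩X⊆B x∉S x∈κ x∈X = base⁺ κ S′ D (inj₂ (x∉S , inj₁ (x∈κ , λ x∈D → proj₂ (proj₂ (D⁻ x∈D)) x∈X)))

    X∖B-independent : ∀ {x} → x ∈ X → x ∉ B → Independent x
    X∖B-independent {x} x∈X x∉B with kind x
    ... | inj₁ i                    = i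
    ... | inj₂ (inj₁ x∈S)           = contradiction (S∩X⊆B x∈S x∈X) x∉B
    ... | inj₂ (inj₂ (x∉S , x∈κ))   = contradiction (κ∩X⊆B x∉S x∈κ x∈X) x∉B

    ∉B-removed : ∀ {x} → x ∉ B → Independent x ⊎ Removed κ S′ D x
    ∉B-removed {x} x∉B with kind x
    ... | inj₁ i          = inj₁ i
    ... | inj₂ (inj₁ x∈S) = inj₂ (inj₁ (x∈S , λ x∈S′ → x∉B (base⁺ κ S′ D (inj₁ (x∈S , x∈S′)))))
    ... | inj₂ (inj₂ (x∉S , x∈κ)) with ∈? D x
    ...   | yes x∈D = inj₂ (inj₂ (x∉S , x∈κ , x∈D))
    ...   | no x∉D  = contradiction (base⁺ κ S′ D (inj₂ (x∉S , inj₁ (x∈κ , x∉D)))) x∉B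

    forced : ∀ {x y} → Removed κ S′ D x → Adj G x y → Independent y → y ∈ B
    forced gone e (y∉S , y∉κ) = base⁺ κ S′ D (inj₂ (y∉S , inj₂ (y∉κ , _ , e , gone)))

    -- A vertex outside of `B` is independent or removed. Two independent vertices are not adjacent,
    -- an independent neighbour of a removed vertex is in `B` by construction, and two removed
    -- vertices are both missed by `X`, which covers all edges.
    B-covers : VertexCover G B
    B-covers x y e with ∈? B x | ∈? B y
    ... | yes x∈B | _       = inj₁ x∈B
    ... | no _    | yes y∈B = inj₂ y∈B
    ... | no x∉B  | no y∉B with ∉B-removed x∉B | ∉B-removed y∉B
    ...   | inj₁ i | inj₁ j = contradiction e (independent i j)
    ...   | inj₁ i | inj₂ s = contradiction (forced s (Adj-sym e) i) x∉B
    ...   | inj₂ r | inj₁ j = contradiction (forced r e j) y∉B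
    ...   | inj₂ r | inj₂ s = contradiction e (uncovered (removed-∉ r) (removed-∉ s))

  Solution : ℕ → Set
  Solution ℓ = ∃[ X ] ConnectedVertexCover G X × ∣ X ∣ ≤ ℓ

  module CliqueCase (ℓ : ℕ) where

    leaf₃ : Subset n → Bool
    leaf₃ S′ = anySmall λ D → covers (base full S′ D) ∧ (connected (base full S′ D) ∧ fits ℓ (base full S′ D))

    solve₃ : Bool
    solve₃ = branch _∨_ leaf₃ S (λ S′ → S′)

    -- With `κ = full` no vertex is left on the independent side, so the guess read off from a
    -- solution `X` has base exactly `X`. Conversely, every accepted guess has been checked
    -- completely.
    solve₃-reflects : CliqueDeletionSet G S → Reflects (Solution ℓ) solve₃
    solve₃-reflects clique = reflects-map sound complete
      (branch-reflects (λ S′ → anySmall-reflects λ D →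
        covers-reflects (base full S′ D) ×-reflects connected-reflects (base full S′ D) ×-reflects fits-reflects ℓ (base full S′ D))
        S (λ S′ → S′))
      where
      sound : (∃[ q ] ∃[ D ] Small D × VertexCover G (base full (S ∩ q) D) ×
                 Connected (induced G (base full (S ∩ q) D)) × ∣ base full (S ∩ q) D ∣ ≤ ℓ) → Solution ℓ
      sound (_ , _ , _ , cov , conn , size≤) = _ , (cov , conn) , size≤
      split : SplitPartition full full
      split x y ((_ , x∉S) , (_ , y∉S)) = adjacent , inj₁ (inj₁ ∈-full)
        where
        adjacent : x ∈ full × y ∈ full → x ≡ y ⊎ Adj G x y
        adjacent _ with x ≟ y
        ... | yes x≡y = inj₁ x≡y
        ... | no x≢y  = inj₂ (clique (x , Subsetₚ.x∉p⇒x∈∁p x∉S) (y , Subsetₚ.x∉p⇒x∈∁p y∉S) (x≢y ∘ cong proj₁))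
      complete : Solution ℓ → ∃[ q ] ∃[ D ] Small D × VertexCover G (base full (S ∩ q) D) ×
                   Connected (induced G (base full (S ∩ q) D)) × ∣ base full (S ∩ q) D ∣ ≤ ℓ
      complete (X , (cov , conn) , size≤) =
        -- The whole of `X` may serve as `q`, since the branching turns it into `S ∩ X`.
        X , D , D-small , B-covers ,
        subst (λ Y → Connected (induced G Y)) (sym B≡X) conn , ≤-trans (≤-reflexive (cong ∣_∣ B≡X)) size≤
        where
        open Traces split cov
        X⊆B : X ⊆ B
        X⊆B {x} x∈X with ∈? B x
        ... | yes x∈B = x∈B
        ... | no x∉B  = contradiction ∈-full (proj₂ (X∖B-independent x∈X x∉B))
        B≡X : B ≡ X
        B≡X = Subsetₚ.⊆-antisym B⊆X X⊆B

-- The algorithm for split deletion sets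

∣p∪⁅x⁆∣≤ : ∀ {k} (Z : Subset k) z → ∣ Z ∪ ⁅ z ⁆ ∣ ≤ suc ∣ Z ∣
∣p∪⁅x⁆∣≤ (false ∷ Z) zero    = ≤-reflexive (cong suc (cong ∣_∣ (Subsetₚ.∪-identityʳ Z)))
∣p∪⁅x⁆∣≤ (true ∷ Z)  zero    = ≤-trans (≤-reflexive (cong suc (cong ∣_∣ (Subsetₚ.∪-identityʳ Z)))) (n≤1+n _)
∣p∪⁅x⁆∣≤ (false ∷ Z) (suc z) = ∣p∪⁅x⁆∣≤ Z z
∣p∪⁅x⁆∣≤ (true ∷ Z)  (suc z) = s≤s (∣p∪⁅x⁆∣≤ Z z)

module SplitCase {n} (G : Graph (Fin n)) (S : Subset n) (ℓ : ℕ) where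
  open Graph G using (adj)
  open Solutions G S

  tableOf : Subset n → (Subset n → Bool) → Tree
  tableOf S′ f = branch cons (λ Q → ⌜ f Q ⌝ᴮ) S′ (λ Q → Q)

  find-tableOf : ∀ S′ f Q → find (tableOf S′ f) S′ Q ≡ f (S′ ∩ Q)
  find-tableOf S′ f Q = find-branch f S′ Q (λ Q → Q)

  without : Subset n → Subset n → Subset n
  without Q M = Vec.tabulate λ y → lookup Q y ∧ not (lookup M y)

  insert : Subset n → Fin n → Subset n
  insert Q w = Vec.tabulate λ y → lookup Q y ∨ does (w ≟ y)

  without-reflects : ∀ (Q M : Subset n) y → Reflects (y ∈ Q × y ∉ M) (lookup Q y ∧ not (lookup M y))
  without-reflects Q M y = ∈-reflects Q y ×-reflects ¬-reflects (∈-reflects M y)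

  insert-reflects : ∀ (Q : Subset n) w y → Reflects (y ∈ Q ⊎ w ≡ y) (lookup Q y ∨ does (w ≟ y))
  insert-reflects Q w y = ∈-reflects Q y ⊎-reflects ≟-reflects w y

  without⁺ : ∀ (Q M : Subset n) {y} → y ∈ Q → y ∉ M → y ∈ without Q M
  without⁺ Q M {y} y∈Q y∉M = ∈-tabulate⁺ (without-reflects Q M y) (y∈Q , y∉M)

  insert⁺ : ∀ (Q : Subset n) w {y} → y ∈ Q ⊎ w ≡ y → y ∈ insert Q w
  insert⁺ Q w {y} = ∈-tabulate⁺ (insert-reflects Q w y)

  -- In round j the table tells which subsets of S′ can be connected to the
  -- root r by adding at most j vertices to B.
  module Rounds (B S′ : Subset n) (r : Fin n) where

    start : Subset n → Bool
    start Q = allFin? λ y → not (lookup Q y) ∨ lookup (reach B r) y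

    -- The last vertex added is z; it connects M and is connected to r directly
    -- or through an element w of S′.
    extend : Tree → Subset n → Fin n → Bool
    extend T Q z =
      (lookup (reach B z) r ∧ find T S′ (without Q (reach B z))) ∨
      anyFin (λ w → (lookup S′ w ∧ lookup (reach B z) w) ∧ find T S′ (insert (without Q (reach B z)) w))

    next : Tree → Subset n → Bool
    next T Q = find T S′ Q ∨ anyFin (extend T Q)

    -- The loop always runs `n` times, but the table is frozen once the budget `e` is spent. This
    -- handles budgets far beyond `n` in polynomially many rounds.
    round : Tree × ℕ → Tree × ℕ
    round (T , e) = (if isZero e then T else tableOf S′ (next T)) , ℕ.pred e

    rounds : ∀ {A : Set} {k} → ℕ → Vec A k → Tree × ℕ
    rounds e = Vec.foldr′ (λ _ → round) (tableOf S′ start , e)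

    -- Here `j` counts the rounds that took effect: either the budget is used up or every round did.
    -- Keeping `Inv` abstract serves both soundness and completeness.
    rounds-invariant : (Inv : Tree → ℕ → Set) → Inv (tableOf S′ start) 0 →
      (∀ {T j} → Inv T j → Inv (tableOf S′ (next T)) (suc j)) →
      ∀ {A : Set} {k} e (xs : Vec A k) →
      ∃[ j ] j + proj₂ (rounds e xs) ≡ e × (proj₂ (rounds e xs) ≡ 0 ⊎ k ≤ j) × Inv (proj₁ (rounds e xs)) j
    rounds-invariant Inv i₀ i₊ e []       = 0 , refl , inj₂ z≤n , i₀
    rounds-invariant Inv i₀ i₊ e (_ ∷ xs) with rounds e xs | rounds-invariant Inv i₀ i₊ e xs
    ... | T , zero  | j , j+0 , _         , i = j , j+0 , inj₁ refl , i
    ... | T , suc f | j , j+f , inj₂ k≤j  , i = suc j , trans (sym (+-suc j f)) j+f , inj₂ (s≤s k≤j) , i₊ i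

    Holds : Tree → Subset n → Set
    Holds t Q = T (find t S′ Q)

    Step : Tree → Subset n → Fin n → Set
    Step t Q z = (Path B z r × Holds t (without Q (reach B z))) ⊎
                 (∃[ w ] (w ∈ S′ × Path B z w) × Holds t (insert (without Q (reach B z)) w))

    next-reflects : ∀ t Q → Reflects (Holds t Q ⊎ ∃[ z ] Step t Q z) (next t Q)
    next-reflects t Q = T-reflects _ ⊎-reflects any-reflects λ z →
      (reach-reflects B z r ×-reflects T-reflects _) ⊎-reflects
      any-reflects λ w → (∈-reflects S′ w ×-reflects reach-reflects B z w) ×-reflects T-reflects _

    start-reflects : ∀ Q → Reflects (∀ y → y ∈ Q → Path B r y) (start Q)
    start-reflects Q = all-reflects λ y → ∈-reflects Q y →-reflects reach-reflects B r y

    holds-tableOf : ∀ {P : Set} {f Q} → Reflects P (f (S′ ∩ Q)) → Reflects P (find (tableOf S′ f) S′ Q)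
    holds-tableOf {P} {f} {Q} = subst (Reflects P) (sym (find-tableOf S′ f Q))

    -- The added vertices themselves must be reached too, so that `B ∪ Z` becomes connected once the
    -- rest of `B` is anchored.
    Connects : Subset n → ℕ → Subset n → Set
    Connects Q j Z = ∣ Z ∣ ≤ j × (∀ {q} → q ∈ S′ → q ∈ Q → Path (B ∪ Z) r q) × (∀ {z} → z ∈ Z → Path (B ∪ Z) r z)

    Sound : Tree → ℕ → Set
    Sound t j = ∀ Q → Holds t Q → ∃[ Z ] Connects Q j Z

    module _ (r∈B : r ∈ B) where

      start-sound : Sound (tableOf S′ start) 0
      start-sound Q holds = Subset.⊥ , ≤-reflexive (Subsetₚ.∣⊥∣≡0 n) ,
        (λ q∈S′ q∈Q → Path-mono (p⊆p∪q Subset.⊥)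
          (to (holds-tableOf {Q = Q} (start-reflects (S′ ∩ Q))) holds _ (x∈p∩q⁺ (q∈S′ , q∈Q)))) ,
        (λ z∈⊥ → contradiction z∈⊥ Subsetₚ.∉⊥)

      -- After adding `z`, the part of the query inside `reach B z` is joined through `z`, and the
      -- rest is joined by the set `Z` of the earlier table. A path from `r` to `z` exists inside
      -- `B`, or passes through `w`, whose insertion into the query made it reachable.
      next-sound : ∀ {t j} → Sound t j → Sound (tableOf S′ (next t)) (suc j)
      next-sound {t} {j} sound Q holds with to (holds-tableOf {Q = Q} (next-reflects t (S′ ∩ Q))) holds
      ... | inj₁ old with sound (S′ ∩ Q) old
      ...   | Z , Z≤ , paths , conn = Z , ℕₚ.m≤n⇒m≤1+n Z≤ , (λ q∈S′ q∈Q → paths q∈S′ (x∈p∩q⁺ (q∈S′ , q∈Q))) , conn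
      next-sound {t} {j} sound Q holds | inj₂ (z , step) = [ via-root , via-S′ ]′ step
        where
        M Q′ : Subset n
        M  = reach B z
        Q′ = without (S′ ∩ Q) M
        module _ {Z} (Z≤ : ∣ Z ∣ ≤ j) (paths : ∀ {q} → q ∈ S′ → q ∈ Q′ → Path (B ∪ Z) r q)
                 (conn : ∀ {y} → y ∈ Z → Path (B ∪ Z) r y) (r→z : Path (B ∪ (Z ∪ ⁅ z ⁆)) r z) where
          Z⁺ : Subset n
          Z⁺ = Z ∪ ⁅ z ⁆
          bigger : B ∪ Z ⊆ B ∪ Z⁺
          bigger x∈ = x∈p∪q⁺ ([ inj₁ , (λ x∈Z → inj₂ (x∈p∪q⁺ (inj₁ x∈Z))) ]′ (x∈p∪q⁻ B Z x∈))
          result : ∃[ Z ] Connects Q (suc j) Z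
          result = Z⁺ , ≤-trans (∣p∪⁅x⁆∣≤ Z z) (s≤s Z≤) , reaches , reaches-Z
            where
            reaches : ∀ {q} → q ∈ S′ → q ∈ Q → Path (B ∪ Z⁺) r q
            reaches {q} q∈S′ q∈Q with reflects-dec (reach-reflects B z q)
            ... | yes z→q = r→z ◅◅ Path-mono (p⊆p∪q Z⁺) z→q
            ... | no ¬z→q = Path-mono bigger (paths q∈S′ (without⁺ (S′ ∩ Q) M (x∈p∩q⁺ (q∈S′ , q∈Q))
                              (λ q∈M → ¬z→q (to (reach-reflects B z q) (from (∈-reflects M q) q∈M)))))
            reaches-Z : ∀ {y} → y ∈ Z⁺ → Path (B ∪ Z⁺) r y
            reaches-Z y∈ with x∈p∪q⁻ Z ⁅ z ⁆ y∈
            ... | inj₁ y∈Z = Path-mono bigger (conn y∈Z)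
            ... | inj₂ y∈z rewrite x∈⁅y⁆⇒x≡y z y∈z = r→z
        z∈⁺ : ∀ Z → z ∈ B ∪ (Z ∪ ⁅ z ⁆)
        z∈⁺ Z = x∈p∪q⁺ (inj₂ (x∈p∪q⁺ (inj₂ (x∈⁅x⁆ z))))
        B⊆⁺ : ∀ Z → B ⊆ B ∪ (Z ∪ ⁅ z ⁆)
        B⊆⁺ Z = p⊆p∪q (Z ∪ ⁅ z ⁆)
        via-root : Path B z r × Holds t Q′ → ∃[ Z ] Connects Q (suc j) Z
        via-root (z→r , h) with sound Q′ h
        ... | Z , Z≤ , paths , conn = result Z≤ paths conn
                (Path-reverse (z∈⁺ Z) (Path-mono (B⊆⁺ Z) z→r))
        via-S′ : ∃[ w ] (w ∈ S′ × Path B z w) × Holds t (insert Q′ w) → ∃[ Z ] Connects Q (suc j) Z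
        via-S′ (w , (w∈S′ , z→w) , h) with sound (insert Q′ w) h
        ... | Z , Z≤ , paths , conn = result Z≤
                (λ q∈S′ q∈Q′ → paths q∈S′ (insert⁺ Q′ w (inj₁ q∈Q′))) conn
                (Path-mono bigger′ (paths w∈S′ (insert⁺ Q′ w (inj₂ refl))) ◅◅
                 Path-reverse (z∈⁺ Z) (Path-mono (B⊆⁺ Z) z→w))
          where
          bigger′ : B ∪ Z ⊆ B ∪ (Z ∪ ⁅ z ⁆)
          bigger′ x∈ = x∈p∪q⁺ ([ inj₁ , (λ x∈Z → inj₂ (x∈p∪q⁺ (inj₁ x∈Z))) ]′ (x∈p∪q⁻ B Z x∈))

    -- The converse: from r one can grow through all of X ⊇ B by adding vertices
    -- outside of B one at a time, each adjacent to what is reached already.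
    module Growth (X : Subset n) (B⊆X : B ⊆ X) (r∈B : r ∈ B)
                  (touch : ∀ {w z} → z ∈ X → z ∉ B → w ∈ X → Adj G w z → (w ∈ S′ × w ∈ B) ⊎ Path B z r) where

      data Grown : ℕ → Subset n → Set where
        none : Grown 0 Subset.⊥
        add  : ∀ {i Y z w} → Grown i Y → z ∈ X → z ∉ B → z ∉ Y → w ∈ X → Path (B ∪ Y) r w → Adj G w z →
                Grown (suc i) (Y ∪ ⁅ z ⁆)

      ∪-mono : ∀ Y z → B ∪ Y ⊆ B ∪ (Y ∪ ⁅ z ⁆)
      ∪-mono Y z x∈ = x∈p∪q⁺ ([ inj₁ , (λ x∈Y → inj₂ (x∈p∪q⁺ (inj₁ x∈Y))) ]′ (x∈p∪q⁻ B Y x∈))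

      new∈ : ∀ Y z → z ∈ B ∪ (Y ∪ ⁅ z ⁆)
      new∈ Y z = x∈p∪q⁺ (inj₂ (x∈p∪q⁺ (inj₂ (x∈⁅x⁆ z))))

      grown-reached : ∀ {i Y} → Grown i Y → ∀ {y} → y ∈ Y → Path (B ∪ Y) r y
      grown-reached none y∈⊥ = contradiction y∈⊥ Subsetₚ.∉⊥
      grown-reached (add {Y = Y} {z} g _ _ _ _ p e) y∈ with x∈p∪q⁻ Y ⁅ z ⁆ y∈
      ... | inj₁ y∈Y = Path-mono (∪-mono Y z) (grown-reached g y∈Y)
      ... | inj₂ y∈z rewrite x∈⁅y⁆⇒x≡y z y∈z = Path-mono (∪-mono Y z) p ◅◅ (e , new∈ Y z) ◅ ε

      grown-⊆ : ∀ {i Y} → Grown i Y → B ∪ Y ⊆ X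
      grown-⊆ none x∈ = [ B⊆X , (λ x∈⊥ → contradiction x∈⊥ Subsetₚ.∉⊥) ]′ (x∈p∪q⁻ B Subset.⊥ x∈)
      grown-⊆ (add {Y = Y} {z} g z∈X _ _ _ _ _) x∈ with x∈p∪q⁻ B (Y ∪ ⁅ z ⁆) x∈
      ... | inj₁ x∈B = B⊆X x∈B
      ... | inj₂ x∈Yz with x∈p∪q⁻ Y ⁅ z ⁆ x∈Yz
      ...   | inj₁ x∈Y = grown-⊆ g (x∈p∪q⁺ (inj₂ x∈Y))
      ...   | inj₂ x∈z rewrite x∈⁅y⁆⇒x≡y z x∈z = z∈X

      -- Every added vertex is new and outside of `B`. So a growth inside a solution `X` takes at
      -- most `∣ X ∣ - ∣ B ∣` rounds, which the budget allows.
      grown-size : ∀ {i Y} → Grown i Y → i + ∣ B ∣ ≤ ∣ B ∪ Y ∣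
      grown-size none = Subsetₚ.∣p∣≤∣p∪q∣ B Subset.⊥
      grown-size (add {Y = Y} {z} g _ z∉B z∉Y _ _ _) = ≤-trans (s≤s (grown-size g))
        (Subsetₚ.p⊂q⇒∣p∣<∣q∣ (∪-mono Y z , z , new∈ Y z , λ z∈ → [ z∉B , z∉Y ]′ (x∈p∪q⁻ B Y z∈)))

      Exhaustive : Tree → ℕ → Set
      Exhaustive t j = ∀ {i Y} → Grown i Y → i ≤ j → ∀ Q → (∀ {q} → q ∈ S′ → q ∈ Q → Path (B ∪ Y) r q) → Holds t Q

      start-complete : Exhaustive (tableOf S′ start) 0
      start-complete none _ Q paths = from (holds-tableOf {Q = Q} (start-reflects (S′ ∩ Q))) λ y y∈ →
        Path-mono (λ x∈ → [ (λ x∈B → x∈B) , (λ x∈⊥ → contradiction x∈⊥ Subsetₚ.∉⊥) ]′ (x∈p∪q⁻ B Subset.⊥ x∈))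
                  (paths (proj₁ (x∈p∩q⁻ S′ Q y∈)) (proj₂ (x∈p∩q⁻ S′ Q y∈)))

      -- Follow the path and remember how the current vertex is reached. Entering `z` switches to
      -- paths from `z` inside `B`; entering `Y` switches back, because all of `Y` is reached from
      -- `r` without `z`. Hence whatever cannot be reached without `z` lies in `reach B z`.
      separate : ∀ {i Y z} → Grown i Y → ∀ {u q} → Path (B ∪ Y) r u ⊎ Path B z u →
                 Path (B ∪ (Y ∪ ⁅ z ⁆)) u q → Path (B ∪ Y) r q ⊎ Path B z q
      separate g p ε = p
      separate {Y = Y} {z} g p ((e , x∈) ◅ rest) = separate g (advance (x∈p∪q⁻ B (Y ∪ ⁅ z ⁆) x∈)) rest
        where
        advance : _ ∈ B ⊎ _ ∈ Y ∪ ⁅ z ⁆ → Path (B ∪ Y) r _ ⊎ Path B z _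
        advance (inj₁ x∈B) = [ (λ p → inj₁ (p ◅◅ (e , p⊆p∪q Y x∈B) ◅ ε)) , (λ p → inj₂ (p ◅◅ (e , x∈B) ◅ ε)) ]′ p
        advance (inj₂ x∈Yz) with x∈p∪q⁻ Y ⁅ z ⁆ x∈Yz
        ... | inj₁ x∈Y = inj₁ (grown-reached g x∈Y)
        ... | inj₂ x∈z rewrite x∈⁅y⁆⇒x≡y z x∈z = inj₂ ε

      -- The last vertex `z` of the growth is the one to try. By `separate`, the part `Q′` of the
      -- query outside of `reach B z` was reached before; if `touch` yields `w ∈ S′`, this `w` was
      -- reached before as well, since `z` was attached to it.
      next-complete : ∀ {t j} → Exhaustive t j → Exhaustive (tableOf S′ (next t)) (suc j)
      next-complete {t} comp none _ Q paths =
        from (holds-tableOf {Q = Q} (next-reflects t (S′ ∩ Q)))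
          (inj₁ (comp none z≤n (S′ ∩ Q) λ q∈S′ q∈ → paths q∈S′ (proj₂ (x∈p∩q⁻ S′ Q q∈))))
      next-complete {t} comp (add {Y = Y} {z} {w} g z∈X z∉B z∉Y w∈X r→w e) (s≤s i≤j) Q paths =
        from (holds-tableOf {Q = Q} (next-reflects t (S′ ∩ Q))) (inj₂ (z , step (touch z∈X z∉B w∈X e)))
        where
        M Q′ : Subset n
        M  = reach B z
        Q′ = without (S′ ∩ Q) M
        paths′ : ∀ {q} → q ∈ S′ → q ∈ Q′ → Path (B ∪ Y) r q
        paths′ {q} q∈S′ q∈Q′ with ∈-tabulate⁻ (without-reflects (S′ ∩ Q) M q) q∈Q′
        ... | q∈ , q∉M with separate g (inj₁ ε) (paths q∈S′ (proj₂ (x∈p∩q⁻ S′ Q q∈)))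
        ...   | inj₁ r→q = r→q
        ...   | inj₂ z→q = contradiction (to (∈-reflects M q) (from (reach-reflects B z q) z→q)) q∉M
        step : (w ∈ S′ × w ∈ B) ⊎ Path B z r → Step t (S′ ∩ Q) z
        step (inj₂ z→r)            = inj₁ (z→r , comp g i≤j Q′ paths′)
        step (inj₁ (w∈S′ , w∈B))   = inj₂ (w , (w∈S′ , (Adj-sym e , w∈B) ◅ ε) , comp g i≤j (insert Q′ w) paths″)
          where
          paths″ : ∀ {q} → q ∈ S′ → q ∈ insert Q′ w → Path (B ∪ Y) r q
          paths″ {q} q∈S′ q∈ with ∈-tabulate⁻ (insert-reflects Q′ w q) q∈
          ... | inj₁ q∈Q′ = paths′ q∈S′ q∈Q′
          ... | inj₂ refl = r→w

      module _ (X-connected : ∀ {x y} → x ∈ X → y ∈ X → Path X x y) where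

        -- Growth continues while a reached vertex has a neighbour in `X` outside of `B ∪ Y`. Once
        -- stuck, a path of `X` starting at `r` can never leave `B ∪ Y`, so all of `X` is reached.
        -- By `grown-size`, `∣ X ∣` is enough fuel.
        exhaust : ∀ fuel {i Y} → Grown i Y → ∣ X ∣ ≤ fuel + i →
                  ∃[ i ] ∃[ Y ] Grown i Y × (∀ {x} → x ∈ X → Path (B ∪ Y) r x)
        exhaust fuel {i} {Y} g enough with reflects-dec (any-reflects λ z → any-reflects λ w →
            ∈-reflects X z ×-reflects ¬-reflects (∈-reflects B z) ×-reflects ¬-reflects (∈-reflects Y z) ×-reflects
            ∈-reflects X w ×-reflects reach-reflects (B ∪ Y) r w ×-reflects T-reflects (adj w z))
        ... | no stuck = i , Y , g , λ x∈X → follow (B⊆X r∈B) ε (X-connected (B⊆X r∈B) x∈X)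
          where
          follow : ∀ {u x} → u ∈ X → Path (B ∪ Y) r u → Path X u x → Path (B ∪ Y) r x
          follow u∈X p ε = p
          follow {u} u∈X p (_◅_ {j = v} (e , v∈X) rest) with reflects-dec (∈-reflects (B ∪ Y) v)
          ... | yes v∈ = follow v∈X (p ◅◅ (e , v∈) ◅ ε) rest
          ... | no v∉  = contradiction (v , u , v∈X , (λ v∈B → v∉ (x∈p∪q⁺ (inj₁ v∈B))) ,
                           (λ v∈Y → v∉ (x∈p∪q⁺ (inj₂ v∈Y))) , u∈X , p , e) stuck
        exhaust zero {i} {Y} g enough | yes (z , w , z∈X , z∉B , z∉Y , w∈X , p , e) =
          contradiction (≤-trans (≤-trans (s≤s (m≤m+n i ∣ B ∣)) (grown-size g⁺))
                          (≤-trans (p⊆q⇒∣p∣≤∣q∣ (grown-⊆ g⁺)) enough)) (ℕₚ.<-irrefl refl)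
          where
          g⁺ : Grown (suc i) (Y ∪ ⁅ z ⁆)
          g⁺ = add g z∈X z∉B z∉Y w∈X p e
        exhaust (suc fuel) {i} g enough | yes (z , w , z∈X , z∉B , z∉Y , w∈X , p , e) =
          exhaust fuel (add g z∈X z∉B z∉Y w∈X p e) (≤-trans enough (≤-reflexive (sym (+-suc fuel i))))

        -- The growth has `i` steps with `i ≤ ∣ X ∣ - ∣ B ∣ ≤ e` and `i ≤ n`, so the table covers it
        -- whether the rounds ended by budget or by `n`.
        rounds-complete : ∀ e → ∣ X ∣ ≤ e + ∣ B ∣ → S′ ⊆ X → Holds (proj₁ (rounds e (allFin n))) S′
        rounds-complete e X≤ S′⊆X with exhaust ∣ X ∣ none (m≤m+n ∣ X ∣ 0)
                                     | rounds-invariant Exhaustive start-complete next-complete e (allFin n)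
        ... | i , Y , g , paths | j , j+f , done , comp = comp g (i≤j done) S′ (λ q∈S′ _ → paths (S′⊆X q∈S′))
          where
          i+B≤X : i + ∣ B ∣ ≤ ∣ X ∣
          i+B≤X = ≤-trans (grown-size g) (p⊆q⇒∣p∣≤∣q∣ (grown-⊆ g))
          i≤j : proj₂ (rounds e (allFin n)) ≡ 0 ⊎ n ≤ j → i ≤ j
          i≤j (inj₁ f≡0) = ≤-trans (ℕₚ.+-cancelʳ-≤ ∣ B ∣ i e (≤-trans i+B≤X X≤))
            (≤-reflexive (trans (sym j+f) (trans (cong (j +_) f≡0) (+-identityʳ j))))
          i≤j (inj₂ n≤j) = ≤-trans (≤-trans (m≤m+n i ∣ B ∣) (≤-trans i+B≤X (Subsetₚ.∣p∣≤n X))) n≤j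

  -- The table speaks about `S′` only; this check ties the rest of `B` to `S′` or to `r`.
  anchored : Subset n → Subset n → Fin n → Bool
  anchored B S′ r = allFin? λ y → not (lookup B y) ∨
    anyFin (λ s → (lookup S′ s ∨ does (r ≟ s)) ∧ lookup (reach B y) s)

  final : Subset n → Subset n → Fin n → Tree
  final B S′ r = proj₁ (Rounds.rounds B S′ r (ℕ.pred (remaining (suc ℓ) B)) (allFin n))

  leaf₁ : Subset n → Subset n → Bool
  leaf₁ κ S′ = anySmall λ D → (covers (base κ S′ D) ∧ fits ℓ (base κ S′ D)) ∧
    anyFin (λ r → (lookup (base κ S′ D) r ∧ anchored (base κ S′ D) S′ r) ∧
                  find (final (base κ S′ D) S′ r) S′ S′)

  -- The first disjunct handles the solutions without a root: meeting neither `S` nor the clique,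
  -- they are connected and independent and so have at most one vertex.
  solve₁ : Subset n → Bool
  solve₁ κ = anySmall covers ∨ branch _∨_ (leaf₁ κ) S (λ S′ → S′)

  Anchored : Subset n → Subset n → Fin n → Set
  Anchored B S′ r = ∀ y → y ∈ B → ∃[ s ] (s ∈ S′ ⊎ r ≡ s) × Path B y s

  Leaf : Subset n → Subset n → Set
  Leaf κ S′ = ∃[ D ] Small D × (VertexCover G (base κ S′ D) × ∣ base κ S′ D ∣ ≤ ℓ) ×
    ∃[ r ] (r ∈ base κ S′ D × Anchored (base κ S′ D) S′ r) × T (find (final (base κ S′ D) S′ r) S′ S′)

  leaf₁-reflects : ∀ κ S′ → Reflects (Leaf κ S′) (leaf₁ κ S′)
  leaf₁-reflects κ S′ = anySmall-reflects λ D →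
    (covers-reflects (base κ S′ D) ×-reflects fits-reflects ℓ (base κ S′ D)) ×-reflects
    any-reflects λ r → (∈-reflects (base κ S′ D) r ×-reflects anchored-reflects (base κ S′ D) r) ×-reflects T-reflects _
    where
    anchored-reflects : ∀ B r → Reflects (Anchored B S′ r) (anchored B S′ r)
    anchored-reflects B r = all-reflects λ y → ∈-reflects B y →-reflects any-reflects λ s →
      (∈-reflects S′ s ⊎-reflects ≟-reflects r s) ×-reflects reach-reflects B y s

  budget : ∀ (B : Subset n) → ℕ.pred (remaining (suc ℓ) B) ≡ ℓ ℕ.∸ ∣ B ∣
  budget B = trans (cong ℕ.pred (remaining-∸ (suc ℓ) B)) (ℕₚ.pred[m∸n]≡m∸[1+n] (suc ℓ) ∣ B ∣)

  ∣p∪q∣≤∣p∣+∣q∣ : ∀ {k} (p q : Subset k) → ∣ p ∪ q ∣ ≤ ∣ p ∣ + ∣ q ∣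
  ∣p∪q∣≤∣p∣+∣q∣ [] []                   = z≤n
  ∣p∪q∣≤∣p∣+∣q∣ (false ∷ p) (false ∷ q) = ∣p∪q∣≤∣p∣+∣q∣ p q
  ∣p∪q∣≤∣p∣+∣q∣ (false ∷ p) (true ∷ q)  = ≤-trans (s≤s (∣p∪q∣≤∣p∣+∣q∣ p q)) (≤-reflexive (sym (+-suc ∣ p ∣ ∣ q ∣)))
  ∣p∪q∣≤∣p∣+∣q∣ (true ∷ p)  (false ∷ q) = s≤s (∣p∪q∣≤∣p∣+∣q∣ p q)
  ∣p∪q∣≤∣p∣+∣q∣ (true ∷ p)  (true ∷ q)  = s≤s (≤-trans (∣p∪q∣≤∣p∣+∣q∣ p q) (+-monoʳ-≤ ∣ p ∣ (n≤1+n ∣ q ∣)))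

  -- The solution is `B ∪ Z` for the set `Z` that the table promises for the query `S′`. The table
  -- connects `S′` and `Z` to `r`, and anchoring connects `B`.
  leaf-sound : ∀ κ S′ → Leaf κ S′ → Solution ℓ
  leaf-sound κ S′ (D , _ , (B-covers , B≤ℓ) , r , (r∈B , anch) , holds)
    with Rounds.rounds-invariant B S′ r (Rounds.Sound B S′ r) (Rounds.start-sound B S′ r r∈B) (Rounds.next-sound B S′ r r∈B)
           (ℕ.pred (remaining (suc ℓ) B)) (allFin n)
    where
    B : Subset n
    B = base κ S′ D
  ... | j , j+f , _ , sound with sound S′ holds
  ...   | Z , Z≤j , S′-paths , Z-paths = X , (X-covers , Path⇒connected X λ x∈X y∈X → Path-reverse r∈X (r→ x∈X) ◅◅ r→ y∈X) , X≤ℓ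
    where
    B X : Subset n
    B = base κ S′ D
    X = B ∪ Z
    B⊆X : B ⊆ X
    B⊆X = p⊆p∪q Z
    r∈X : r ∈ X
    r∈X = B⊆X r∈B
    X-covers : VertexCover G X
    X-covers x y e = [ (λ x∈ → inj₁ (B⊆X x∈)) , (λ y∈ → inj₂ (B⊆X y∈)) ]′ (B-covers x y e)
    r→ : ∀ {x} → x ∈ X → Path X r x
    r→ {x} x∈X with x∈p∪q⁻ B Z x∈X
    ... | inj₂ x∈Z = Z-paths x∈Z
    ... | inj₁ x∈B with anch x x∈B
    ...   | s , inj₁ s∈S′ , p = S′-paths s∈S′ s∈S′ ◅◅ Path-reverse x∈X (Path-mono B⊆X p)
    ...   | .r , inj₂ refl , p = Path-reverse x∈X (Path-mono B⊆X p)
    X≤ℓ : ∣ X ∣ ≤ ℓ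
    X≤ℓ = begin
      ∣ X ∣                   ≤⟨ ∣p∪q∣≤∣p∣+∣q∣ B Z ⟩
      ∣ B ∣ + ∣ Z ∣           ≤⟨ +-monoʳ-≤ ∣ B ∣ (≤-trans Z≤j (ℕₚ.m+n≤o⇒m≤o j (≤-reflexive (trans j+f (budget B))))) ⟩
      ∣ B ∣ + (ℓ ℕ.∸ ∣ B ∣)   ≡⟨ ℕₚ.m+[n∸m]≡n B≤ℓ ⟩
      ℓ                       ∎
      where open ℕₚ.≤-Reasoning

  small-size : ∀ {D : Subset n} → Small D → ∣ D ∣ ≤ 1
  small-size {D} small with reflects-dec (any-reflects (∈-reflects D))
  ... | yes (v , v∈D) = ≤-trans (p⊆q⇒∣p∣≤∣q∣ (λ x∈D → subst (_∈ ⁅ v ⁆) (small v∈D x∈D) (x∈⁅x⁆ v)))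
                          (≤-reflexive (Subsetₚ.∣⁅x⁆∣≡1 v))
  ... | no ∄          = ≤-trans (p⊆q⇒∣p∣≤∣q∣ {q = Subset.⊥} (λ x∈D → contradiction (_ , x∈D) ∄))
                          (≤-trans (≤-reflexive (Subsetₚ.∣⊥∣≡0 n)) z≤n)

  module _ (ℓ>0 : 1 ≤ ℓ) {κ : Subset n} (split : SplitPartition full κ) where

    solve₁-sound : (∃[ X ] Small X × VertexCover G X) ⊎ (∃[ q ] Leaf κ (S ∩ q)) → Solution ℓ
    solve₁-sound (inj₂ (q , leaf))       = leaf-sound κ (S ∩ q) leaf
    -- A set of at most one vertex is connected, and it fits because `ℓ` is positive.
    solve₁-sound (inj₁ (X , small , cov)) = X , (cov , Path⇒connected X λ {x} x∈X y∈X → subst (Path X x) (small x∈X y∈X) ε) ,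
                                            ≤-trans (small-size small) ℓ>0

    module _ {X} (X-covers : VertexCover G X) (conn : Connected (induced G X)) (X≤ℓ : ∣ X ∣ ≤ ℓ) where
      open Traces split X-covers

      paths : ∀ {x y} → x ∈ X → y ∈ X → Path X x y
      paths = connected⇒Path X conn

      Root : Fin n → Set
      Root r = r ∈ X × (r ∈ S ⊎ (r ∉ S × r ∈ κ)) × (∀ {c} → c ∉ S → c ∈ κ → c ∈ X → c ≡ r ⊎ Adj G c r)

      -- A clique vertex is preferred, since it sees the rest of the clique. A vertex of `S` is
      -- taken only if `X` has no clique vertex outside of `S`; then the last condition of `Root` is
      -- vacuous.
      root : (∃[ r ] Root r) ⊎ Small X
      root with reflects-dec (any-reflects λ c → ¬-reflects (∈-reflects S c) ×-reflects ∈-reflects κ c ×-reflects ∈-reflects X c)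
      ... | yes (r , r∉S , r∈κ , r∈X) = inj₁ (r , r∈X , inj₂ (r∉S , r∈κ) ,
              λ {c} c∉S c∈κ c∈X → proj₁ (split c r ((∈-full , c∉S) , (∈-full , r∉S))) (c∈κ , r∈κ))
      ... | no ∄c with reflects-dec (any-reflects λ s → ∈-reflects S s ×-reflects ∈-reflects X s)
      ...   | yes (s , s∈S , s∈X) = inj₁ (s , s∈X , inj₁ s∈S , λ c∉S c∈κ c∈X → contradiction (_ , c∉S , c∈κ , c∈X) ∄c)
      ...   | no ∄s = inj₂ λ x∈X y∈X → alone x∈X (paths x∈X y∈X)
        where
        lonely : ∀ {x} → x ∈ X → Independent x
        lonely {x} x∈X with kind x
        ... | inj₁ i                  = i
        ... | inj₂ (inj₁ x∈S)         = contradiction (_ , x∈S , x∈X) ∄s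
        ... | inj₂ (inj₂ (x∉S , x∈κ)) = contradiction (_ , x∉S , x∈κ , x∈X) ∄c
        alone : ∀ {x y} → x ∈ X → Path X x y → x ≡ y
        alone x∈X ε               = refl
        alone x∈X ((e , v∈X) ◅ _) = contradiction e (independent (lonely x∈X) (lonely v∈X))

      module _ {r} (is-root : Root r) where
        private
          r∈X : r ∈ X
          r∈X = proj₁ is-root

        r-kind : r ∈ S ⊎ (r ∉ S × r ∈ κ)
        r-kind = proj₁ (proj₂ is-root)

        near : ∀ {c} → c ∉ S → c ∈ κ → c ∈ X → c ≡ r ⊎ Adj G c r
        near = proj₂ (proj₂ is-root)

        r∈B : r ∈ B
        r∈B = [ (λ r∈S → S∩X⊆B r∈S r∈X) , (λ (r∉S , r∈κ) → κ∩X⊆B r∉S r∈κ r∈X) ]′ r-kind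

        r-dependent : ¬ Independent r
        r-dependent (r∉S , r∉κ) = [ r∉S , (λ (_ , r∈κ) → r∉κ r∈κ) ]′ r-kind

        -- Supplies `touch`: a neighbour `w` in the clique lies in `B` and gives the path from `z`
        -- over `w` to `r`, so only neighbours in `S′` have to be remembered.
        step-from : ∀ {z w} → Independent z → Adj G z w → w ∈ X → (w ∈ S′ × w ∈ B) ⊎ Path B z r
        step-from {z} {w} i e w∈X with kind w
        ... | inj₁ j          = contradiction e (independent i j)
        ... | inj₂ (inj₁ w∈S) = inj₁ (x∈p∩q⁺ (w∈S , w∈X) , S∩X⊆B w∈S w∈X)
        ... | inj₂ (inj₂ (w∉S , w∈κ)) with near w∉S w∈κ w∈X
        ...   | inj₁ refl = inj₂ ((e , r∈B) ◅ ε)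
        ...   | inj₂ e′   = inj₂ ((e , κ∩X⊆B w∉S w∈κ w∈X) ◅ (e′ , r∈B) ◅ ε)

        anchor : Anchored B S′ r
        anchor y y∈B with kind y
        ... | inj₂ (inj₁ y∈S) = y , inj₁ (x∈p∩q⁺ (y∈S , B⊆X y∈B)) , ε
        ... | inj₂ (inj₂ (y∉S , y∈κ)) with near y∉S y∈κ (B⊆X y∈B)
        ...   | inj₁ refl = y , inj₂ refl , ε
        ...   | inj₂ e    = r , inj₂ refl , (e , r∈B) ◅ ε
        -- An independent `y` differs from `r`, so connectedness of `X` gives it a neighbour in `X`,
        -- to which `step-from` applies.
        anchor y y∈B | inj₁ i with paths (B⊆X y∈B) r∈X
        ... | ε             = contradiction i r-dependent
        ... | _◅_ {j = w} (e , w∈X) _ with step-from i e w∈X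
        ...   | inj₁ (w∈S′ , w∈B) = w , inj₁ w∈S′ , (e , w∈B) ◅ ε
        ...   | inj₂ p            = r , inj₂ refl , p

        leaf : Leaf κ (S ∩ X)
        leaf = D , D-small , (B-covers , ≤-trans (p⊆q⇒∣p∣≤∣q∣ B⊆X) X≤ℓ) , r , (r∈B , anchor) ,
          Rounds.Growth.rounds-complete B S′ r X B⊆X r∈B
            (λ z∈X z∉B w∈X e → step-from (X∖B-independent z∈X z∉B) (Adj-sym e) w∈X)
            paths (ℕ.pred (remaining (suc ℓ) B)) enough (λ x∈S′ → proj₂ (x∈p∩q⁻ S X x∈S′))
          where
          enough : ∣ X ∣ ≤ ℕ.pred (remaining (suc ℓ) B) + ∣ B ∣
          enough = ≤-trans X≤ℓ (≤-trans (ℕₚ.m≤n+m∸n ℓ ∣ B ∣)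
            (≤-reflexive (trans (ℕₚ.+-comm ∣ B ∣ _) (cong (_+ ∣ B ∣) (sym (budget B))))))

    solve₁-reflects : Reflects (Solution ℓ) (solve₁ κ)
    solve₁-reflects = reflects-map solve₁-sound complete
      (anySmall-reflects covers-reflects ⊎-reflects branch-reflects (leaf₁-reflects κ) S (λ S′ → S′))
      where
      complete : Solution ℓ → (∃[ X ] Small X × VertexCover G X) ⊎ (∃[ q ] Leaf κ (S ∩ q))
      complete (X , (cov , conn) , X≤ℓ) with root cov conn X≤ℓ
      ... | inj₁ (r , is-root) = inj₂ (X , leaf cov conn X≤ℓ is-root)
      ... | inj₂ small         = inj₁ (X , small , cov)

-- Computing a split partition

-- The counterpart of `anySmall` for searches that return a value: each small set may replace the
-- current candidate.
smallFold : ∀ {n} {A : Set} → (Subset n → A → A) → A → A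
smallFold c a = Vec.foldr′ (λ v acc → c (singleton v) acc) (c empty a) (allFin _)

smallFold-hits : ∀ {n} {A : Set} (P : A → Set) (c : Subset n → A → A) →
                 (∀ D {a} → P a → P (c D a)) → ∀ {D} → Small D → (∀ a → P (c D a)) →
                 ∀ a → P (smallFold c a)
smallFold-hits {n} P c keeps {D} small hits a with small-cases small
... | inj₁ refl = go (allFin n)
  where
  go : ∀ {k} (vs : Vec (Fin n) k) → P (Vec.foldr′ (λ v acc → c (singleton v) acc) (c empty a) vs)
  go []       = hits a
  go (v ∷ vs) = keeps (singleton v) (go vs)
... | inj₂ (v , refl) = go (λ x → x) (v , refl)
  where
  go : ∀ {k} (g : Fin k → Fin n) → ∃[ j ] g j ≡ v →
       P (Vec.foldr′ (λ v acc → c (singleton v) acc) (c empty a) (Vec.tabulate g))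
  go g (zero , refl)   = hits _
  go g (suc j , gj≡v)  = keeps (singleton (g zero)) (go (g ∘ suc) (j , gj≡v))

smallFold-keeps : ∀ {n} {A : Set} (P : A → Set) (c : Subset n → A → A) →
                  (∀ D {a} → P a → P (c D a)) → ∀ {a} → P a → P (smallFold c a)
smallFold-keeps {n} P c keeps {a} p = go (allFin n)
  where
  go : ∀ {k} (vs : Vec (Fin n) k) → P (Vec.foldr′ (λ v acc → c (singleton v) acc) (c empty a) vs)
  go []       = keeps empty p
  go (v ∷ vs) = keeps (singleton v) (go vs)

module Partition {n} (G : Graph (Fin n)) (S : Subset n) where
  open Graph G using (adj)
  open Solutions G S

  valid : Subset n → Subset n → Bool
  valid U κ = allFin? λ x → allFin? λ y →
    not ((lookup U x ∧ not (lookup S x)) ∧ (lookup U y ∧ not (lookup S y))) ∨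
    ((not (lookup κ x ∧ lookup κ y) ∨ (does (x ≟ y) ∨ adj x y)) ∧
     ((lookup κ x ∨ lookup κ y) ∨ not (adj x y)))

  valid-reflects : ∀ U κ → Reflects (SplitPartition U κ) (valid U κ)
  valid-reflects U κ = all-reflects λ x → all-reflects λ y →
    (outside x ×-reflects outside y) →-reflects
    ((∈-reflects κ x ×-reflects ∈-reflects κ y) →-reflects (≟-reflects x y ⊎-reflects T-reflects (adj x y))) ×-reflects
    ((∈-reflects κ x ⊎-reflects ∈-reflects κ y) ⊎-reflects ¬-reflects (T-reflects (adj x y)))
    where
    outside : ∀ x → Reflects (x ∈ U × x ∉ S) (lookup U x ∧ not (lookup S x))
    outside x = ∈-reflects U x ×-reflects ¬-reflects (∈-reflects S x)

  candidate : Subset n → Fin n → Subset n → Subset n → Bool → Subset n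
  candidate κ v D₁ D₂ b = Vec.tabulate λ y →
    if does (v ≟ y) then b else ((lookup κ y ∧ not (lookup D₁ y)) ∨ lookup D₂ y)

  pick : Subset n → Subset n → Subset n → Subset n → Subset n
  pick U κ₁ κ₂ κ = if valid U κ₁ then κ₁ else (if valid U κ₂ then κ₂ else κ)

  adjoin : Subset n → Fin n → Subset n
  adjoin U v = Vec.tabulate λ y → lookup U y ∨ does (v ≟ y)

  -- Two split partitions differ in at most one vertex on each side, so a
  -- partition of the vertices in U extends to the vertex v after moving at
  -- most one vertex out of the clique and at most one into it.
  extendPartition : Fin n → Subset n × Subset n → Subset n × Subset n
  extendPartition v (U , κ) = adjoin U v ,
    smallFold (λ D₁ κ₁ → smallFold (λ D₂ κ₂ →
      pick (adjoin U v) (candidate κ v D₁ D₂ false) (candidate κ v D₁ D₂ true) κ₂) κ₁) κ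

  partitions : ∀ {k} → Vec (Fin n) k → Subset n × Subset n
  partitions = Vec.foldr′ extendPartition (empty , empty)

  partition : Subset n
  partition = proj₂ (partitions (allFin n))

  SplitPartition-cong : ∀ {U κ κ′} → (∀ {y} → y ∈ U → y ∉ S → (y ∈ κ → y ∈ κ′) × (y ∈ κ′ → y ∈ κ)) →
                        SplitPartition U κ → SplitPartition U κ′
  SplitPartition-cong eq split x y outside@((x∈U , x∉S) , (y∈U , y∉S)) with split x y outside
  ... | clique , indep =
    (λ (x∈ , y∈) → clique (proj₂ (eq x∈U x∉S) x∈ , proj₂ (eq y∈U y∉S) y∈)) ,
    [ (λ where (inj₁ x∈) → inj₁ (inj₁ (proj₁ (eq x∈U x∉S) x∈))
               (inj₂ y∈) → inj₁ (inj₂ (proj₁ (eq y∈U y∉S) y∈))) , inj₂ ]′ indep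

  pick-keeps : ∀ U κ₁ κ₂ {κ} → SplitPartition U κ → SplitPartition U (pick U κ₁ κ₂ κ)
  pick-keeps U κ₁ κ₂ split with valid U κ₁ | valid-reflects U κ₁ | valid U κ₂ | valid-reflects U κ₂
  ... | true  | ofʸ ok | _     | _      = ok
  ... | false | _      | true  | ofʸ ok = ok
  ... | false | _      | false | _      = split

  pick-finds : ∀ U κ₁ κ₂ κ → SplitPartition U κ₁ ⊎ SplitPartition U κ₂ → SplitPartition U (pick U κ₁ κ₂ κ)
  pick-finds U κ₁ κ₂ κ found with valid U κ₁ | valid-reflects U κ₁ | valid U κ₂ | valid-reflects U κ₂
  ... | true  | ofʸ ok | _     | _      = ok
  ... | false | _      | true  | ofʸ ok = ok
  ... | false | ofⁿ no₁ | false | ofⁿ no₂ = contradiction found [ no₁ , no₂ ]′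

  adjoin⁻ : ∀ U v {y} → y ∈ adjoin U v → y ∈ U ⊎ v ≡ y
  adjoin⁻ U v {y} = ∈-tabulate⁻ (∈-reflects U y ⊎-reflects ≟-reflects v y)

  adjoin⁺ : ∀ U v {y} → y ∈ U ⊎ v ≡ y → y ∈ adjoin U v
  adjoin⁺ U v {y} = ∈-tabulate⁺ (∈-reflects U y ⊎-reflects ≟-reflects v y)

  module _ {κ* : Subset n} (split* : SplitPartition full κ*) where

    module _ (v : Fin n) {U κ : Subset n} (split : SplitPartition U κ) where
      private
        differ : (Fin n → Bool) → Subset n
        differ f = Vec.tabulate λ y → (lookup U y ∧ not (lookup S y)) ∧ f y

        D₁ D₂ : Subset n
        D₁ = differ λ y → lookup κ y ∧ not (lookup κ* y)
        D₂ = differ λ y → not (lookup κ y) ∧ lookup κ* y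

        D₁-reflects : ∀ y → Reflects ((y ∈ U × y ∉ S) × y ∈ κ × y ∉ κ*)
                      ((lookup U y ∧ not (lookup S y)) ∧ (lookup κ y ∧ not (lookup κ* y)))
        D₁-reflects y = (∈-reflects U y ×-reflects ¬-reflects (∈-reflects S y)) ×-reflects
                        ∈-reflects κ y ×-reflects ¬-reflects (∈-reflects κ* y)

        D₂-reflects : ∀ y → Reflects ((y ∈ U × y ∉ S) × y ∉ κ × y ∈ κ*)
                      ((lookup U y ∧ not (lookup S y)) ∧ (not (lookup κ y) ∧ lookup κ* y))
        D₂-reflects y = (∈-reflects U y ×-reflects ¬-reflects (∈-reflects S y)) ×-reflects
                        ¬-reflects (∈-reflects κ y) ×-reflects ∈-reflects κ* y

        -- Two distinct vertices on the clique side of one partition and on the independent side of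
        -- the other would be both adjacent and not adjacent. So both differences are small.
        clash : ∀ {U₁ U₂ κ₁ κ₂} → SplitPartition U₁ κ₁ → SplitPartition U₂ κ₂ → ∀ {x y} →
                (x ∈ U₁ × x ∉ S) × (y ∈ U₁ × y ∉ S) → x ∈ U₂ → y ∈ U₂ →
                x ∈ κ₁ → y ∈ κ₁ → x ∉ κ₂ → y ∉ κ₂ → x ≡ y
        clash s₁ s₂ {x} {y} o@((_ , x∉S) , (_ , y∉S)) x∈U₂ y∈U₂ x∈ y∈ x∉ y∉ with proj₁ (s₁ x y o) (x∈ , y∈)
        ... | inj₁ x≡y = x≡y
        ... | inj₂ e with proj₂ (s₂ x y ((x∈U₂ , x∉S) , (y∈U₂ , y∉S)))
        ...   | inj₁ (inj₁ x∈₂) = contradiction x∈₂ x∉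
        ...   | inj₁ (inj₂ y∈₂) = contradiction y∈₂ y∉
        ...   | inj₂ ¬e         = contradiction e ¬e

        D₁-small : Small D₁
        D₁-small {x} {y} x∈ y∈ with ∈-tabulate⁻ (D₁-reflects x) x∈ | ∈-tabulate⁻ (D₁-reflects y) y∈
        ... | o , x∈κ , x∉ | o′ , y∈κ , y∉ = clash split split* (o , o′) ∈-full ∈-full x∈κ y∈κ x∉ y∉

        D₂-small : Small D₂
        D₂-small {x} {y} x∈ y∈ with ∈-tabulate⁻ (D₂-reflects x) x∈ | ∈-tabulate⁻ (D₂-reflects y) y∈
        ... | o , x∉κ , x∈ | o′ , y∉κ , y∈ =
          clash split* split ((∈-full , proj₂ o) , (∈-full , proj₂ o′)) (proj₁ o) (proj₁ o′) x∈ y∈ x∉κ y∉κ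

        -- Moving `D₁` out and `D₂` in turns `κ` into `κ*` on `U` outside of `S`, and `v` is placed
        -- as in `κ*`.
        candidate-split : SplitPartition (adjoin U v) (candidate κ v D₁ D₂ (lookup κ* v))
        candidate-split = SplitPartition-cong agrees λ x y ((_ , x∉S) , (_ , y∉S)) → split* x y ((∈-full , x∉S) , (∈-full , y∉S))
          where
          cand-reflects : ∀ y → Reflects ((v ≡ y × v ∈ κ*) ⊎ (¬ v ≡ y × ((y ∈ κ × y ∉ D₁) ⊎ y ∈ D₂)))
                          (if does (v ≟ y) then lookup κ* v else ((lookup κ y ∧ not (lookup D₁ y)) ∨ lookup D₂ y))
          cand-reflects y = if-reflects (≟-reflects v y) (∈-reflects κ* v)
            ((∈-reflects κ y ×-reflects ¬-reflects (∈-reflects D₁ y)) ⊎-reflects ∈-reflects D₂ y)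
          agrees : ∀ {y} → y ∈ adjoin U v → y ∉ S → (y ∈ κ* → y ∈ candidate κ v D₁ D₂ (lookup κ* v)) ×
                   (y ∈ candidate κ v D₁ D₂ (lookup κ* v) → y ∈ κ*)
          agrees {y} y∈U⁺ y∉S = (λ y∈κ* → ∈-tabulate⁺ (cand-reflects y) (into y∈κ*)) , (λ y∈ → out (∈-tabulate⁻ (cand-reflects y) y∈))
            where
            y∈U : ¬ v ≡ y → y ∈ U
            y∈U v≢y = [ (λ y∈U → y∈U) , (λ v≡y → contradiction v≡y v≢y) ]′ (adjoin⁻ U v y∈U⁺)
            into : y ∈ κ* → (v ≡ y × v ∈ κ*) ⊎ (¬ v ≡ y × ((y ∈ κ × y ∉ D₁) ⊎ y ∈ D₂))
            into y∈κ* with v ≟ y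
            ... | yes refl = inj₁ (refl , y∈κ*)
            ... | no v≢y with reflects-dec (∈-reflects κ y)
            ...   | yes y∈κ = inj₂ (v≢y , inj₁ (y∈κ , λ y∈D₁ → proj₂ (proj₂ (∈-tabulate⁻ (D₁-reflects y) y∈D₁)) y∈κ*))
            ...   | no y∉κ  = inj₂ (v≢y , inj₂ (∈-tabulate⁺ (D₂-reflects y) ((y∈U v≢y , y∉S) , y∉κ , y∈κ*)))
            out : (v ≡ y × v ∈ κ*) ⊎ (¬ v ≡ y × ((y ∈ κ × y ∉ D₁) ⊎ y ∈ D₂)) → y ∈ κ*
            out (inj₁ (refl , y∈κ*))        = y∈κ*
            out (inj₂ (v≢y , inj₂ y∈D₂))    = proj₂ (proj₂ (∈-tabulate⁻ (D₂-reflects y) y∈D₂))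
            out (inj₂ (v≢y , inj₁ (y∈κ , y∉D₁))) with reflects-dec (∈-reflects κ* y)
            ... | yes y∈κ* = y∈κ*
            ... | no y∉κ*  = contradiction (∈-tabulate⁺ (D₁-reflects y) ((y∈U v≢y , y∉S) , y∈κ , y∉κ*)) y∉D₁

        one-valid : ∀ b → SplitPartition (adjoin U v) (candidate κ v D₁ D₂ b) →
                    SplitPartition (adjoin U v) (candidate κ v D₁ D₂ false) ⊎
                    SplitPartition (adjoin U v) (candidate κ v D₁ D₂ true)
        one-valid false = inj₁
        one-valid true  = inj₂

      extendPartition-split : SplitPartition (adjoin U v) (proj₂ (extendPartition v (U , κ)))
      extendPartition-split =
        smallFold-hits (SplitPartition (adjoin U v)) _
          (λ D₁ → smallFold-keeps (SplitPartition (adjoin U v)) _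
            (λ D₂ → pick-keeps (adjoin U v) (candidate κ v D₁ D₂ false) (candidate κ v D₁ D₂ true)))
          D₁-small
          (λ κ₁ → smallFold-hits (SplitPartition (adjoin U v)) _
            (λ D₂ → pick-keeps (adjoin U v) (candidate κ v D₁ D₂ false) (candidate κ v D₁ D₂ true))
            D₂-small
            (λ κ₂ → pick-finds (adjoin U v) (candidate κ v D₁ D₂ false) (candidate κ v D₁ D₂ true) κ₂
                      (one-valid (lookup κ* v) candidate-split))
            κ₁)
          κ

    partitions-split : ∀ {k} (vs : Vec (Fin n) k) →
      (∀ i → lookup vs i ∈ proj₁ (partitions vs)) × SplitPartition (proj₁ (partitions vs)) (proj₂ (partitions vs))
    partitions-split [] = (λ ()) , λ x y ((x∈ , _) , _) → contradiction x∈ ∈-empty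
    partitions-split (v ∷ vs) with partitions-split vs
    ... | covered , split = covered′ , extendPartition-split v split
      where
      covered′ : ∀ i → lookup (v ∷ vs) i ∈ adjoin (proj₁ (partitions vs)) v
      covered′ zero    = adjoin⁺ (proj₁ (partitions vs)) v (inj₂ refl)
      covered′ (suc i) = adjoin⁺ (proj₁ (partitions vs)) v (inj₁ (covered i))

    partition-split : SplitPartition full partition
    partition-split x y ((_ , x∉S) , (_ , y∉S)) = proj₂ (partitions-split (allFin n)) x y ((all x , x∉S) , (all y , y∉S))
      where
      all : ∀ x → x ∈ proj₁ (partitions (allFin n))
      all x = subst (_∈ proj₁ (partitions (allFin n))) (Vecₚ.lookup-allFin x) (proj₁ (partitions-split (allFin n)) x)

  -- This partition comes from the promise and is invisible to the program; it is the reference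
  -- against which the computed one is proved correct.
  split⇒partition : SplitDeletionSet G S → ∃[ κ* ] SplitPartition full κ*
  split⇒partition (κ , clique , independent) = κ* , split*
    where
    side : ∀ y → Dec (y ∈ ∁ S) → Bool
    side y (yes y∈) = κ (y , y∈)
    side y (no _)   = false
    κ* : Subset n
    κ* = Vec.tabulate λ y → side y (y Subsetₚ.∈? ∁ S)
    κ*-spec : ∀ {y} (y∈ : y ∈ ∁ S) → (y ∈ κ* → κ (y , y∈) ≡ true) × (κ (y , y∈) ≡ true → y ∈ κ*)
    κ*-spec {y} y∈ = (λ y∈κ* → trans (sym (eq y∈)) (trans (sym (lookup∘tabulate _ y)) ([]=⇒lookup y∈κ*))) ,
                     (λ κ≡ → lookup⇒[]= y κ* (trans (lookup∘tabulate _ y) (trans (eq y∈) κ≡)))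
      where
      eq : ∀ y∈ → side y (y Subsetₚ.∈? ∁ S) ≡ κ (y , y∈)
      eq y∈ with y Subsetₚ.∈? ∁ S
      ... | yes y∈′ = cong (λ p → κ (y , p)) (VecWithK.[]=-irrelevant y∈′ y∈)
      ... | no y∉   = contradiction y∈ y∉
    split* : SplitPartition full κ*
    split* x y ((_ , x∉S) , (_ , y∉S)) = adjacent , separated
      where
      x∈ : x ∈ ∁ S
      x∈ = Subsetₚ.x∉p⇒x∈∁p x∉S
      y∈ : y ∈ ∁ S
      y∈ = Subsetₚ.x∉p⇒x∈∁p y∉S
      adjacent : x ∈ κ* × y ∈ κ* → x ≡ y ⊎ Adj G x y
      adjacent (x∈κ , y∈κ) with x ≟ y
      ... | yes x≡y = inj₁ x≡y
      ... | no x≢y  = inj₂ (clique (x , x∈) (y , y∈) (proj₁ (κ*-spec x∈) x∈κ) (proj₁ (κ*-spec y∈) y∈κ) (x≢y ∘ cong proj₁))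
      separated : (x ∈ κ* ⊎ y ∈ κ*) ⊎ ¬ Adj G x y
      separated with κ (x , x∈) in κx | κ (y , y∈) in κy
      ... | true  | _     = inj₁ (inj₁ (proj₂ (κ*-spec x∈) κx))
      ... | false | true  = inj₁ (inj₂ (proj₂ (κ*-spec y∈) κy))
      ... | false | false = inj₂ (independent (x , x∈) (y , y∈) κx κy)

-- The algorithms as terms

-- Used to erase the digit bounds carried by the numbers of type `num`.
foldr-fusion : ∀ {A B C : Set} (h : B → C) {f : A → B → B} {g : A → C → C} →
               (∀ x b → h (f x b) ≡ g x (h b)) → ∀ z {k} (xs : Vec A k) →
               h (Vec.foldr′ f z xs) ≡ Vec.foldr′ g (h z) xs
foldr-fusion h eq z []                 = refl
foldr-fusion h {g = g} eq z (x ∷ xs)   = trans (eq x _) (cong (g x) (foldr-fusion h eq z xs))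

size-Vec : ∀ {A : Set} (e : A → Tree) {k} (xs : Vec A k) → k ≤ size (⌜ e ⌝ⱽ xs)
size-Vec e []       = z≤n
size-Vec e (x ∷ xs) = s≤s (≤-trans (size-Vec e xs) (m≤n+m _ (size (e x))))

module Programs (Del : ∀ {n} → Graph (Fin n) → Subset n → Set) where
  open CVCInstance

  encode : CVCInstance Del → Tree
  encode = Problem.encode (CVC Del)

  N : CVCInstance Del → ℕ
  N i = size (encode i)

  vertices : CVCInstance Del → Tree
  vertices i = ⌜ (λ x → ⌜ toℕ x ⌝ᵁ) ⌝ⱽ (allFin (n i))

  open Language (CVCInstance Del) N (λ i → cons (vertices i) (encode i)) public

  instance
    rooted-𝟙 : Rooted 𝟙
    rooted-𝟙 = here

    rooted-⊗ : ∀ {Γ A} → ⦃ Rooted Γ ⦄ → Rooted (Γ ⊗ A)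
    rooted-⊗ ⦃ r ⦄ = there r

  V : Length
  V = record
    { len   = n
    ; bound = 𝕏
    -- The characteristic vector of `S` in the input has length `n`.
    ; len≤  = λ i → ≤-trans (size-Vec ⌜_⌝ᴮ (S i)) (≤-trans (m≤m+n _ _)
                (≤-trans (n≤1+n _) (≤-trans (m≤n+m _ (size ⌜ G i ⌝ᴳ)) (n≤1+n _))))
    }

  𝕊 : Ty
  𝕊 = vec 𝔹 V

  rangeᵀ : Poly 𝟙 (vec (fin V) V) (λ i _ → allFin (n i))
  rangeᵀ = simple fstᶠ (# 3) λ _ _ → fstᶠ-⇓

  open Loops V rangeᵀ public

  matrixᵀ : Poly 𝟙 (vec 𝕊 V) (λ i _ → adjacencyMatrix (G i))
  matrixᵀ = simple (fstᶠ ∘ᶠ sndᶠ) (# 9) λ i _ → ∘ᶠ-⇓ {fstᶠ} {sndᶠ} sndᶠ-⇓ fstᶠ-⇓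

  S₀ᵀ : Poly 𝟙 𝕊 (λ i _ → S i)
  S₀ᵀ = simple (fstᶠ ∘ᶠ (sndᶠ ∘ᶠ sndᶠ)) (# 15) λ i _ →
    ∘ᶠ-⇓ {fstᶠ} {sndᶠ ∘ᶠ sndᶠ} (∘ᶠ-⇓ {sndᶠ} {sndᶠ} sndᶠ-⇓ sndᶠ-⇓) fstᶠ-⇓

  -- The bound on the digits, which pred preserves, makes arithmetic polynomial.
  num : Ty
  num = coded (λ i → Σ[ k ∈ ℕ ] digits (fromℕ k) ≤ suc (digits (fromℕ (ℓ i)))) (λ k → ⌜ proj₁ k ⌝ᴺ)

  digits-ℓ : ∀ i → digits (fromℕ (ℓ i)) ≤ N i
  digits-ℓ i = ≤-trans (digits≤size (fromℕ (ℓ i))) (≤-trans (m≤n+m _ (size ⌜ S i ⌝ˢ))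
    (≤-trans (n≤1+n _) (≤-trans (m≤n+m _ (size ⌜ G i ⌝ᴳ)) (n≤1+n _))))

  suc-num : Map 𝟙 num
  suc-num i _ = suc (ℓ i) , subst (λ b → digits b ≤ suc (digits (fromℕ (ℓ i)))) (sym (fromℕ-suc (ℓ i))) (digits-suc (fromℕ (ℓ i)))

  ℓ+1ᵀ : Poly 𝟙 num suc-num
  ℓ+1ᵀ = simple (sucᶠ ∘ᶠ (sndᶠ ∘ᶠ (sndᶠ ∘ᶠ sndᶠ))) (# 18 :+ (# 10 :+ 𝕏 :* # 4 :* # 10)) λ i _ →
    ⇓-mono (bound≤ i)
      (⇓-result (cong ⌜_⌝ᵇ (sym (fromℕ-suc (ℓ i))))
        (∘ᶠ-⇓ {sucᶠ} {sndᶠ ∘ᶠ (sndᶠ ∘ᶠ sndᶠ)}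
          (∘ᶠ-⇓ {sndᶠ} {sndᶠ ∘ᶠ sndᶠ} (∘ᶠ-⇓ {sndᶠ} {sndᶠ} sndᶠ-⇓ sndᶠ-⇓) sndᶠ-⇓) (sucᶠ-⇓ (fromℕ (ℓ i)))))
    where
    bound≤ : ∀ i → 18 + size ⌜ ℓ i ⌝ᴺ * 10 ≤ 18 + (10 + N i * 4 * 10)
    bound≤ i = +-monoʳ-≤ 18 (*-monoˡ-≤ 10 (≤-trans (size≤digits (fromℕ (ℓ i))) (+-monoʳ-≤ 1 (*-monoˡ-≤ 4 (digits-ℓ i)))))

  pred-num : Map num num
  pred-num i (k , short) = ℕ.pred k ,
    ≤-trans (≤-reflexive (cong digits (ℕᵇₚ.fromℕ-pred k))) (≤-trans (digits-pred (fromℕ k)) short)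

  pred₀ᵀ : Poly num num pred-num
  pred₀ᵀ = simple predᶠ (# 9 :+ (# 1 :+ (# 1 :+ 𝕏) :* # 4) :* # 9) λ i (k , short) →
    ⇓-mono (+-monoʳ-≤ 9 (*-monoˡ-≤ 9 (≤-trans (size≤digits (fromℕ k))
      (+-monoʳ-≤ 1 (*-monoˡ-≤ 4 (≤-trans short (s≤s (digits-ℓ i))))))))
      (⇓-result (cong ⌜_⌝ᵇ (sym (ℕᵇₚ.fromℕ-pred k))) (predᶠ-⇓ (fromℕ k)))

  isZero₀ᵀ : Poly num 𝔹 (λ _ k → isZero (proj₁ k))
  isZero₀ᵀ = simple isZeroᶠ (# 5) λ _ k → isZeroᶠ-⇓ (proj₁ k)

  -- Lets f be inferred from the term before it is compared with g.
  infix 0 _as_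

  _as_ : ∀ {Γ w A f g} → Term Γ w A f → (∀ i γ → f i γ ≡ g i γ) → Term Γ w A g
  t as eq = congᵀ eq t

  module _ {Γ : Ty} ⦃ rooted : Rooted Γ ⦄ {w : Weight Γ} where

    adjᵀ : ∀ {x y} → Term Γ w (fin V) x → Term Γ w (fin V) y →
           Term Γ w 𝔹 (λ i γ → Graph.adj (G i) (x i γ) (y i γ))
    adjᵀ {x} {y} s t = congᵀ (λ i γ → trans (cong (λ row → lookup row (y i γ)) (lookup∘tabulate _ (x i γ)))
                                            (lookup∘tabulate _ (y i γ)))
                             (lookupᵀ (lookupᵀ (matrixᵀ $ᵀ rootᵀ) s) t)

    Sᵀ : Term Γ w 𝕊 (λ i _ → S i)
    Sᵀ = S₀ᵀ $ᵀ rootᵀ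

    emptyᵀ : Term Γ w 𝕊 (λ i _ → empty)
    emptyᵀ = tabulateᵀ falseᵀ

    fullᵀ : Term Γ w 𝕊 (λ i _ → full)
    fullᵀ = tabulateᵀ trueᵀ

  singleton₀ᵀ : Poly (𝟙 ⊗ fin V) 𝕊 (λ i γ → singleton (proj₂ γ))
  singleton₀ᵀ = tabulateᵀ (equalᵀ v1 v0)

  module _ {Γ : Ty} ⦃ rooted : Rooted Γ ⦄ {w : Weight Γ} where

    singletonᵀ : ∀ {x} → Term Γ w (fin V) x → Term Γ w 𝕊 (λ i γ → singleton (x i γ))
    singletonᵀ t = singleton₀ᵀ $ᵀ (rootᵀ ,ᵀ t)

    anySmallᵀ : ∀ {f} → Term (Γ ⊗ 𝕊) (λ i γ → w i (proj₁ γ)) 𝔹 f →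
                Term Γ w 𝔹 (λ i γ → anySmall (λ D → f i (γ , D)))
    anySmallᵀ t = letᵀ emptyᵀ t ∨ᵀ anyᵀ (compose t (fstᵀ ,ᵀ (singleton₀ᵀ $ᵀ (rootᵀ ,ᵀ v0))) (λ _ _ → ≤-refl))

  module R (i : CVCInstance Del) = Reachability (G i)
  module Sol (i : CVCInstance Del) = Solutions (G i) (S i)

  reach₀ᵀ : Poly ((𝟙 ⊗ 𝕊) ⊗ fin V) 𝕊 (λ i ((_ , X) , u) → R.reach i X u)
  reach₀ᵀ = iterateᵀ (singletonᵀ v0)
    (tabulateᵀ (lookupᵀ v1 v0 ∨ᵀ (lookupᵀ v4 v0 ∧ᵀ anyᵀ (lookupᵀ v2 v0 ∧ᵀ adjᵀ v0 v1))))

  module _ {Γ : Ty} ⦃ rooted : Rooted Γ ⦄ {w : Weight Γ} where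

    reachᵀ : ∀ {X u} → Term Γ w 𝕊 X → Term Γ w (fin V) u → Term Γ w 𝕊 (λ i γ → R.reach i (X i γ) (u i γ))
    reachᵀ s t = reach₀ᵀ $ᵀ (rootᵀ ,ᵀ s ,ᵀ t)

  covers₀ᵀ : Poly (𝟙 ⊗ 𝕊) 𝔹 (λ i (_ , X) → R.covers i X)
  covers₀ᵀ = allᵀ (allᵀ (notᵀ (adjᵀ v1 v0) ∨ᵀ (lookupᵀ v2 v1 ∨ᵀ lookupᵀ v2 v0)))

  connected₀ᵀ : Poly (𝟙 ⊗ 𝕊) 𝔹 (λ i (_ , X) → R.connected i X)
  connected₀ᵀ = allᵀ (allᵀ (notᵀ (lookupᵀ v2 v1 ∧ᵀ lookupᵀ v2 v0) ∨ᵀ lookupᵀ (reachᵀ v2 v1) v0))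

  base₀ᵀ : Poly (((𝟙 ⊗ 𝕊) ⊗ 𝕊) ⊗ 𝕊) 𝕊
           (λ i (((_ , κ) , S′) , D) → Sol.base i κ S′ D)
  base₀ᵀ = tabulateᵀ
    (ifᵀ (lookupᵀ Sᵀ v0) (lookupᵀ v2 v0)
      (ifᵀ (lookupᵀ v3 v0) (notᵀ (lookupᵀ v1 v0))
        (anyᵀ (adjᵀ v0 v1 ∧ᵀ ifᵀ (lookupᵀ Sᵀ v0) (notᵀ (lookupᵀ v3 v0)) (lookupᵀ v4 v0 ∧ᵀ lookupᵀ v2 v0)))))

  remaining-num : Map (𝟙 ⊗ 𝕊) num
  remaining-num i γ = Vec.foldr′ (λ x r → if x then pred-num i r else r) (suc-num i tt) (proj₂ γ)

  remaining-num≡ : ∀ i γ → proj₁ (remaining-num i γ) ≡ remaining (suc (ℓ i)) (proj₂ γ)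
  remaining-num≡ i γ = foldr-fusion proj₁ (λ where true r → refl
                                                   false r → refl) (suc-num i tt) (proj₂ γ)

  remaining₀ᵀ : Poly (𝟙 ⊗ 𝕊) num remaining-num
  remaining₀ᵀ = foldrᵀ v0 (ℓ+1ᵀ $ᵀ rootᵀ) (ifᵀ v1 (pred₀ᵀ $ᵀ v0) v0)

  fits₀ᵀ : Poly (𝟙 ⊗ 𝕊) 𝔹 (λ i γ → fits (ℓ i) (proj₂ γ))
  fits₀ᵀ = congᵀ (λ i γ → cong (λ r → not (isZero r)) (remaining-num≡ i γ)) (notᵀ (isZero₀ᵀ $ᵀ remaining₀ᵀ))

  check₃ᵀ : Poly (𝟙 ⊗ 𝕊) 𝔹 (λ i (_ , B) → R.covers i B ∧ (R.connected i B ∧ fits (ℓ i) B))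
  check₃ᵀ = covers₀ᵀ ∧ᵀ (connected₀ᵀ ∧ᵀ fits₀ᵀ)

  leaf₃ᵀ : Poly (𝟙 ⊗ 𝕊) 𝔹 (λ i (_ , S′) → Sol.CliqueCase.leaf₃ i (ℓ i) S′)
  leaf₃ᵀ = anySmallᵀ (check₃ᵀ $ᵀ (rootᵀ ,ᵀ (base₀ᵀ $ᵀ (rootᵀ ,ᵀ fullᵀ ,ᵀ v1 ,ᵀ v0)))) as λ _ _ → refl

  solve₃ᵀ : Term 𝟙 (λ i _ → 2 ℕ.^ ∣ S i ∣) 𝔹 (λ i _ → Sol.CliqueCase.solve₃ i (ℓ i))
  solve₃ᵀ = branchᵀ 0 (leaf₃ᵀ $ᵀ (rootᵀ ,ᵀ v0)) (fstᵀ ∨ᵀ sndᵀ) Sᵀ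

  -- The terms for the table of the split case, in the context S′, B, r, T, Q, z.

  module Sp (i : CVCInstance Del) = SplitCase (G i) (S i) (ℓ i)

  without₀ᵀ : Poly ((𝟙 ⊗ 𝕊) ⊗ 𝕊) 𝕊 (λ i ((_ , Q) , M) → Sp.without i Q M)
  without₀ᵀ = tabulateᵀ (lookupᵀ v2 v0 ∧ᵀ notᵀ (lookupᵀ v1 v0))

  insert₀ᵀ : Poly ((𝟙 ⊗ 𝕊) ⊗ fin V) 𝕊 (λ i ((_ , Q) , x) → Sp.insert i Q x)
  insert₀ᵀ = tabulateᵀ (lookupᵀ v2 v0 ∨ᵀ equalᵀ v1 v0)

  module _ {Γ : Ty} ⦃ rooted : Rooted Γ ⦄ {w : Weight Γ} where

    withoutᵀ : ∀ {Q M} → Term Γ w 𝕊 Q → Term Γ w 𝕊 M → Term Γ w 𝕊 (λ i γ → Sp.without i (Q i γ) (M i γ))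
    withoutᵀ s t = without₀ᵀ $ᵀ (rootᵀ ,ᵀ s ,ᵀ t)

    insertᵀ : ∀ {Q x} → Term Γ w 𝕊 Q → Term Γ w (fin V) x → Term Γ w 𝕊 (λ i γ → Sp.insert i (Q i γ) (x i γ))
    insertᵀ s t = insert₀ᵀ $ᵀ (rootᵀ ,ᵀ s ,ᵀ t)

  Ctx : Ty
  Ctx = ((𝟙 ⊗ 𝕊) ⊗ 𝕊) ⊗ fin V

  module Rd (i : CVCInstance Del) (γ : ⟦ Ctx ⟧ i) =
    SplitCase.Rounds (G i) (S i) (ℓ i) (proj₂ (proj₁ γ)) (proj₂ (proj₁ (proj₁ γ))) (proj₂ γ)

  extend₀ᵀ : Poly (((Ctx ⊗ 𝕋) ⊗ 𝕊) ⊗ fin V) 𝔹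
             (λ i (((γ , t) , Q) , z) → Rd.extend i γ t Q z)
  extend₀ᵀ =
    (lookupᵀ (reachᵀ v4 v0) v3 ∧ᵀ findᵀ v2 v5 (withoutᵀ v1 (reachᵀ v4 v0))) ∨ᵀ
    anyᵀ ((lookupᵀ v6 v0 ∧ᵀ lookupᵀ (reachᵀ v5 v1) v0) ∧ᵀ
          findᵀ v3 v6 (insertᵀ (withoutᵀ v2 (reachᵀ v5 v1)) v0))

  next₀ᵀ : Poly ((Ctx ⊗ 𝕋) ⊗ 𝕊) 𝔹 (λ i ((γ , t) , Q) → Rd.next i γ t Q)
  next₀ᵀ = findᵀ v1 v4 v0 ∨ᵀ anyᵀ extend₀ᵀ

  start₀ᵀ : Poly (Ctx ⊗ 𝕊) 𝔹 (λ i (γ , Q) → Rd.start i γ Q)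
  start₀ᵀ = allᵀ (notᵀ (lookupᵀ v1 v0) ∨ᵀ lookupᵀ (reachᵀ v3 v2) v0)

  -- A table has exponential size, so its nodes are recoded as raw trees of type `𝕋`; joining two
  -- halves is then a single `cons`.
  tableᵀ : ∀ {Γ m f} → Poly (Γ ⊗ 𝕊) 𝔹 f → Poly Γ 𝕊 m →
           Term Γ (λ i γ → 2 ℕ.^ ∣ m i γ ∣) 𝕋 (λ i γ → Sp.tableOf i (m i γ) (λ Q → f i (γ , Q)))
  tableᵀ leaf mask = branchᵀ 0 (recode (λ _ b → ⌜ b ⌝ᴮ) (λ _ _ → refl) (leaf $ᵀ idᵀ))
                              (recode (λ _ p → cons (proj₁ p) (proj₂ p)) (λ _ _ → refl) idᵀ) mask

  2^S′ : Weight Ctx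
  2^S′ i (((_ , S′) , _) , _) = 2 ℕ.^ ∣ S′ ∣

  round-num : Map (Ctx ⊗ (𝕋 ⊗ num)) (𝕋 ⊗ num)
  round-num i (γ@(((_ , S′) , _) , _) , t , e) =
    (if isZero (proj₁ e) then t else Sp.tableOf i S′ (Rd.next i γ t)) , pred-num i e

  roundᵀ : Term (Ctx ⊗ (𝕋 ⊗ num)) (λ i γ → 2^S′ i (proj₁ γ)) (𝕋 ⊗ num) round-num
  roundᵀ = ifᵀ (isZero₀ᵀ $ᵀ (sndᵀ $ᵀ v0)) (fstᵀ $ᵀ v0)
             (compose (tableᵀ next₀ᵀ v3) (fstᵀ ,ᵀ (fstᵀ $ᵀ v0)) (λ _ _ → ≤-refl)) ,ᵀ
           (pred₀ᵀ $ᵀ (sndᵀ $ᵀ v0))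

  budget-num : Map Ctx num
  budget-num i ((_ , B) , _) = pred-num i (remaining-num i (tt , B))

  rounds-num : Map Ctx (𝕋 ⊗ num)
  rounds-num i γ@(((_ , S′) , _) , _) = Vec.foldr′ (λ x acc → round-num i (γ , acc))
    (Sp.tableOf i S′ (Rd.start i γ) , budget-num i γ) (allFin (n i))

  roundsᵀ : Term Ctx 2^S′ (𝕋 ⊗ num) rounds-num
  roundsᵀ = iterateᵀ (tableᵀ start₀ᵀ v2 ,ᵀ (pred₀ᵀ $ᵀ (remaining₀ᵀ $ᵀ (rootᵀ ,ᵀ v1))))
                     (compose roundᵀ ((fstᵀ $ᵀ fstᵀ) ,ᵀ v0) (λ _ _ → ≤-refl)) as λ _ _ → refl

  finalᵀ : Term Ctx 2^S′ 𝕋 (λ i (((_ , S′) , B) , r) → Sp.final i B S′ r)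
  finalᵀ = congᵀ final≡ (fstᵀ $ᵀ roundsᵀ)
    where
    final≡ : ∀ i (γ@(((_ , S′) , B) , r) : ⟦ Ctx ⟧ i) → proj₁ (rounds-num i γ) ≡ Sp.final i B S′ r
    final≡ i γ@(((_ , S′) , B) , r) = trans
      (cong proj₁ (foldr-fusion forget (λ _ _ → refl)
        (Sp.tableOf i S′ (Rd.start i γ) , budget-num i γ) (allFin (n i))))
      (cong (λ e → proj₁ (Rd.rounds i γ (ℕ.pred e) (allFin (n i)))) (remaining-num≡ i (tt , B)))
      where
      forget : Tree × ⟦ num ⟧ i → Tree × ℕ
      forget (T , e) = T , proj₁ e

  anchored₀ᵀ : Poly Ctx 𝔹 (λ i (((_ , S′) , B) , r) → Sp.anchored i B S′ r)
  anchored₀ᵀ = allᵀ (notᵀ (lookupᵀ v2 v0) ∨ᵀ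
                 anyᵀ ((lookupᵀ v4 v0 ∨ᵀ equalᵀ v2 v0) ∧ᵀ lookupᵀ (reachᵀ v3 v1) v0))

  check₁ᵀ : Term ((𝟙 ⊗ 𝕊) ⊗ 𝕊) (λ i ((_ , S′) , _) → 2 ℕ.^ ∣ S′ ∣) 𝔹 (λ i ((_ , S′) , B) →
    (R.covers i B ∧ fits (ℓ i) B) ∧
    anyFin (λ r → (lookup B r ∧ Sp.anchored i B S′ r) ∧ find (Sp.final i B S′ r) S′ S′))
  check₁ᵀ = ((covers₀ᵀ $ᵀ (rootᵀ ,ᵀ v0)) ∧ᵀ (fits₀ᵀ $ᵀ (rootᵀ ,ᵀ v0))) ∧ᵀ
    anyᵀ ((lookupᵀ v1 v0 ∧ᵀ (anchored₀ᵀ $ᵀ idᵀ)) ∧ᵀ findᵀ finalᵀ v2 v2)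

  leaf₁ᵀ : Term ((𝟙 ⊗ 𝕊) ⊗ 𝕊) (λ i γ → 2 ℕ.^ ∣ proj₂ γ ∣) 𝔹
           (λ i ((_ , κ) , S′) → Sp.leaf₁ i κ S′)
  leaf₁ᵀ = anySmallᵀ (compose check₁ᵀ (rootᵀ ,ᵀ v1 ,ᵀ (base₀ᵀ $ᵀ (rootᵀ ,ᵀ v2 ,ᵀ v1 ,ᵀ v0))) (λ _ _ → ≤-refl)) as λ _ _ → refl

  module Pt (i : CVCInstance Del) = Partition (G i) (S i)

  valid₀ᵀ : Poly ((𝟙 ⊗ 𝕊) ⊗ 𝕊) 𝔹 (λ i ((_ , U) , κ) → Pt.valid i U κ)
  valid₀ᵀ = allᵀ (allᵀ
    (notᵀ ((lookupᵀ v3 v1 ∧ᵀ notᵀ (lookupᵀ Sᵀ v1)) ∧ᵀ (lookupᵀ v3 v0 ∧ᵀ notᵀ (lookupᵀ Sᵀ v0))) ∨ᵀ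
     ((notᵀ (lookupᵀ v2 v1 ∧ᵀ lookupᵀ v2 v0) ∨ᵀ (equalᵀ v1 v0 ∨ᵀ adjᵀ v1 v0)) ∧ᵀ
      ((lookupᵀ v2 v1 ∨ᵀ lookupᵀ v2 v0) ∨ᵀ notᵀ (adjᵀ v1 v0)))))

  adjoin₀ᵀ : Poly ((𝟙 ⊗ 𝕊) ⊗ fin V) 𝕊 (λ i ((_ , U) , v) → Pt.adjoin i U v)
  adjoin₀ᵀ = insert₀ᵀ

  candidate₀ᵀ : Poly (((((𝟙 ⊗ 𝕊) ⊗ fin V) ⊗ 𝕊) ⊗ 𝕊) ⊗ 𝔹) 𝕊
    (λ i (((((_ , κ) , v) , D₁) , D₂) , b) → Pt.candidate i κ v D₁ D₂ b)
  candidate₀ᵀ = tabulateᵀ (ifᵀ (equalᵀ v4 v0) v1 ((lookupᵀ v5 v0 ∧ᵀ notᵀ (lookupᵀ v3 v0)) ∨ᵀ lookupᵀ v2 v0))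

  pick₀ᵀ : Poly ((((𝟙 ⊗ 𝕊) ⊗ 𝕊) ⊗ 𝕊) ⊗ 𝕊) 𝕊 (λ i ((((_ , U) , κ₁) , κ₂) , κ) → Pt.pick i U κ₁ κ₂ κ)
  pick₀ᵀ = ifᵀ (valid₀ᵀ $ᵀ (rootᵀ ,ᵀ v3 ,ᵀ v2)) v2 (ifᵀ (valid₀ᵀ $ᵀ (rootᵀ ,ᵀ v3 ,ᵀ v1)) v1 v0)

  smallFoldᵀ : ∀ {Γ A c a} → ⦃ Rooted Γ ⦄ → Poly ((Γ ⊗ 𝕊) ⊗ A) A c → Poly Γ A a →
               Poly Γ A (λ i γ → smallFold (λ D acc → c i ((γ , D) , acc)) (a i γ))
  smallFoldᵀ t s = iterateᵀ (t $ᵀ (idᵀ ,ᵀ emptyᵀ ,ᵀ s)) (t $ᵀ ((fstᵀ $ᵀ fstᵀ) ,ᵀ singletonᵀ v1 ,ᵀ v0)) as λ _ _ → refl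

  -- In the context v, U, κ, D₁, κ₁, D₂, κ₂.
  improveᵀ : Poly (((((((𝟙 ⊗ fin V) ⊗ 𝕊) ⊗ 𝕊) ⊗ 𝕊) ⊗ 𝕊) ⊗ 𝕊) ⊗ 𝕊) 𝕊 _
  improveᵀ = pick₀ᵀ $ᵀ (rootᵀ ,ᵀ (adjoin₀ᵀ $ᵀ (rootᵀ ,ᵀ v5 ,ᵀ v6)) ,ᵀ
    (candidate₀ᵀ $ᵀ (rootᵀ ,ᵀ v4 ,ᵀ v6 ,ᵀ v3 ,ᵀ v1 ,ᵀ falseᵀ)) ,ᵀ
    (candidate₀ᵀ $ᵀ (rootᵀ ,ᵀ v4 ,ᵀ v6 ,ᵀ v3 ,ᵀ v1 ,ᵀ trueᵀ)) ,ᵀ v0)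

  extendPartitionᵀ : Poly (((𝟙 ⊗ fin V) ⊗ 𝕊) ⊗ 𝕊) (𝕊 ⊗ 𝕊)
    (λ i (((_ , v) , U) , κ) → Pt.extendPartition i v (U , κ))
  extendPartitionᵀ = (adjoin₀ᵀ $ᵀ (rootᵀ ,ᵀ v1 ,ᵀ v2)) ,ᵀ smallFoldᵀ (smallFoldᵀ improveᵀ v0) v0 as λ _ _ → refl

  partitionᵀ : Poly 𝟙 𝕊 (λ i _ → Pt.partition i)
  partitionᵀ = sndᵀ $ᵀ iterateᵀ (emptyᵀ ,ᵀ emptyᵀ)
    (extendPartitionᵀ $ᵀ ((fstᵀ $ᵀ fstᵀ) ,ᵀ v1 ,ᵀ (fstᵀ $ᵀ v0) ,ᵀ (sndᵀ $ᵀ v0)))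

  search₁ᵀ : Term (𝟙 ⊗ 𝕊) (λ i _ → 3 ℕ.^ ∣ S i ∣) 𝔹 (λ i (_ , κ) → Sp.solve₁ i κ)
  search₁ᵀ = anySmallᵀ (covers₀ᵀ $ᵀ (rootᵀ ,ᵀ v0)) ∨ᵀ branchᵀ 1 leaf₁ᵀ (fstᵀ ∨ᵀ sndᵀ) Sᵀ

  solve₁ᵀ : Term 𝟙 (λ i _ → 3 ℕ.^ ∣ S i ∣) 𝔹 (λ i _ → Sp.solve₁ i (Pt.partition i))
  solve₁ᵀ = compose search₁ᵀ (rootᵀ ,ᵀ (partitionᵀ $ᵀ idᵀ)) (λ _ _ → ≤-refl)

-- Running times

toℚᵘ-ℕ→ℚ : ∀ m → ℚ.toℚᵘ (ℕ→ℚ m) ℚᵘ.≃ mkℚᵘ (ℤ.+ m) 0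
toℚᵘ-ℕ→ℚ m = ℚₚ.toℚᵘ-fromℚᵘ (mkℚᵘ (ℤ.+ m) 0)

ℕ→ℚ-* : ∀ a b → ℕ→ℚ (a * b) ≡ ℕ→ℚ a ℚ.* ℕ→ℚ b
ℕ→ℚ-* a b = ℚₚ.toℚᵘ-injective (begin
  ℚ.toℚᵘ (ℕ→ℚ (a * b))                   ≈⟨ toℚᵘ-ℕ→ℚ (a * b) ⟩
  mkℚᵘ (ℤ.+ (a * b)) 0                      ≈⟨ *≡* (cong (ℤ._* ℤ.+ 1) (ℤₚ.pos-* a b)) ⟩
  mkℚᵘ (ℤ.+ a) 0 ℚᵘ.* mkℚᵘ (ℤ.+ b) 0          ≈⟨ ℚᵘₚ.*-cong (toℚᵘ-ℕ→ℚ a) (toℚᵘ-ℕ→ℚ b) ⟨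
  ℚ.toℚᵘ (ℕ→ℚ a) ℚᵘ.* ℚ.toℚᵘ (ℕ→ℚ b)     ≈⟨ ℚₚ.toℚᵘ-homo-* (ℕ→ℚ a) (ℕ→ℚ b) ⟨
  ℚ.toℚᵘ (ℕ→ℚ a ℚ.* ℕ→ℚ b)               ∎)
  where open ℚᵘₚ.≃-Reasoning

ℕ→ℚ-+ : ∀ a b → ℕ→ℚ (a + b) ≡ ℕ→ℚ a ℚ.+ ℕ→ℚ b
ℕ→ℚ-+ a b = ℚₚ.toℚᵘ-injective (begin
  ℚ.toℚᵘ (ℕ→ℚ (a + b))                   ≈⟨ toℚᵘ-ℕ→ℚ (a + b) ⟩
  mkℚᵘ (ℤ.+ (a + b)) 0                      ≈⟨ *≡* (cong (ℤ._* ℤ.+ 1) (cong₂ ℤ._+_ (sym (ℤₚ.*-identityʳ (ℤ.+ a))) (sym (ℤₚ.*-identityʳ (ℤ.+ b))))) ⟩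
  mkℚᵘ (ℤ.+ a) 0 ℚᵘ.+ mkℚᵘ (ℤ.+ b) 0          ≈⟨ ℚᵘₚ.+-cong (toℚᵘ-ℕ→ℚ a) (toℚᵘ-ℕ→ℚ b) ⟨
  ℚ.toℚᵘ (ℕ→ℚ a) ℚᵘ.+ ℚ.toℚᵘ (ℕ→ℚ b)     ≈⟨ ℚₚ.toℚᵘ-homo-+ (ℕ→ℚ a) (ℕ→ℚ b) ⟨
  ℚ.toℚᵘ (ℕ→ℚ a ℚ.+ ℕ→ℚ b)               ∎)
  where open ℚᵘₚ.≃-Reasoning

ℕ→ℚ-mono : ∀ {a b} → a ≤ b → ℕ→ℚ a ℚ.≤ ℕ→ℚ b
ℕ→ℚ-mono {a} {b} a≤b = ℚₚ.toℚᵘ-cancel-≤ (begin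
  ℚ.toℚᵘ (ℕ→ℚ a) ≃⟨ toℚᵘ-ℕ→ℚ a ⟩
  mkℚᵘ (ℤ.+ a) 0    ≤⟨ *≤* (ℤₚ.*-monoʳ-≤-nonNeg (ℤ.+ 1) (ℤ.+≤+ a≤b)) ⟩
  mkℚᵘ (ℤ.+ b) 0    ≃⟨ toℚᵘ-ℕ→ℚ b ⟨
  ℚ.toℚᵘ (ℕ→ℚ b) ∎)
  where open ℚᵘₚ.≤-Reasoning

ℕ→ℚ-^ : ∀ a k → ℕ→ℚ a ^ k ≡ ℕ→ℚ (a ℕ.^ k)
ℕ→ℚ-^ a zero    = refl
ℕ→ℚ-^ a (suc k) = trans (cong (ℕ→ℚ a ℚ.*_) (ℕ→ℚ-^ a k)) (sym (ℕ→ℚ-* a (a ℕ.^ k)))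

size≥1 : ∀ t → 1 ≤ size t
size≥1 nil        = s≤s z≤n
size≥1 (cons _ _) = s≤s z≤n

1≤^ : ∀ {m} → 1 ≤ m → ∀ k → 1 ≤ m ℕ.^ k
1≤^ 1≤m zero    = ≤-refl
1≤^ 1≤m (suc k) = *-mono-≤ 1≤m (1≤^ 1≤m k)

^-grow : ∀ {m} → 1 ≤ m → ∀ {k l} → k ≤ l → m ℕ.^ k ≤ m ℕ.^ l
^-grow {suc m} _ = ℕₚ.^-monoʳ-≤ (suc m)

-- Abstract, since the exponents must not be unfolded.
abstract

  eval-polynomial : ∀ P → ∃[ c ] (∀ m → 1 ≤ m → eval P m ≤ c * m ℕ.^ c)
  eval-polynomial (# c) = c , λ m 1≤m → ≤-trans (≤-reflexive (sym (ℕₚ.*-identityʳ c))) (*-monoʳ-≤ c (1≤^ 1≤m c))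
  eval-polynomial 𝕏     = 1 , λ m _ → ≤-reflexive (sym (trans (ℕₚ.*-identityˡ _) (ℕₚ.*-identityʳ m)))
  eval-polynomial (P :+ Q) with eval-polynomial P | eval-polynomial Q
  ... | c , P≤ | d , Q≤ = c + d , λ m 1≤m → begin
    eval P m + eval Q m                     ≤⟨ +-mono-≤ (P≤ m 1≤m) (Q≤ m 1≤m) ⟩
    c * m ℕ.^ c + d * m ℕ.^ d               ≤⟨ +-mono-≤ (*-monoʳ-≤ c (^-grow 1≤m (m≤m+n c d))) (*-monoʳ-≤ d (^-grow 1≤m (m≤n+m d c))) ⟩
    c * m ℕ.^ (c + d) + d * m ℕ.^ (c + d)   ≡⟨ ℕₚ.*-distribʳ-+ (m ℕ.^ (c + d)) c d ⟨
    (c + d) * m ℕ.^ (c + d)                 ∎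
    where open ℕₚ.≤-Reasoning
  eval-polynomial (P :* Q) with eval-polynomial P | eval-polynomial Q
  -- The same number is both coefficient and exponent, so it has to dominate `c * d` and `c + d`.
  ... | c , P≤ | d , Q≤ = c * d + (c + d) , λ m 1≤m → begin
    eval P m * eval Q m                                        ≤⟨ *-mono-≤ (P≤ m 1≤m) (Q≤ m 1≤m) ⟩
    (c * m ℕ.^ c) * (d * m ℕ.^ d)                              ≡⟨ arith c (m ℕ.^ c) d (m ℕ.^ d) ⟩
    (c * d) * (m ℕ.^ c * m ℕ.^ d)                              ≡⟨ cong (c * d *_) (ℕₚ.^-distribˡ-+-* m c d) ⟨
    (c * d) * m ℕ.^ (c + d)                                    ≤⟨ *-mono-≤ (m≤m+n (c * d) (c + d)) (^-grow 1≤m (m≤n+m (c + d) (c * d))) ⟩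
    (c * d + (c + d)) * m ℕ.^ (c * d + (c + d))                ∎
    where
    open ℕₚ.≤-Reasoning
    arith : ∀ a x b y → (a * x) * (b * y) ≡ (a * b) * (x * y)
    arith = solve-∀

runProgram : Fn → Program
runProgram (fn δ) = record { functions = δ ; main = call zero (var zero) }

runProgram-⇓ : ∀ F {x y b} → F ▹ x ⇓ y ⟨ b ⟩ → ∃[ t ] t ≤ 2 + b × runProgram F on-input x returns y in-steps t
runProgram-⇓ (fn δ) d = ⇓call (⇓var zero) d

decided : ∀ (Π : Problem) (f : ℕ → ℚ) (F : Fn) c (answer : Problem.Instance Π → Bool) (time : Problem.Instance Π → ℕ) →
  (∀ x → F ▹ Problem.encode Π x ⇓ ⌜ answer x ⌝ᴮ ⟨ time x ⟩) →
  (∀ x → Reflects (Problem.Yes Π x) (answer x)) →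
  (∀ x → ℕ→ℚ (2 + time x) ℚ.≤ f (Problem.parameter Π x) ℚ.* ℕ→ℚ (c * size (Problem.encode Π x) ℕ.^ c)) →
  Π solvableInO* f
decided Π f F c answer time runs reflects bounded = runProgram F , c , instances
  where
  open Problem Π
  instances : ∀ x → ∃[ b ] ∃[ t ] runProgram F on-input encode x returns ⌜ b ⌝ᴮ in-steps t × Reflects (Yes x) b ×
              ℕ→ℚ t ℚ.≤ f (parameter x) ℚ.* ℕ→ℚ (c * size (encode x) ℕ.^ c)
  instances x = let t , t≤ , d = runProgram-⇓ F (runs x) in
    answer x , t , d , reflects x , ℚₚ.≤-trans (ℕ→ℚ-mono t≤) (bounded x)

-- Stated for variables, since the arguments of ℕ→ℚ must not be unfolded.
ℕ→ℚ-bound : ∀ a b s C → a ≤ b ℕ.^ s * C → ℕ→ℚ a ℚ.≤ ℕ→ℚ b ^ s ℚ.* ℕ→ℚ C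
ℕ→ℚ-bound a b s C a≤ = ℚₚ.≤-trans (ℕ→ℚ-mono {a} {b ℕ.^ s * C} a≤)
  (ℚₚ.≤-reflexive (trans (ℕ→ℚ-* (b ℕ.^ s) C) (cong (ℚ._* ℕ→ℚ C) (sym (ℕ→ℚ-^ b s)))))

-- The constants are the overheads of `runProgram` (2), of composing with the preparation (3) and of
-- the preparation itself (`29 + m * 12`). Doubling the polynomial absorbs the successor of the
-- weight.
exponential-bound : ∀ b → 1 ≤ b → ∀ P → ∃[ c ] (∀ m → 1 ≤ m → ∀ s →
  2 + (3 + ((29 + m * 12) + eval P m * suc (b ℕ.^ s))) ≤ b ℕ.^ s * (c * m ℕ.^ c))
exponential-bound b 1≤b P = bound-from (eval-polynomial ((# 34 :+ 𝕏 :* # 12 :+ P) :* # 2))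
  where
  open ℕₚ.≤-Reasoning
  arith : ∀ w p → p * (w + w) ≡ w * (p * 2)
  arith = solve-∀
  steps≤ : ∀ a p W {C} → 1 ≤ W → (a + p) * 2 ≤ C → a + p * suc W ≤ W * C
  steps≤ a p W {C} 1≤W ≤C = begin
    a + p * suc W       ≤⟨ absorb a p W ⟩
    (a + p) * suc W     ≤⟨ *-monoʳ-≤ (a + p) (+-monoˡ-≤ W 1≤W) ⟩
    (a + p) * (W + W)   ≡⟨ arith W (a + p) ⟩
    W * ((a + p) * 2)   ≤⟨ *-monoʳ-≤ W ≤C ⟩
    W * C               ∎
  bound-from : ∃[ c ] (∀ m → 1 ≤ m → (34 + m * 12 + eval P m) * 2 ≤ c * m ℕ.^ c) →
               ∃[ c ] (∀ m → 1 ≤ m → ∀ s → 2 + (3 + ((29 + m * 12) + eval P m * suc (b ℕ.^ s))) ≤ b ℕ.^ s * (c * m ℕ.^ c))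
  bound-from (c , P≤) = c , λ m 1≤m s → steps≤ (34 + m * 12) (eval P m) (b ℕ.^ s) (1≤^ 1≤b s) (P≤ m 1≤m)

module Solvability (Del : ∀ {n} → Graph (Fin n) → Subset n → Set) where
  open Programs Del
  open CVCInstance

  prepareᶠ : Fn
  prepareᶠ = (recurᶠ range-body ∘ᶠ (constᶠ nil ,ᶠ (fstᶠ ∘ᶠ sndᶠ))) ,ᶠ idᶠ

  prepareᶠ-⇓ : ∀ i → prepareᶠ ▹ encode i ⇓ cons (vertices i) (encode i) ⟨ 29 + N i * 12 ⟩
  prepareᶠ-⇓ i = ⇓-mono (≤-trans (≤-reflexive (arith (n i * 12))) (+-monoʳ-≤ 29 (*-monoˡ-≤ 12 (Length.len≤ V i))))
    (,ᶠ-⇓ {recurᶠ range-body ∘ᶠ (constᶠ nil ,ᶠ (fstᶠ ∘ᶠ sndᶠ))} {idᶠ}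
      (∘ᶠ-⇓ {recurᶠ range-body} {constᶠ nil ,ᶠ (fstᶠ ∘ᶠ sndᶠ)}
        (,ᶠ-⇓ {constᶠ nil} {fstᶠ ∘ᶠ sndᶠ} (constᶠ-⇓ nil) (∘ᶠ-⇓ {fstᶠ} {sndᶠ} sndᶠ-⇓ fstᶠ-⇓))
        (rangeᶠ-⇓ ⌜_⌝ᴮ 0 (S i)))
      idᶠ-⇓)
    where
    arith : ∀ m → 5 + ((3 + ((5 + (1 + (3 + (3 + 3)))) + (5 + m))) + 1) ≡ 29 + m
    arith = solve-∀

  solvable : ∀ b → 1 ≤ b → ∀ {f} → Term 𝟙 (λ i _ → b ℕ.^ ∣ S i ∣) 𝔹 f →
             (∀ i → Reflects (Problem.Yes (CVC Del) i) (f i tt)) →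
             CVC Del solvableInO* (λ k → ℕ→ℚ b ^ k)
  solvable b 1≤b {f} (term F P d) reflects =
    decided (CVC Del) (λ k → ℕ→ℚ b ^ k) (F ∘ᶠ prepareᶠ) c (λ i → f i tt)
      (λ i → 3 + ((29 + N i * 12) + eval P (N i) * suc (b ℕ.^ ∣ S i ∣)))
      (λ i → ∘ᶠ-⇓ {F} {prepareᶠ} (prepareᶠ-⇓ i) (d i tt)) reflects
      (λ i → ℕ→ℚ-bound _ b ∣ S i ∣ (c * N i ℕ.^ c) (proj₂ (exponential-bound b 1≤b P) (N i) (size≥1 (encode i)) ∣ S i ∣))
    where
    c : ℕ
    c = proj₁ (exponential-bound b 1≤b P)

splitSolvable : CVC SplitDeletionSet solvableInO* (λ k → ℕ→ℚ 3 ^ k)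
splitSolvable = solvable 3 (s≤s z≤n) solve₁ᵀ λ i → let open CVCInstance i in
  SplitCase.solve₁-reflects G S ℓ ℓ>0
    (Partition.partition-split G S (proj₂ (Partition.split⇒partition G S deletionSet)))
  where
  open Solvability SplitDeletionSet
  open Programs SplitDeletionSet

cliqueSolvable : CVC CliqueDeletionSet solvableInO* (λ k → ℕ→ℚ 2 ^ k)
cliqueSolvable = solvable 2 (s≤s z≤n) solve₃ᵀ λ i → let open CVCInstance i in
  Solutions.CliqueCase.solve₃-reflects G S ℓ deletionSet
  where
  open Solvability CliqueDeletionSet
  open Programs CliqueDeletionSet

-- The reduction from Set Cover

∣++∣ : ∀ {a b} (p : Subset a) (q : Subset b) → ∣ p ++ q ∣ ≡ ∣ p ∣ + ∣ q ∣
∣++∣ []          q = refl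
∣++∣ (false ∷ p) q = ∣++∣ p q
∣++∣ (true ∷ p)  q = cong suc (∣++∣ p q)

-- The incidence graph between the elements of the universe plus a root, which
-- belongs to every set, and the sets.  A singleton set for every element and
-- for the root forces these into every connected vertex cover.
module Incidence {m : ℕ} (F : List (Subset m)) where

  M k : ℕ
  M = suc m
  k = List.length F

  sets : Vec (Subset M) k
  sets = Vec.map (true ∷_) (Vec.fromList F)

  rows : Vec (Subset M) (M + k)
  rows = Vec.map singleton (allFin M) ++ sets

  -- Labels make adjacency a lookup. As the rows may coincide, the vertices of the graph are the
  -- positions in `vertexList`, not the labels.
  Vertex : Set
  Vertex = Fin M ⊎ Subset M

  vertexList : Vec Vertex (M + (M + k))
  vertexList = Vec.map inj₁ (allFin M) ++ Vec.map inj₂ rows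

  incident : Vertex → Vertex → Bool
  incident x y = [ (λ u → [ (λ _ → false) , (λ r → lookup r u) ]′ y)
                 , (λ r → [ (λ u → lookup r u) , (λ _ → false) ]′ y) ]′ x

  incident-sym : ∀ x y → incident x y ≡ incident y x
  incident-sym (inj₁ _) (inj₁ _) = refl
  incident-sym (inj₁ _) (inj₂ _) = refl
  incident-sym (inj₂ _) (inj₁ _) = refl
  incident-sym (inj₂ _) (inj₂ _) = refl

  incident-irrefl : ∀ x → incident x x ≡ false
  incident-irrefl (inj₁ _) = refl
  incident-irrefl (inj₂ _) = refl

  graph : Graph (Fin (M + (M + k)))
  graph = record
    { adj    = λ x y → incident (lookup vertexList x) (lookup vertexList y)
    ; sym    = λ x y → incident-sym (lookup vertexList x) (lookup vertexList y)
    ; irrefl = λ x → incident-irrefl (lookup vertexList x)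
    }

  element : Fin M → Fin (M + (M + k))
  element u = u ↑ˡ (M + k)

  pendant : Fin M → Fin (M + (M + k))
  pendant u = M ↑ʳ (u ↑ˡ k)

  set : Fin k → Fin (M + (M + k))
  set j = M ↑ʳ (M ↑ʳ j)

  data View : Fin (M + (M + k)) → Set where
    isElement : ∀ u → View (element u)
    isPendant : ∀ u → View (pendant u)
    isSet     : ∀ j → View (set j)

  view : ∀ x → View x
  view x with Fin.splitAt M x in eq
  ... | inj₁ u = subst View (Finₚ.splitAt⁻¹-↑ˡ eq) (isElement u)
  ... | inj₂ y = subst View (Finₚ.splitAt⁻¹-↑ʳ {M} eq) view-row
    where
    view-row : View (M ↑ʳ y)
    view-row with Fin.splitAt M y in eq′
    ... | inj₁ u = subst (View ∘ (M ↑ʳ_)) (Finₚ.splitAt⁻¹-↑ˡ eq′) (isPendant u)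
    ... | inj₂ j = subst (View ∘ (M ↑ʳ_)) (Finₚ.splitAt⁻¹-↑ʳ {M} eq′) (isSet j)

  vertex-element : ∀ u → lookup vertexList (element u) ≡ inj₁ u
  vertex-element u = trans (lookup-++ˡ (Vec.map inj₁ (allFin M)) _ u)
    (trans (lookup-map u inj₁ (allFin M)) (cong inj₁ (Vecₚ.lookup-allFin u)))

  vertex-row : ∀ y → lookup vertexList (M ↑ʳ y) ≡ inj₂ (lookup rows y)
  vertex-row y = trans (lookup-++ʳ (Vec.map inj₁ (allFin M)) (Vec.map inj₂ rows) y) (lookup-map y inj₂ rows)

  vertex-pendant : ∀ u → lookup vertexList (pendant u) ≡ inj₂ (singleton u)
  vertex-pendant u = trans (vertex-row (u ↑ˡ k)) (cong inj₂ (trans (lookup-++ˡ (Vec.map singleton (allFin M)) sets u)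
    (trans (lookup-map u singleton (allFin M)) (cong singleton (Vecₚ.lookup-allFin u)))))

  vertex-set : ∀ j → lookup vertexList (set j) ≡ inj₂ (true ∷ List.lookup F j)
  vertex-set j = trans (vertex-row (M ↑ʳ j)) (cong inj₂ (trans (lookup-++ʳ (Vec.map singleton (allFin M)) sets j)
    (trans (lookup-map j (true ∷_) (Vec.fromList F)) (cong (true ∷_) (lookup-fromList F j)))))
    where
    lookup-fromList : ∀ {A : Set} (xs : List A) j → lookup (Vec.fromList xs) j ≡ List.lookup xs j
    lookup-fromList (x ∷ xs) zero    = refl
    lookup-fromList (x ∷ xs) (suc j) = lookup-fromList xs j

  adj-via : ∀ x y {p q} → lookup vertexList x ≡ p → lookup vertexList y ≡ q → Graph.adj graph x y ≡ incident p q
  adj-via _ _ refl refl = refl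

  element-element : ∀ u v → ¬ Adj graph (element u) (element v)
  element-element u v = subst T (adj-via (element u) (element v) (vertex-element u) (vertex-element v))

  row-row : ∀ x y → ¬ Adj graph (M ↑ʳ x) (M ↑ʳ y)
  row-row x y = subst T (adj-via (M ↑ʳ x) (M ↑ʳ y) (vertex-row x) (vertex-row y))

  element-pendant : ∀ u v → Reflects (v ≡ u) (Graph.adj graph (element u) (pendant v))
  element-pendant u v = subst (Reflects (v ≡ u)) (sym (adj-via (element u) (pendant v) (vertex-element u) (vertex-pendant v)))
    (∈-tabulate-reflects {f = λ x → does (v ≟ x)} (≟-reflects v u))

  element-set : ∀ u j → Reflects (u ∈ (true ∷ List.lookup F j)) (Graph.adj graph (element u) (set j))
  element-set u j = subst (Reflects (u ∈ (true ∷ List.lookup F j))) (sym (adj-via (element u) (set j) (vertex-element u) (vertex-set j)))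
    (∈-reflects (true ∷ List.lookup F j) u)

  -- The root, element `zero`, stays outside. This makes the parameter exactly `∣U∣` and leaves the
  -- root as the clique and the rows as the independent set.
  S : Subset (M + (M + k))
  S = (false ∷ Vec.replicate m true) ++ Vec.replicate (M + k) false

  ∣S∣≡m : ∣ S ∣ ≡ m
  ∣S∣≡m = trans (∣++∣ (false ∷ Vec.replicate m true) (Vec.replicate (M + k) false))
    (trans (cong₂ _+_ (Subsetₚ.∣⊤∣≡n m) (Subsetₚ.∣⊥∣≡0 (M + k))) (+-identityʳ m))

  open Reachability graph

  S-split : SplitDeletionSet graph S
  S-split = (λ (x , _) → isRoot x) , clique , independent
    where
    isRoot : Fin (M + (M + k)) → Bool
    isRoot x = does (x ≟ zero)
    clique : ∀ (x y : Σ[ v ∈ _ ] v ∈ ∁ S) → isRoot (proj₁ x) ≡ true → isRoot (proj₁ y) ≡ true → x ≢ y → Adj (induced graph (∁ S)) x y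
    clique (x , x∈) (y , y∈) x≡0 y≡0 x≢y with x ≟ zero | y ≟ zero
    ... | yes refl | yes refl = contradiction (cong (_ ,_) (VecWithK.[]=-irrelevant x∈ y∈)) x≢y
    row : ∀ x → x ∈ ∁ S → isRoot x ≡ false → ∃[ y ] x ≡ M ↑ʳ y
    row x x∈ x≢0 with view x
    ... | isPendant u       = _ , refl
    ... | isSet j           = _ , refl
    ... | isElement (suc u) = contradiction
            (lookup⇒[]= (element (suc u)) S (trans (lookup-++ˡ (Vec.replicate m true) _ u) (lookup-replicate u true)))
            (Subsetₚ.x∈∁p⇒x∉p x∈)
    independent : ∀ (x y : Σ[ v ∈ _ ] v ∈ ∁ S) → isRoot (proj₁ x) ≡ false → isRoot (proj₁ y) ≡ false → ¬ Adj (induced graph (∁ S)) x y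
    independent (x , x∈) (y , y∈) x≢0 y≢0 with row x x∈ x≢0 | row y y∈ y≢0
    ... | a , refl | b , refl = row-row a b

  module _ {ℓ : ℕ} where

    indices : ∀ F′ → (∀ {f} → f List∈.∈ F′ → f List∈.∈ F) →
              ∃[ J ] ∣ J ∣ ≤ List.length F′ × (∀ {f} → f List∈.∈ F′ → ∃[ j ] j ∈ J × List.lookup F j ≡ f)
    indices []       F′⊆F = Subset.⊥ , ≤-reflexive (Subsetₚ.∣⊥∣≡0 k) , λ ()
    indices (f ∷ F′) F′⊆F with indices F′ (F′⊆F ∘ there)
    ... | J , J≤ , covered = J ∪ ⁅ j ⁆ , ≤-trans (∣p∪⁅x⁆∣≤ J j) (s≤s J≤) , λ where
        (here refl) → j , x∈p∪q⁺ (inj₂ (x∈⁅x⁆ j)) , sym (Anyₚ.lookup-index (F′⊆F (here refl)))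
        (there f∈)  → let j , j∈J , eq = covered f∈ in j , x∈p∪q⁺ (inj₁ j∈J) , eq
      where
      j : Fin k
      j = Any.index (F′⊆F (here refl))

    ⋃-∈ : ∀ (F′ : List (Subset m)) {u} → u ∈ ⋃ F′ → ∃[ f ] f List∈.∈ F′ × u ∈ f
    ⋃-∈ []       u∈ = contradiction u∈ Subsetₚ.∉⊥
    ⋃-∈ (f ∷ F′) u∈ with x∈p∪q⁻ f (⋃ F′) u∈
    ... | inj₁ u∈f = f , here refl , u∈f
    ... | inj₂ u∈F′ = let g , g∈ , u∈g = ⋃-∈ F′ u∈F′ in g , there g∈ , u∈g

    ∈-⋃ : ∀ (F′ : List (Subset m)) {u f} → f List∈.∈ F′ → u ∈ f → u ∈ ⋃ F′
    ∈-⋃ (f ∷ F′) (here refl) u∈f = x∈p∪q⁺ (inj₁ u∈f)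
    ∈-⋃ (g ∷ F′) (there f∈) u∈f  = x∈p∪q⁺ (inj₂ (∈-⋃ F′ f∈ u∈f))

    Cover : Set
    Cover = ∃[ F′ ] (∀ {f} → f List∈.∈ F′ → f List∈.∈ F) × List.length F′ ≤ ℓ × ⋃ F′ ≡ Subset.⊤

    -- All elements, the root and the chosen sets. Every edge ends at an element or the root; each
    -- element lies in a chosen set, and each set contains the root.
    cover⇒solution : Cover → Solutions.Solution graph S (M + ℓ)
    cover⇒solution (F′ , F′⊆F , F′≤ℓ , ⋃F′≡⊤) with indices F′ F′⊆F
    ... | J , J≤ , covered = X , (X-covers , Path⇒connected X λ x∈X y∈X → to-root x∈X ◅◅ Path-reverse y∈X (to-root y∈X)) , X≤
      where
      X : Subset (M + (M + k))
      X = Subset.⊤ {M} ++ (Subset.⊥ {M} ++ J)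
      X≤ : ∣ X ∣ ≤ M + ℓ
      X≤ = begin
        ∣ X ∣                                                ≡⟨ ∣++∣ {M} Subset.⊤ (Subset.⊥ ++ J) ⟩
        ∣ Subset.⊤ {M} ∣ + ∣ Subset.⊥ {M} ++ J ∣            ≡⟨ cong₂ _+_ (Subsetₚ.∣⊤∣≡n M) (trans (∣++∣ {M} Subset.⊥ J) (cong (_+ ∣ J ∣) (Subsetₚ.∣⊥∣≡0 M))) ⟩
        M + ∣ J ∣                                           ≤⟨ +-monoʳ-≤ M (≤-trans J≤ F′≤ℓ) ⟩
        M + ℓ                                               ∎
        where open ℕₚ.≤-Reasoning
      element∈X : ∀ u → element u ∈ X
      element∈X u = lookup⇒[]= (element u) X (trans (lookup-++ˡ Subset.⊤ _ u) (lookup-replicate u true))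
      set∈X : ∀ {j} → j ∈ J → set j ∈ X
      set∈X {j} j∈J = lookup⇒[]= (set j) X (trans (lookup-++ʳ {m = M} Subset.⊤ (Subset.⊥ ++ J) (M ↑ʳ j))
        (trans (lookup-++ʳ {m = M} Subset.⊥ J j) ([]=⇒lookup j∈J)))
      pendant∉X : ∀ {u} → pendant u ∉ X
      pendant∉X {u} p∈X with trans (sym ([]=⇒lookup p∈X)) (trans (lookup-++ʳ {m = M} Subset.⊤ (Subset.⊥ ++ J) (u ↑ˡ k))
        (trans (lookup-++ˡ {m = M} Subset.⊥ J u) (lookup-replicate u false)))
      ... | ()
      set-root : ∀ j → Adj graph (set j) (element zero)
      set-root j = Adj-sym {element zero} {set j} (from (element-set zero j) Vec.here)
      X-covers : VertexCover graph X
      X-covers x y e with view x | view y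
      ... | isElement u | _           = inj₁ (element∈X u)
      ... | isPendant _ | isElement v = inj₂ (element∈X v)
      ... | isSet _     | isElement v = inj₂ (element∈X v)
      ... | isPendant u | isPendant v = contradiction e (row-row (u ↑ˡ k) (v ↑ˡ k))
      ... | isPendant u | isSet j     = contradiction e (row-row (u ↑ˡ k) (M ↑ʳ j))
      ... | isSet j     | isPendant v = contradiction e (row-row (M ↑ʳ j) (v ↑ˡ k))
      ... | isSet i     | isSet j     = contradiction e (row-row (M ↑ʳ i) (M ↑ʳ j))
      to-root : ∀ {x} → x ∈ X → Path X x (element zero)
      to-root {x} x∈X with view x
      ... | isPendant u       = contradiction x∈X pendant∉X
      ... | isSet j           = (set-root j , element∈X zero) ◅ ε
      ... | isElement zero    = ε
      ... | isElement (suc u) with ⋃-∈ F′ (subst (u ∈_) (sym ⋃F′≡⊤) Subsetₚ.∈⊤)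
      ...   | f , f∈F′ , u∈f with covered f∈F′
      ...     | j , j∈J , refl = (from (element-set (suc u) j) (Vec.there u∈f) , set∈X j∈J) ◅ (set-root j , element∈X zero) ◅ ε

    selected : ∀ (G : List (Subset m)) → Subset (List.length G) → List (Subset m)
    selected []      []          = []
    selected (f ∷ G) (false ∷ J) = selected G J
    selected (f ∷ G) (true ∷ J)  = f ∷ selected G J

    length-selected : ∀ G J → List.length (selected G J) ≡ ∣ J ∣
    length-selected []      []          = refl
    length-selected (f ∷ G) (false ∷ J) = length-selected G J
    length-selected (f ∷ G) (true ∷ J)  = cong suc (length-selected G J)

    selected-⊆ : ∀ G J {f} → f List∈.∈ selected G J → f List∈.∈ G
    selected-⊆ []      []          ()
    selected-⊆ (g ∷ G) (false ∷ J) f∈          = there (selected-⊆ G J f∈)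
    selected-⊆ (g ∷ G) (true ∷ J)  (here refl) = here refl
    selected-⊆ (g ∷ G) (true ∷ J)  (there f∈)  = there (selected-⊆ G J f∈)

    ∈-selected : ∀ G J {j} → j ∈ J → List.lookup G j List∈.∈ selected G J
    ∈-selected (g ∷ G) (true ∷ J)  Vec.here        = here refl
    ∈-selected (g ∷ G) (false ∷ J) (Vec.there j∈J) = ∈-selected G J j∈J
    ∈-selected (g ∷ G) (true ∷ J)  (Vec.there j∈J) = there (∈-selected G J j∈J)

    module _ (X : Subset (M + (M + k))) (X-covers : VertexCover graph X)
             (paths : ∀ {x y} → x ∈ X → y ∈ X → Path X x y) where

      covered-by : ∀ u → element u ∈ X ⊎ pendant u ∈ X
      covered-by u = X-covers (element u) (pendant u) (from (element-pendant u u) refl)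

      from-pendant : ∀ u {x} → Adj graph (pendant u) x → x ≡ element u
      from-pendant u {x} e with view x
      ... | isElement v = cong element (sym (to (element-pendant v u) (Adj-sym {pendant u} {element v} e)))
      ... | isPendant v = contradiction e (row-row (u ↑ˡ k) (v ↑ˡ k))
      ... | isSet j     = contradiction e (row-row (u ↑ˡ k) (M ↑ʳ j))

      pendant≢element : ∀ u v → pendant u ≢ element v
      pendant≢element u v eq with trans (sym (vertex-pendant u)) (trans (cong (lookup vertexList) eq) (vertex-element v))
      ... | ()

      other : ∀ {u v} → u ≢ v → ∃[ y ] y ∈ X × pendant u ≢ y
      other {u} {v} u≢v with covered-by v
      ... | inj₁ v∈X = element v , v∈X , pendant≢element u v
      ... | inj₂ p∈X = pendant v , p∈X , λ eq → u≢v (Finₚ.↑ˡ-injective k u v (Finₚ.↑ʳ-injective M _ _ eq))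

      -- If the edge to the pendant were covered by the pendant, its path to another vertex of `X`
      -- would start with its only neighbour, the element. The second element `v` provides that
      -- other vertex.
      element∈ : ∀ {u v} → u ≢ v → element u ∈ X
      element∈ {u} u≢v with covered-by u
      ... | inj₁ u∈X = u∈X
      ... | inj₂ p∈X with other u≢v
      ...   | y , y∈X , p≢y with paths p∈X y∈X
      ...     | ε = contradiction refl p≢y
      ...     | (e , z∈X) ◅ _ = subst (_∈ X) (from-pendant u e) z∈X

      Covering : Fin m → Set
      Covering u = ∃[ j ] set j ∈ X × u ∈ List.lookup F j

      drop-root : ∀ {u j} → suc u ∈ (true ∷ List.lookup F j) → u ∈ List.lookup F j
      drop-root (Vec.there u∈) = u∈

      -- The path to the root can only alternate between the element and its pendant until it enters
      -- a set. That set belongs to `X` and contains the element.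
      escape : ∀ u {x} → x ≡ element (suc u) ⊎ x ≡ pendant (suc u) → Path X x (element zero) → Covering u
      escape u (inj₁ eq) ε with Finₚ.↑ˡ-injective (M + k) zero (suc u) eq
      ... | ()
      escape u (inj₂ eq) ε = contradiction (sym eq) (pendant≢element (suc u) zero)
      escape u (inj₂ refl) ((e , _) ◅ p) = escape u (inj₁ (from-pendant (suc u) e)) p
      escape u (inj₁ refl) (_◅_ {j = y} (e , y∈X) p) with view y
      ... | isElement v = contradiction e (element-element (suc u) v)
      ... | isPendant v = escape u (inj₂ (cong pendant (to (element-pendant (suc u) v) e))) p
      ... | isSet j     = j , y∈X , drop-root (to (element-set (suc u) j) e)

    solution⇒cover : Solutions.Solution graph S (M + ℓ) → Cover
    solution⇒cover (X , (X-covers , conn) , X≤) with inhabited? m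
      where
      inhabited? : ∀ m → Fin m ⊎ ¬ Fin m
      inhabited? zero    = inj₂ λ ()
      inhabited? (suc _) = inj₁ zero
    -- An empty universe is covered by the empty family. The case is separate because `element∈`
    -- asks for an element besides the root.
    ... | inj₂ ¬u = [] , (λ ()) , z≤n , Subsetₚ.⊆-antisym (λ _ → Subsetₚ.∈⊤) (λ {u} _ → contradiction u ¬u)
    ... | inj₁ u₀ with Vec.splitAt M X
    ...   | P , Q , refl with Vec.splitAt M Q
    ...     | A , J , refl = selected F J , selected-⊆ F J ,
              ≤-trans (≤-reflexive (length-selected F J)) J≤ℓ ,
              Subsetₚ.⊆-antisym (λ _ → Subsetₚ.∈⊤) (λ {u} _ → covered u)
      where
      X′ : Subset (M + (M + k))
      X′ = P ++ (A ++ J)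
      paths : ∀ {x y} → x ∈ X′ → y ∈ X′ → Path X′ x y
      paths = connected⇒Path X′ conn
      element∈X : ∀ u → element u ∈ X′
      element∈X zero    = element∈ X′ X-covers paths {zero} {suc u₀} λ ()
      element∈X (suc u) = element∈ X′ X-covers paths {suc u} {zero} λ ()
      covered : ∀ u → u ∈ ⋃ (selected F J)
      covered u with escape X′ X-covers paths u (inj₁ refl) (paths (element∈X (suc u)) (element∈X zero))
      ... | j , j∈X , u∈f = ∈-⋃ (selected F J) (∈-selected F J j∈J) u∈f
        where
        j∈J : j ∈ J
        j∈J = lookup⇒[]= j J (trans (sym (lookup-++ʳ A J j))
          (trans (sym (lookup-++ʳ P (A ++ J) (M ↑ʳ j))) ([]=⇒lookup j∈X)))
      ⊤⊆P : Subset.⊤ ⊆ P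
      ⊤⊆P {u} _ = lookup⇒[]= u P (trans (sym (lookup-++ˡ P (A ++ J) u)) ([]=⇒lookup (element∈X u)))
      J≤ℓ : ∣ J ∣ ≤ ℓ
      J≤ℓ = ℕₚ.+-cancelˡ-≤ M ∣ J ∣ ℓ (begin
        M + ∣ J ∣                     ≡⟨ cong (_+ ∣ J ∣) (Subsetₚ.∣⊤∣≡n M) ⟨
        ∣ Subset.⊤ {M} ∣ + ∣ J ∣     ≤⟨ +-mono-≤ (p⊆q⇒∣p∣≤∣q∣ ⊤⊆P) (m≤n+m ∣ J ∣ ∣ A ∣) ⟩
        ∣ P ∣ + (∣ A ∣ + ∣ J ∣)       ≡⟨ trans (∣++∣ P (A ++ J)) (cong (_+_ ∣ P ∣) (∣++∣ A J)) ⟨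
        ∣ X′ ∣                        ≤⟨ X≤ ⟩
        M + ℓ                         ∎)
        where open ℕₚ.≤-Reasoning

-- Programs for the reduction

case-body : Body
case-body _ f g =
  case (var 0F) nil
    (case (var 1F) nil
      (case (var 0F)
        (call f (cons (var 2F) (var 1F)))
        (call g (cons (var 4F) (var 3F)))))

caseᶠ : Fn → Fn → Fn
caseᶠ F G = link case-body F G

module _ {F G : Fn} where
  open Link F G

  caseᶠ-left : ∀ {γ x y b} → F ▹ cons γ x ⇓ y ⟨ b ⟩ → caseᶠ F G ▹ cons γ (cons nil x) ⇓ y ⟨ 10 + b ⟩
  caseᶠ-left d = ⇓case-cons (⇓var 0F) (⇓case-cons (⇓var _) (⇓case-nil (⇓var _)
    (⇓call (⇓cons (⇓var _) (⇓var _)) (⇓left case-body d))))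

  caseᶠ-right : ∀ {γ x y b} → G ▹ cons γ x ⇓ y ⟨ b ⟩ → caseᶠ F G ▹ cons γ (cons (cons nil nil) x) ⇓ y ⟨ 10 + b ⟩
  caseᶠ-right d = ⇓case-cons (⇓var 0F) (⇓case-cons (⇓var _) (⇓case-cons (⇓var _)
    (⇓call (⇓cons (⇓var _) (⇓var _)) (⇓right case-body d))))

size-Vec≤ : ∀ {A : Set} (e : A → Tree) b → (∀ x → size (e x) ≤ b) → ∀ {k} (xs : Vec A k) → size (⌜ e ⌝ⱽ xs) ≤ 1 + k * (1 + b)
size-Vec≤ e b e≤ []               = ≤-refl
size-Vec≤ e b e≤ {suc k} (x ∷ xs) = s≤s (≤-trans (+-mono-≤ (e≤ x) (size-Vec≤ e b e≤ xs))
  (≤-reflexive (+-suc b (k * (1 + b)))))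

size-Bool : ∀ b → size ⌜ b ⌝ᴮ ≤ 3
size-Bool false = s≤s z≤n
size-Bool true  = ≤-refl

digits-+ : ∀ k l → digits (fromℕ (k + l)) ≤ k + digits (fromℕ l)
digits-+ zero    l = ≤-refl
digits-+ (suc k) l = ≤-trans (≤-reflexive (cong digits (fromℕ-suc (k + l))))
  (≤-trans (digits-suc (fromℕ (k + l))) (s≤s (digits-+ k l)))

-- One successor per list entry: the summand added to `ℓ` is the length of the list of elements and
-- root.
addᶠ : Fn
addᶠ = foldrᶠ (sucᶠ ∘ᶠ sndᶠ)

addᶠ-⇓ : ∀ {A : Set} (e : A → Tree) {γ} l D {k} (xs : Vec A k) → k + digits (fromℕ l) ≤ D →
         addᶠ ▹ cons γ (cons ⌜ l ⌝ᴺ (⌜ e ⌝ⱽ xs)) ⇓ ⌜ k + l ⌝ᴺ ⟨ 7 + k * (33 + D * 40) ⟩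
addᶠ-⇓ e l D []               k≤ = foldrᶠ-nil {sucᶠ ∘ᶠ sndᶠ}
addᶠ-⇓ e l D {suc k} (x ∷ xs) k≤ = ⇓-mono bound≤ (⇓-result (cong ⌜_⌝ᵇ (sym (fromℕ-suc (k + l))))
  (foldrᶠ-cons {sucᶠ ∘ᶠ sndᶠ} (addᶠ-⇓ e l D xs (≤-trans (n≤1+n _) k≤))
    (∘ᶠ-⇓ {sucᶠ} {sndᶠ} sndᶠ-⇓ (sucᶠ-⇓ (fromℕ (k + l))))))
  where
  open ℕₚ.≤-Reasoning
  short : size ⌜ k + l ⌝ᴺ ≤ 1 + D * 4
  short = ≤-trans (size≤digits (fromℕ (k + l)))
    (+-monoʳ-≤ 1 (*-monoˡ-≤ 4 (≤-trans (digits-+ k l) (≤-trans (n≤1+n _) k≤))))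
  arith : ∀ r d → 17 + ((7 + r) + (3 + (3 + (1 + d * 4) * 10))) ≡ 7 + ((33 + d * 40) + r)
  arith = solve-∀
  bound≤ : 17 + ((7 + k * (33 + D * 40)) + (3 + (3 + size ⌜ k + l ⌝ᴺ * 10))) ≤ 7 + ((33 + D * 40) + k * (33 + D * 40))
  bound≤ = begin
    17 + ((7 + k * (33 + D * 40)) + (3 + (3 + size ⌜ k + l ⌝ᴺ * 10)))
      ≤⟨ +-monoʳ-≤ 17 (+-monoʳ-≤ (7 + k * (33 + D * 40)) (+-monoʳ-≤ 6 (*-monoˡ-≤ 10 short))) ⟩
    17 + ((7 + k * (33 + D * 40)) + (3 + (3 + (1 + D * 4) * 10)))
      ≡⟨ arith (k * (33 + D * 40)) D ⟩
    7 + ((33 + D * 40) + k * (33 + D * 40)) ∎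

module Reduction where
  open SetCoverInstance

  encode : SetCoverInstance → Tree
  encode = Problem.encode SetCover

  N : SetCoverInstance → ℕ
  N i = size (encode i)

  elements : SetCoverInstance → Tree
  elements i = ⌜ (λ x → ⌜ toℕ x ⌝ᵁ) ⌝ⱽ (allFin (suc (m i)))

  open Language SetCoverInstance N (λ i → cons (elements i) (encode i))

  instance
    rooted-𝟙 : Rooted 𝟙
    rooted-𝟙 = here

    rooted-⊗ : ∀ {Γ A} → ⦃ Rooted Γ ⦄ → Rooted (Γ ⊗ A)
    rooted-⊗ ⦃ r ⦄ = there r

  module In (i : SetCoverInstance) = Incidence (F i)

  universe : ∀ k → ⌜ (λ _ → nil) ⌝ⱽ (Vec.replicate k tt) ≡ ⌜ List.replicate k nil ⌝ᴸ
  universe zero    = refl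
  universe (suc k) = cong (cons nil) (universe k)

  -- The universe is listed in the input, and the outer `cons` pays for the root.
  m<N : ∀ i → suc (m i) ≤ N i
  m<N i = s≤s (≤-trans (size-Vec (λ _ → nil) (Vec.replicate (m i) tt))
    (≤-trans (≤-reflexive (cong size (universe (m i)))) (m≤m+n _ _)))

  family : ∀ i → ⌜ ⌜_⌝ˢ ⌝ⱽ (Vec.fromList (F i)) ≡ ⌜ List.map ⌜_⌝ˢ (F i) ⌝ᴸ
  family i = cong (λ xs → ⌜ List.map ⌜_⌝ˢ xs ⌝ᴸ) (Vecₚ.toList∘fromList (F i))

  k≤N : ∀ i → List.length (F i) ≤ N i
  k≤N i = ≤-trans (size-Vec ⌜_⌝ˢ (Vec.fromList (F i))) (≤-trans (≤-reflexive (cong size (family i)))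
    (≤-trans (m≤m+n _ _) (≤-trans (n≤1+n _)
      (≤-trans (m≤n+m _ (size ⌜ List.replicate (m i) nil ⌝ᴸ)) (n≤1+n _)))))

  digits-ℓ : ∀ i → digits (fromℕ (ℓ i)) ≤ N i
  digits-ℓ i = ≤-trans (digits≤size (fromℕ (ℓ i))) (≤-trans (m≤n+m _ (size ⌜ List.map ⌜_⌝ˢ (F i) ⌝ᴸ))
    (≤-trans (n≤1+n _) (≤-trans (m≤n+m _ (size ⌜ List.replicate (m i) nil ⌝ᴸ)) (n≤1+n _))))

  𝕞 𝕄 𝕂 : Length
  𝕞 = record { len = m ; bound = 𝕏 ; len≤ = λ i → ≤-trans (n≤1+n _) (m<N i) }
  𝕄 = record { len = λ i → suc (m i) ; bound = 𝕏 ; len≤ = m<N }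
  𝕂 = record { len = λ i → List.length (F i) ; bound = 𝕏 ; len≤ = k≤N }

  _+ᴸ_ : Length → Length → Length
  L +ᴸ L′ = record
    { len   = λ i → len L i + len L′ i
    ; bound = Length.bound L :+ Length.bound L′
    ; len≤  = λ i → +-mono-≤ (Length.len≤ L i) (Length.len≤ L′ i)
    }

  𝕋ot : Length
  𝕋ot = 𝕄 +ᴸ (𝕄 +ᴸ 𝕂)

  rangeᵀ : Poly 𝟙 (vec (fin 𝕄) 𝕄) (λ i _ → allFin (suc (m i)))
  rangeᵀ = simple fstᶠ (# 3) λ _ _ → fstᶠ-⇓

  open Loops 𝕄 rangeᵀ

  familyᵀ : Poly 𝟙 (vec (vec 𝔹 𝕞) 𝕂) (λ i _ → Vec.fromList (F i))
  familyᵀ = simple (fstᶠ ∘ᶠ (sndᶠ ∘ᶠ sndᶠ)) (# 15) λ i _ → ⇓-result (sym (family i))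
    (∘ᶠ-⇓ {fstᶠ} {sndᶠ ∘ᶠ sndᶠ} (∘ᶠ-⇓ {sndᶠ} {sndᶠ} sndᶠ-⇓ sndᶠ-⇓) fstᶠ-⇓)

  num : Ty
  num = coded (λ _ → ℕ) ⌜_⌝ᴺ

  ℓ′ᵀ : Poly 𝟙 num (λ i _ → suc (m i) + ℓ i)
  ℓ′ᵀ = simple (addᶠ ∘ᶠ (idᶠ ,ᶠ ((sndᶠ ∘ᶠ (sndᶠ ∘ᶠ sndᶠ)) ,ᶠ fstᶠ)))
    (# 39 :+ 𝕏 :* (# 33 :+ (𝕏 :+ 𝕏) :* # 40)) λ i _ →
    ⇓-mono (+-monoʳ-≤ 39 (*-monoˡ-≤ (33 + (N i + N i) * 40) (m<N i)))
    (∘ᶠ-⇓ {addᶠ} {idᶠ ,ᶠ ((sndᶠ ∘ᶠ (sndᶠ ∘ᶠ sndᶠ)) ,ᶠ fstᶠ)}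
      (,ᶠ-⇓ {idᶠ} {(sndᶠ ∘ᶠ (sndᶠ ∘ᶠ sndᶠ)) ,ᶠ fstᶠ} idᶠ-⇓
        (,ᶠ-⇓ {sndᶠ ∘ᶠ (sndᶠ ∘ᶠ sndᶠ)} {fstᶠ}
          (∘ᶠ-⇓ {sndᶠ} {sndᶠ ∘ᶠ sndᶠ} (∘ᶠ-⇓ {sndᶠ} {sndᶠ} sndᶠ-⇓ sndᶠ-⇓) sndᶠ-⇓) fstᶠ-⇓))
      (addᶠ-⇓ (λ x → ⌜ toℕ x ⌝ᵁ) (ℓ i) (N i + N i) (allFin (suc (m i))) (+-mono-≤ (m<N i) (digits-ℓ i))))

  appendᵀ : ∀ {A} L L′ → Poly (vec A L ⊗ vec A L′) (vec A (L +ᴸ L′)) (λ i p → proj₁ p ++ proj₂ p)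
  appendᵀ {A} L L′ = simple (foldrᶠ ((sndᶠ ∘ᶠ fstᶠ) ,ᶠ sndᶠ) ∘ᶠ (constᶠ nil ,ᶠ (sndᶠ ,ᶠ fstᶠ)))
    (# 27 :+ Length.bound L :* # 34) λ i (xs , ys) →
    ⇓-mono (+-monoʳ-≤ 27 (*-monoˡ-≤ 34 (Length.len≤ L i)))
      (∘ᶠ-⇓ {foldrᶠ ((sndᶠ ∘ᶠ fstᶠ) ,ᶠ sndᶠ)} {constᶠ nil ,ᶠ (sndᶠ ,ᶠ fstᶠ)}
        (,ᶠ-⇓ {constᶠ nil} {sndᶠ ,ᶠ fstᶠ} (constᶠ-⇓ nil) (,ᶠ-⇓ {sndᶠ} {fstᶠ} sndᶠ-⇓ fstᶠ-⇓))
        (foldrᶠ-Vec {(sndᶠ ∘ᶠ fstᶠ) ,ᶠ sndᶠ} (enc A) (λ zs → ⌜ enc A ⌝ⱽ (zs ++ ys))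
          (λ x zs → ,ᶠ-⇓ {sndᶠ ∘ᶠ fstᶠ} {sndᶠ} (∘ᶠ-⇓ {sndᶠ} {fstᶠ} fstᶠ-⇓ sndᶠ-⇓) sndᶠ-⇓) xs))

  tag : Tree → Ty
  tag t = coded (λ _ → Unit) (λ _ → t)

  module _ {Γ : Ty} {w : Weight Γ} where

    inj₁ᵀ : ∀ {A B f} → Term Γ w A f → Term Γ w (A ⊕ B) (λ i γ → inj₁ (f i γ))
    inj₁ᵀ t = recode {A = tag nil ⊗ _} (λ _ p → inj₁ (proj₂ p)) (λ _ _ → refl) (constᵀ {A = tag nil} _ nil (λ _ _ → refl) ,ᵀ t)

    inj₂ᵀ : ∀ {A B f} → Term Γ w B f → Term Γ w (A ⊕ B) (λ i γ → inj₂ (f i γ))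
    inj₂ᵀ t = recode {A = tag (cons nil nil) ⊗ _} (λ _ p → inj₂ (proj₂ p)) (λ _ _ → refl)
                (constᵀ {A = tag (cons nil nil)} _ (cons nil nil) (λ _ _ → refl) ,ᵀ t)

  caseᵀ : ∀ {Γ A B C f g} → Poly (Γ ⊗ A) C f → Poly (Γ ⊗ B) C g →
          Poly (Γ ⊗ (A ⊕ B)) C (λ i p → [ (λ a → f i (proj₁ p , a)) , (λ b → g i (proj₁ p , b)) ]′ (proj₂ p))
  caseᵀ {Γ} {A} {B} {C} {f} {g} (term F P d) (term G Q e) = term (caseᶠ F G) (# 10 :+ (P :+ Q)) cases
    where
    cases : ∀ i p → caseᶠ F G ▹ enc (Γ ⊗ (A ⊕ B)) p ⇓
            enc C ([ (λ a → f i (proj₁ p , a)) , (λ b → g i (proj₁ p , b)) ]′ (proj₂ p)) ⟨ (10 + (eval P (N i) + eval Q (N i))) * 1 ⟩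
    cases i (γ , inj₁ a) = ⇓-mono (≤-trans (absorb 10 (eval P (N i)) 0) (*-monoˡ-≤ 1 (+-monoʳ-≤ 10 (m≤m+n (eval P (N i)) (eval Q (N i))))))
                                  (caseᶠ-left {F} {G} (d i (γ , a)))
    cases i (γ , inj₂ b) = ⇓-mono (≤-trans (absorb 10 (eval Q (N i)) 0) (*-monoˡ-≤ 1 (+-monoʳ-≤ 10 (m≤n+m (eval Q (N i)) (eval P (N i))))))
                                  (caseᶠ-right {F} {G} (e i (γ , b)))

  row vertex : Ty
  row    = vec 𝔹 𝕄
  vertex = fin 𝕄 ⊕ row

  rowsᵀ : Poly 𝟙 (vec row (𝕄 +ᴸ 𝕂)) (λ i _ → In.rows i)
  rowsᵀ = appendᵀ 𝕄 𝕂 $ᵀ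
    (mapᵀ rangeᵀ (tabulateᵀ (equalᵀ v1 v0)) ,ᵀ
     mapᵀ familyᵀ (recode {A = 𝔹 ⊗ vec 𝔹 𝕞} {B = row} (λ _ p → proj₁ p ∷ proj₂ p) (λ _ _ → refl) (trueᵀ ,ᵀ v0)))

  verticesᵀ : Poly 𝟙 (vec vertex 𝕋ot) (λ i _ → In.vertexList i)
  verticesᵀ = appendᵀ 𝕄 (𝕄 +ᴸ 𝕂) $ᵀ (mapᵀ rangeᵀ (inj₁ᵀ v0) ,ᵀ mapᵀ rowsᵀ (inj₂ᵀ v0))

  incidentᵀ : Poly ((𝟙 ⊗ vertex) ⊗ vertex) 𝔹 (λ i ((_ , x) , y) → In.incident i x y)
  incidentᵀ = caseᵀ {Γ = 𝟙 ⊗ vertex} (caseᵀ {Γ = 𝟙 ⊗ fin 𝕄} falseᵀ (lookupᵀ v0 v1) $ᵀ (rootᵀ ,ᵀ v0 ,ᵀ v1))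
                                     (caseᵀ {Γ = 𝟙 ⊗ row} (lookupᵀ v1 v0) falseᵀ $ᵀ (rootᵀ ,ᵀ v0 ,ᵀ v1))
              $ᵀ (rootᵀ ,ᵀ v0 ,ᵀ v1)

  matrixᵀ : Poly (𝟙 ⊗ vec vertex 𝕋ot) (vec (vec 𝔹 𝕋ot) 𝕋ot)
            (λ i (_ , vs) → Vec.map (λ x → Vec.map (In.incident i x) vs) vs)
  matrixᵀ = mapᵀ v0 (mapᵀ v1 (incidentᵀ $ᵀ (rootᵀ ,ᵀ v1 ,ᵀ v0)))

  inS : ∀ i → In.Vertex i → Bool
  inS i x = [ (λ u → not (does (u ≟ zero))) , (λ _ → false) ]′ x

  inSᵀ : Poly (𝟙 ⊗ vertex) 𝔹 (λ i γ → inS i (proj₂ γ))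
  inSᵀ = caseᵀ {Γ = 𝟙} (notᵀ (equalᵀ v0 (constᵀ {A = fin 𝕄} (λ _ _ → zero) nil (λ _ _ → refl)))) falseᵀ

  S≡ : ∀ i → Vec.map (inS i) (In.vertexList i) ≡ In.S i
  S≡ i = trans (Vecₚ.map-++ (inS i) (Vec.map inj₁ (allFin (In.M i))) (Vec.map inj₂ (In.rows i)))
    (cong₂ _++_ (cong (false ∷_) (constant true (λ x → inS i x) (Vec.map inj₁ (Vec.tabulate suc)) nonzero))
                (constant false (λ x → inS i x) (Vec.map inj₂ (In.rows i)) row∉S))
    where
    constant : ∀ {A : Set} b (f : A → Bool) {k} (xs : Vec A k) → (∀ j → f (lookup xs j) ≡ b) → Vec.map f xs ≡ Vec.replicate k b
    constant b f []       eq = refl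
    constant b f (x ∷ xs) eq = cong₂ _∷_ (eq zero) (constant b f xs (eq ∘ suc))
    nonzero : ∀ j → inS i (lookup (Vec.map inj₁ (Vec.tabulate suc)) j) ≡ true
    nonzero j = cong (inS i) {_} {inj₁ (suc j)} (trans (lookup-map j inj₁ (Vec.tabulate suc)) (cong inj₁ (lookup∘tabulate suc j)))
    row∉S : ∀ j → inS i (lookup (Vec.map inj₂ (In.rows i)) j) ≡ false
    row∉S j = cong (inS i) {_} {inj₂ (lookup (In.rows i) j)} (lookup-map j inj₂ (In.rows i))

  matrix≡ : ∀ i → Vec.map (λ x → Vec.map (In.incident i x) (In.vertexList i)) (In.vertexList i) ≡ adjacencyMatrix (In.graph i)
  matrix≡ i = sym (trans (Vecₚ.tabulate-cong (λ x → rows≡ (In.incident i (lookup (In.vertexList i) x))))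
                         (rows≡ (λ x → Vec.map (In.incident i x) (In.vertexList i))))
    where
    rows≡ : ∀ {A : Set} (f : In.Vertex i → A) → Vec.tabulate (λ y → f (lookup (In.vertexList i) y)) ≡ Vec.map f (In.vertexList i)
    rows≡ f = trans (Vecₚ.tabulate-∘ f (lookup (In.vertexList i))) (cong (Vec.map f) (Vecₚ.tabulate∘lookup (In.vertexList i)))

  reduced : SetCoverInstance → CVCInstance SplitDeletionSet
  reduced i = record
    { n = In.M i + (In.M i + In.k i) ; G = In.graph i ; S = In.S i ; deletionSet = In.S-split i
    ; ℓ = In.M i + ℓ i ; ℓ>0 = s≤s z≤n }

  reducedᵀ : Poly 𝟙 (vec (vec 𝔹 𝕋ot) 𝕋ot ⊗ (vec 𝔹 𝕋ot ⊗ num))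
             (λ i _ → adjacencyMatrix (In.graph i) , (In.S i , In.M i + ℓ i))
  reducedᵀ = congᵀ (λ i _ → matrix≡ i) (matrixᵀ $ᵀ (rootᵀ ,ᵀ verticesᵀ)) ,ᵀ
             (congᵀ (λ i _ → S≡ i) (mapᵀ verticesᵀ inSᵀ) ,ᵀ ℓ′ᵀ)

-- Transferring a running time along the reduction

fromProgram : Program → Fn
fromProgram P = fn (mapCalls suc (Program.main P) ∷ Vec.map (mapCalls suc) (Program.functions P))

fromProgram-⇓ : ∀ P {x y t} → P on-input x returns y in-steps t → fromProgram P ▹ x ⇓ y ⟨ t ⟩
fromProgram-⇓ P {t = t} d = t , ≤-refl ,
  mapCalls-⇓ suc (λ f → lookup-map f (mapCalls suc) (Program.functions P)) d

_:^_ : Bound → ℕ → Bound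
P :^ zero  = # 1
P :^ suc c = P :* P :^ c

eval-:^ : ∀ P c m → eval (P :^ c) m ≡ eval P m ℕ.^ c
eval-:^ P zero    m = refl
eval-:^ P (suc c) m = cong (eval P m *_) (eval-:^ P c m)

-- The summands bound the adjacency matrix, the deletion set and `ℓ`. The factor 4 is a digit or
-- truth value of size at most 3 plus its list cell.
outputBound : ℕ → ℕ → ℕ
outputBound v d = 2 + ((1 + v * (1 + (1 + v * 4))) + ((1 + v * 4) + (1 + d * 4)))

outputBound-mono : ∀ {v v′ d d′} → v ≤ v′ → d ≤ d′ → outputBound v d ≤ outputBound v′ d′
outputBound-mono v≤ d≤ = +-monoʳ-≤ 2 (+-mono-≤
  (+-monoʳ-≤ 1 (*-mono-≤ v≤ (+-monoʳ-≤ 2 (*-monoˡ-≤ 4 v≤))))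
  (+-mono-≤ (+-monoʳ-≤ 1 (*-monoˡ-≤ 4 v≤)) (+-monoʳ-≤ 1 (*-monoˡ-≤ 4 d≤))))

size-instance : ∀ {Del : ∀ {n} → Graph (Fin n) → Subset n → Set} (x : CVCInstance Del) →
                size (Problem.encode (CVC Del) x) ≤
                outputBound (CVCInstance.n x) (digits (fromℕ (CVCInstance.ℓ x)))
size-instance x = ≤-trans
  (s≤s (+-mono-≤ (size-Vec≤ ⌜_⌝ˢ (1 + n * 4) (λ (r : Subset n) → size-Vec≤ ⌜_⌝ᴮ 3 size-Bool r) (adjacencyMatrix G))
    (s≤s (+-mono-≤ (size-Vec≤ ⌜_⌝ᴮ 3 size-Bool S) (size≤digits (fromℕ ℓ))))))
  (≤-reflexive (arith (1 + n * (1 + (1 + n * 4))) _))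
  where
  open CVCInstance x
  arith : ∀ a b → suc (a + suc b) ≡ 2 + (a + b)
  arith = solve-∀

ℕ→ℚ-nonNeg : ∀ m → ℚ.NonNegative (ℕ→ℚ m)
ℕ→ℚ-nonNeg m = ℚ.nonNegative (ℕ→ℚ-mono {0} {m} z≤n)

-- The time `A` of the reduction has no exponential factor of its own; `1 ≤ r` allows multiplying it
-- by one.
ratio-bound : ∀ {r s : ℚ} A t C D → 1ℚ ℚ.≤ r → s ℚ.≤ r → ℕ→ℚ t ℚ.≤ s ℚ.* ℕ→ℚ C → A + C ≤ D →
              ℕ→ℚ (A + t) ℚ.≤ r ℚ.* ℕ→ℚ D
ratio-bound {r} {s} A t C D 1≤r s≤r t≤ A+C≤D = begin
  ℕ→ℚ (A + t)                        ≡⟨ ℕ→ℚ-+ A t ⟩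
  ℕ→ℚ A ℚ.+ ℕ→ℚ t                    ≤⟨ ℚₚ.+-mono-≤ A≤ (ℚₚ.≤-trans t≤ (ℚₚ.*-monoʳ-≤-nonNeg (ℕ→ℚ C) ⦃ ℕ→ℚ-nonNeg C ⦄ s≤r)) ⟩
  r ℚ.* ℕ→ℚ A ℚ.+ r ℚ.* ℕ→ℚ C        ≡⟨ ℚₚ.*-distribˡ-+ r (ℕ→ℚ A) (ℕ→ℚ C) ⟨
  r ℚ.* (ℕ→ℚ A ℚ.+ ℕ→ℚ C)            ≡⟨ cong (r ℚ.*_) (ℕ→ℚ-+ A C) ⟨
  r ℚ.* ℕ→ℚ (A + C)                  ≤⟨ ℚₚ.*-monoˡ-≤-nonNeg r ⦃ ℚ.nonNegative (ℚₚ.≤-trans 0≤1 1≤r) ⦄ (ℕ→ℚ-mono A+C≤D) ⟩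
  r ℚ.* ℕ→ℚ D                        ∎
  where
  open ℚₚ.≤-Reasoning
  0≤1 : 0ℚ ℚ.≤ 1ℚ
  0≤1 = ℕ→ℚ-mono {0} {1} z≤n
  A≤ : ℕ→ℚ A ℚ.≤ r ℚ.* ℕ→ℚ A
  A≤ = ℚₚ.≤-trans (ℚₚ.≤-reflexive (sym (ℚₚ.*-identityˡ (ℕ→ℚ A)))) (ℚₚ.*-monoʳ-≤-nonNeg (ℕ→ℚ A) ⦃ ℕ→ℚ-nonNeg A ⦄ 1≤r)

module Transfer where
  open SetCoverInstance
  open Reduction
  open Language SetCoverInstance N (λ i → cons (elements i) (encode i))

  prepareᶠ : Fn
  prepareᶠ = (recurᶠ range-body ∘ᶠ (constᶠ nil ,ᶠ (constᶠ nil ,ᶠ fstᶠ))) ,ᶠ idᶠ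

  prepareᶠ-⇓ : ∀ i → prepareᶠ ▹ encode i ⇓ cons (elements i) (encode i) ⟨ 29 + N i * 12 ⟩
  prepareᶠ-⇓ i = ⇓-mono (≤-trans (≤-reflexive (arith (suc (m i) * 12))) (+-monoʳ-≤ 29 (*-monoˡ-≤ 12 (m<N i))))
    (,ᶠ-⇓ {recurᶠ range-body ∘ᶠ (constᶠ nil ,ᶠ (constᶠ nil ,ᶠ fstᶠ))} {idᶠ}
      (∘ᶠ-⇓ {recurᶠ range-body} {constᶠ nil ,ᶠ (constᶠ nil ,ᶠ fstᶠ)}
        (,ᶠ-⇓ {constᶠ nil} {constᶠ nil ,ᶠ fstᶠ} (constᶠ-⇓ nil)
          (⇓-result (cong (cons nil) (sym (universe (m i)))) (,ᶠ-⇓ {constᶠ nil} {fstᶠ} (constᶠ-⇓ nil) fstᶠ-⇓)))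
        (rangeᶠ-⇓ (λ _ → nil) 0 (tt ∷ Vec.replicate (m i) tt)))
      idᶠ-⇓)
    where
    arith : ∀ m → 5 + ((3 + ((5 + (1 + (5 + (1 + 3)))) + (5 + m))) + 1) ≡ 29 + m
    arith = solve-∀

  reductionᶠ : Fn
  reductionᶠ = code reducedᵀ ∘ᶠ prepareᶠ

  reductionᶠ-⇓ : ∀ i → reductionᶠ ▹ encode i ⇓ Problem.encode (CVC SplitDeletionSet) (reduced i)
                 ⟨ 3 + ((29 + N i * 12) + eval (bound reducedᵀ) (N i) * 1) ⟩
  reductionᶠ-⇓ i = ∘ᶠ-⇓ {code reducedᵀ} {prepareᶠ} (prepareᶠ-⇓ i) (run reducedᵀ i tt)

  sizeBound : Bound
  sizeBound = # 2 :+ ((# 1 :+ order :* (# 1 :+ (# 1 :+ order :* # 4))) :+ ((# 1 :+ order :* # 4) :+ (# 1 :+ (𝕏 :+ 𝕏) :* # 4)))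
    where
    order : Bound
    order = 𝕏 :+ (𝕏 :+ 𝕏)

  size-reduced : ∀ i → size (Problem.encode (CVC SplitDeletionSet) (reduced i)) ≤ eval sizeBound (N i)
  size-reduced i = ≤-trans (size-instance (reduced i))
    (outputBound-mono {In.M i + (In.M i + In.k i)} {N i + (N i + N i)} {digits (fromℕ (In.M i + ℓ i))} {N i + N i}
      (Length.len≤ 𝕋ot i) (≤-trans (digits-+ (In.M i) (ℓ i)) (+-mono-≤ (m<N i) (digits-ℓ i))))

  timeBound : Bound
  timeBound = # 8 :+ ((# 29 :+ 𝕏 :* # 12) :+ bound reducedᵀ :* # 1)

  module _ {f g : ℕ → ℚ} (1≤f : ∀ k → 1ℚ ℚ.≤ f k) (g≤f : ∀ k → g k ℚ.≤ f k)
           (solution : CVC SplitDeletionSet solvableInO* g) where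

    P : Program
    P = proj₁ solution

    c : ℕ
    c = proj₁ (proj₂ solution)

    answer : SetCoverInstance → Bool
    answer i = proj₁ (proj₂ (proj₂ solution) (reduced i))

    steps : SetCoverInstance → ℕ
    steps i = proj₁ (proj₂ (proj₂ (proj₂ solution) (reduced i)))

    total : Bound
    total = timeBound :+ # c :* sizeBound :^ c

    exponent : ℕ
    exponent = proj₁ (eval-polynomial total)

    answer-reflects : ∀ i → Reflects (Problem.Yes SetCover i) (answer i)
    answer-reflects i = reflects-map (In.solution⇒cover i {ℓ i}) (In.cover⇒solution i {ℓ i})
      (proj₁ (proj₂ (proj₂ (proj₂ (proj₂ (proj₂ solution) (reduced i))))))

    size^ : ∀ s b m → s ≤ eval b m → c * s ℕ.^ c ≤ eval (# c :* b :^ c) m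
    size^ s b m s≤ = *-monoʳ-≤ c (≤-trans (ℕₚ.^-monoˡ-≤ c s≤) (≤-reflexive (sym (eval-:^ b c m))))

    -- By `∣S∣≡m` the reduction preserves the parameter exactly, so only the polynomial factor
    -- grows, through the size of the reduced instance.
    setCoverSolvable : SetCover solvableInO* f
    setCoverSolvable = decided SetCover f (fromProgram P ∘ᶠ reductionᶠ) exponent answer
      (λ i → 3 + ((3 + ((29 + N i * 12) + eval (bound reducedᵀ) (N i) * 1)) + steps i))
      (λ i → ∘ᶠ-⇓ {fromProgram P} {reductionᶠ} (reductionᶠ-⇓ i) (fromProgram-⇓ P (proj₁ (proj₂ (proj₂ (proj₂ (proj₂ solution) (reduced i)))))))
      answer-reflects
      λ i → ratio-bound (8 + ((29 + N i * 12) + eval (bound reducedᵀ) (N i) * 1)) (steps i)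
        (c * size (Problem.encode (CVC SplitDeletionSet) (reduced i)) ℕ.^ c) (exponent * N i ℕ.^ exponent)
        (1≤f (m i)) (g≤f (m i))
        (subst (λ k → ℕ→ℚ (steps i) ℚ.≤ g k ℚ.* ℕ→ℚ (c * size (Problem.encode (CVC SplitDeletionSet) (reduced i)) ℕ.^ c))
               {Problem.parameter (CVC SplitDeletionSet) (reduced i)} (In.∣S∣≡m i) (proj₂ (proj₂ (proj₂ (proj₂ (proj₂ (proj₂ solution) (reduced i)))))))
        (≤-trans (+-monoʳ-≤ (eval timeBound (N i)) (size^ _ sizeBound (N i) (size-reduced i)))
                    (proj₂ (eval-polynomial total) (N i) (size≥1 (encode i))))

-- The lower bound for every base

1≤^ℚ : ∀ {r} → 1ℚ ℚ.≤ r → ∀ k → 1ℚ ℚ.≤ r ^ k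
1≤^ℚ {r} 1≤r zero    = ℚₚ.≤-refl
1≤^ℚ {r} 1≤r (suc k) = ℚₚ.≤-trans 1≤r (ℚₚ.≤-trans (ℚₚ.≤-reflexive (sym (ℚₚ.*-identityʳ r)))
  (ℚₚ.*-monoˡ-≤-nonNeg r ⦃ ℚ.nonNegative (ℚₚ.≤-trans (ℕ→ℚ-mono {0} {1} z≤n) 1≤r) ⦄ (1≤^ℚ 1≤r k)))

^ℚ≤1 : ∀ {r} → 0ℚ ℚ.≤ r → r ℚ.≤ 1ℚ → ∀ k → r ^ k ℚ.≤ 1ℚ
^ℚ≤1 {r} 0≤r r≤1 zero    = ℚₚ.≤-refl
^ℚ≤1 {r} 0≤r r≤1 (suc k) = ℚₚ.≤-trans (ℚₚ.*-monoˡ-≤-nonNeg r ⦃ ℚ.nonNegative 0≤r ⦄ (^ℚ≤1 0≤r r≤1 k))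
  (ℚₚ.≤-trans (ℚₚ.≤-reflexive (ℚₚ.*-identityʳ r)) r≤1)

steps≥1 : ∀ {p n} {δ : Functions p} {ρ : Vec Tree n} {e v t} → δ ∙ ρ ⊢ e ⇓ v [ t ] → 1 ≤ t
steps≥1 (var _)         = s≤s z≤n
steps≥1 nil             = s≤s z≤n
steps≥1 (cons _ _)      = s≤s z≤n
steps≥1 (case-nil _ _)  = s≤s z≤n
steps≥1 (case-cons _ _) = s≤s z≤n
steps≥1 (bind _ _)      = s≤s z≤n
steps≥1 (call _ _)      = s≤s z≤n

singleVertex : CVCInstance SplitDeletionSet
singleVertex = record
  { n = 1 ; G = record { adj = λ _ _ → false ; sym = λ _ _ → refl ; irrefl = λ _ → refl } ; S = true ∷ []
  ; deletionSet = (λ _ → false) , (λ _ _ ()) , (λ _ _ _ _ ()) ; ℓ = 1 ; ℓ>0 = s≤s z≤n }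

nonpositive-bound : ∀ {r} t D → r ℚ.≤ 0ℚ → 1 ≤ t → ¬ (ℕ→ℚ t ℚ.≤ r ^ 1 ℚ.* ℕ→ℚ D)
nonpositive-bound {r} t D r≤0 1≤t t≤ = 1≰0 (begin
  1ℚ                ≤⟨ ℕ→ℚ-mono {1} {t} 1≤t ⟩
  ℕ→ℚ t             ≤⟨ t≤ ⟩
  r ^ 1 ℚ.* ℕ→ℚ D   ≡⟨ cong (ℚ._* ℕ→ℚ D) (ℚₚ.*-identityʳ r) ⟩
  r ℚ.* ℕ→ℚ D       ≤⟨ ℚₚ.*-monoʳ-≤-nonNeg (ℕ→ℚ D) ⦃ ℕ→ℚ-nonNeg D ⦄ r≤0 ⟩
  0ℚ ℚ.* ℕ→ℚ D      ≡⟨ ℚₚ.*-zeroˡ (ℕ→ℚ D) ⟩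
  0ℚ                ∎)
  where
  open ℚₚ.≤-Reasoning
  1≰0 : ¬ 1ℚ ℚ.≤ 0ℚ
  1≰0 (ℚ.*≤* (ℤ.+≤+ ()))

-- On an instance of parameter 1 the time bound is at most 0, yet every evaluation takes a step.
nonpositive-base : ∀ {r} → r ℚ.≤ 0ℚ → ¬ (CVC SplitDeletionSet solvableInO* (λ k → r ^ k))
nonpositive-base r≤0 (P , c , solves) =
  let _ , t , d , _ , t≤ = solves singleVertex in
  nonpositive-bound t (c * size (Problem.encode (CVC SplitDeletionSet) singleVertex) ℕ.^ c) r≤0 (steps≥1 d) t≤

-- For r < 1 the time of the reduction is not absorbed by the exponential
-- factor; then the larger base q is refuted instead.
splitUnsolvable : ∀ {r q} → 1ℚ ℚ.≤ q → ¬ (SetCover solvableInO* (λ k → r ^ k)) →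
                  ¬ (SetCover solvableInO* (λ k → q ^ k)) → ¬ (CVC SplitDeletionSet solvableInO* (λ k → r ^ k))
splitUnsolvable {r} {q} 1≤q unsolvable unsolvable′ = cases (1ℚ ℚₚ.≤? r) (r ℚₚ.≤? 0ℚ)
  where
  cases : Dec (1ℚ ℚ.≤ r) → Dec (r ℚ.≤ 0ℚ) → ¬ (CVC SplitDeletionSet solvableInO* (λ k → r ^ k))
  cases (yes 1≤r) _         solvable = unsolvable (Transfer.setCoverSolvable (1≤^ℚ 1≤r) (λ _ → ℚₚ.≤-refl) solvable)
  cases (no _)    (yes r≤0) solvable = nonpositive-base r≤0 solvable
  cases (no 1≰r)  (no r≰0)  solvable = unsolvable′ (Transfer.setCoverSolvable (1≤^ℚ 1≤q) r^≤q^ solvable)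
    where
    r^≤q^ : ∀ k → r ^ k ℚ.≤ q ^ k
    r^≤q^ k = ℚₚ.≤-trans (^ℚ≤1 (ℚₚ.<⇒≤ (ℚₚ.≰⇒> r≰0)) (ℚₚ.<⇒≤ (ℚₚ.≰⇒> 1≰r)) k) (1≤^ℚ 1≤q k)

splitLowerBound : SetCoverConjecture → ∀ (e : ℚ) → 0ℚ < e →
                  ¬ (CVC SplitDeletionSet solvableInO* (λ k → (ℕ→ℚ 2 - e) ^ k))
-- The larger base is `2 - 1 = 1`, refuted by the conjecture for `ε = 1`.
splitLowerBound conjecture e 0<e = splitUnsolvable {ℕ→ℚ 2 - e} {ℕ→ℚ 2 - 1ℚ} (ℚₚ.≤-refl {1ℚ})
  (conjecture e 0<e) (conjecture 1ℚ (ℚ.*<* (ℤ.+<+ (s≤s z≤n))))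

theorem3 : (CVC SplitDeletionSet solvableInO* (λ k → ℕ→ℚ 3 ^ k)) ×
    (SetCoverConjecture →
    ∀ (ε : ℚ) → 0ℚ < ε →
    ¬ (CVC SplitDeletionSet solvableInO* (λ k → (ℕ→ℚ 2 - ε) ^ k))) ×
    (CVC CliqueDeletionSet solvableInO* (λ k → ℕ→ℚ 2 ^ k))
theorem3 = splitSolvable , splitLowerBound , cliqueSolvable
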